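{- Let $P_\bullet$, $Q_\bullet$, $R_\bullet$ be reduced expressions expressing double cosets $p$, $q$, $r$ respectively, composable in the sense that $P_\bullet\circ Q_\bullet\circ R_\bullet$ is defined, and suppose that $P_\bullet\circ Q_\bullet\circ R_\bullet$ is a reduced expression (expressing the reduced composition $p.q.r$). Then $$\mathrm{id}_{\mathrm{BS}(P_\bullet)}\otimes \mathrm{End}_{<q}(\mathrm{BS}(Q_\bullet))\otimes \mathrm{id}_{\mathrm{BS}(R_\bullet)}\subset \mathrm{End}_{<p.q.r}(\mathrm{BS}(P_\bullet\circ Q_\bullet\circ R_\bullet)).$$
   Context: Cosets. $(W,S)$ is a Coxeter system with length function $\ell$. For $I\subset S$, $W_I$ is the subgroup generated by $I$; $I$ is finitary if $W_I$ is finite, and then $w_I$ is its longest element and $\ell(I):=\ell(w_I)$. The $*$-product on $W$ is the associative monoid product determined by $s*w=sw$ if $sw>w$ and $s*w=w$ if $sw<w$ ($s\in S$, $w\in W$). For finitary $I,J$, an $(I,J)$-coset is an element $p\in W_I\backslash W/W_J$ (regarded as a triple $(p,I,J)$), with maximal and minimal elements $\overline p,\underline p$; $p\le q$ means $\underline p\le\underline q$ in Bruhat order. Expressions. A (singlestep) expression is a sequence $I_\bullet=[I_0,\dots,I_d]$ of finitary subsets of $S$, consecutive ones differing by adding or removing one element. It expresses the unique $(I_0,I_d)$-coset $q$ with $\overline q=w_{I_0}*\cdots*w_{I_d}$. Recording local maxima and minima gives $I_0=L_0\subset K_1\supset L_1\subset\cdots\subset K_m\supset L_m=I_d$ (with $L_0=K_1$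 if $I_\bullet$ starts by decreasing and $K_m=L_m$ if it ends by increasing); $I_\bullet$ is reduced if $\overline q=(w_{K_1}w_{L_1}^{ -1})\cdots(w_{K_{m-1}}w_{L_{m-1}}^{ -1})w_{K_m}$ with lengths of the factors adding up to $\ell(\overline q)$. Expressions with matching end and start are concatenated: $[P_0,\dots,P_c]\circ[Q_0,\dots,Q_d]=[P_0,\dots,P_c=Q_0,\dots,Q_d]$. If $P_\bullet\circ Q_\bullet\circ R_\bullet$ is reduced, $p.q.r$ denotes the coset it expresses. Realization. $V$ is a realization of $(W,S)$ over a field $\Bbbk$: a finite-dimensional $\Bbbk$-vector space with $\alpha_s^\vee\in V$, $\alpha_s\in V^*$ ($s\in S$), $\langle\alpha_s^\vee,\alpha_s\rangle=2$, such that $s(v)=v-\alpha_s(v)\alpha_s^\vee$ defines a representation of $W$, with the standard Elias–Williamson technical condition that the two-coloured quantum numbers $[m_{st}]_s,[m_{st}]_t$ vanish when $m_{st}<\infty$ (defined by $[0]=0$, $[1]=1$, $[2]_s=-\langle\alpha_s^\vee,\alpha_t\rangle$, $[2]_t=-\langle\alpha_t^\vee,\alpha_s\rangle$, $[2]_s[n]_t=[n+1]_s+[n-1]_s$ and symmetrically). It is assumed balanced ($[m_{st}-1]_s=[m_{st}-1]_t=1$ for $m_{st}<\infty$), reflection faithful ($W$ acts faithfully, and $x\in W$ fixes a codimension one subspace exactly when it is conjugate to an element of $S$) and to satisfy generalized Demazure surjectivity (for each finitary $I$ the Demazure operator $\partial_{w_I}:R\to R^I$, composed from $\partial_s(f)=(f-sf)/\alpha_s$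 along a reduced word of $w_I$, is surjective). $R=\mathrm{Sym}(V^*)$ is graded with $V^*$ in degree 2, and $R^I$ is the subring of $W_I$-invariants. Bimodules. $M(i)$ is the grading shift with $M(i)^j=M^{i+j}$. For $I\subset J$ finitary, $\mathrm{BS}([I,J])=R^I$ as $(R^I,R^J)$-bimodule and $\mathrm{BS}([J,I])=R^I(\ell(J)-\ell(I))$ as $(R^J,R^I)$-bimodule; $\mathrm{BS}([I])=R^I$, and $\mathrm{BS}(I_\bullet)=\mathrm{BS}([I_0,I_1])\otimes_{R^{I_1}}\cdots\otimes_{R^{I_{d-1}}}\mathrm{BS}([I_{d-1},I_d])$. Thus $\mathrm{BS}(P_\bullet\circ Q_\bullet\circ R_\bullet)$ is the tensor product $\mathrm{BS}(P_\bullet)\otimes\mathrm{BS}(Q_\bullet)\otimes\mathrm{BS}(R_\bullet)$ over the intermediate invariant rings. $\mathrm{Hom}(M,N)=\bigoplus_{i\in\mathbb Z}\mathrm{Hom}^i(M,N)$, where $\mathrm{Hom}^i(M,N)$ is the space of degree zero bimodule maps $M\to N(i)$; $\mathrm{End}(M)=\mathrm{Hom}(M,M)$. Lower terms. For a downward-closed set $C$ of $(I,J)$-cosets, $\mathrm{Hom}_C$ is the two-sided ideal in the category of graded $(R^I,R^J)$-bimodules generated by the identity maps of $\mathrm{BS}(M_\bullet)$ for all expressions $M_\bullet$ expressing some $q\in C$; i.e. it consists of finite sums of morphisms each factoring through such a $\mathrm{BS}(M_\bullet)$. $\mathrm{Hom}_{<p}$ is $\mathrm{Hom}_C$ for $C=\{q\mid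 q<p\}$, and $\mathrm{End}_{<p}(B)=\mathrm{Hom}_{<p}(B,B)$. -}

module Defs where

open import Level using (Level; 0ℓ; _⊔_) renaming (suc to lsuc)
open import Algebra.Bundles using (Group; AbelianGroup; Ring; CommutativeRing)
open import Algebra.Apartness.Bundles using (HeytingCommutativeRing; HeytingField)
open import Algebra.Module.Bundles using (Bimodule; Module)
open import Algebra.Module.Morphism.Structures using (IsBimoduleHomomorphism; IsModuleHomomorphism)
open import Algebra.Morphism.Structures using (IsGroupHomomorphism)
open import Axiom.ExcludedMiddle using (ExcludedMiddle)
open import Data.Empty using (⊥-elim)
open import Data.Integer.Base using (ℤ; +_; 0ℤ) renaming (_+_ to _+ℤ_; _-_ to _-ℤ_)
open import Data.List.Base using (List; []; _∷_; _++_; concat; replicate; reverse; length; map; foldr)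
open import Data.List.Extrema.Nat using (argmax)
open import Data.List.Relation.Unary.All as All using (All)
open import Data.List.Relation.Unary.Any using (Any)
open import Data.Nat.Base using (ℕ; zero; suc; _≤_; _<_; _∸_)
open import Data.Nat.ListAction using (sum)
open import Data.Product.Base using (∃-syntax; Σ-syntax; _×_; _,_; proj₁; proj₂)
open import Data.Sum.Base using (inj₁)
open import Data.Vec.Functional using (Vector)
open import Function.Base using (id)
open import Function.Bundles using (_⇔_)
open import Relation.Binary.PropositionalEquality.Core as ≡ using (_≡_; _≢_)
open import Relation.Nullary using (¬_; yes; no)
open import Relation.Unary using (Pred; _∈_; _∉_; _⊆_; _≐_; _∪_; ｛_｝)
import Algebra.Definitions.RawMonoid as RawMonoidSum
import Algebra.Module.Construct.TensorUnit as TensorUnit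
import Algebra.Properties.AbelianGroup as AbelianGroupProperties
import Algebra.Properties.CommutativeSemigroup as CommutativeSemigroupProperties
import Algebra.Properties.Group as GroupProperties
import Data.Integer.Properties as ℤₚ
import Data.List.Properties as Listₚ
import Data.Nat.Properties as ℕₚ

additive⇒isGroupHomomorphism :
  ∀ {a b c d} (G : AbelianGroup a b) (H : AbelianGroup c d)
  (f : AbelianGroup.Carrier G → AbelianGroup.Carrier H) →
  (∀ {x y} → AbelianGroup._≈_ G x y → AbelianGroup._≈_ H (f x) (f y)) →
  (∀ x y → AbelianGroup._≈_ H (f (AbelianGroup._∙_ G x y)) (AbelianGroup._∙_ H (f x) (f y))) →
  IsGroupHomomorphism (AbelianGroup.rawGroup G) (AbelianGroup.rawGroup H) f
additive⇒isGroupHomomorphism G H f f-cong f-homo = record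
  { isMonoidHomomorphism = record
    { isMagmaHomomorphism = record
      { isRelHomomorphism = record { cong = f-cong }
      ; homo = f-homo
      }
    ; ε-homo = f-ε
    }
  ; ⁻¹-homo = λ x → P.inverseˡ-unique (f (x G.⁻¹)) (f x)
      (H.trans (H.sym (f-homo (x G.⁻¹) x)) (H.trans (f-cong (G.inverseˡ x)) f-ε))
  }
  where
  module G = AbelianGroup G
  module H = AbelianGroup H
  module P = GroupProperties H.group
  f-ε : f G.ε H.≈ H.ε
  f-ε = P.identityˡ-unique (f G.ε) (f G.ε)
    (H.trans (H.sym (f-homo G.ε G.ε)) (f-cong (G.identityˡ G.ε)))

-- A grading is given by its homogeneous components, as predicates on the
-- underlying set.  That the components decompose the whole as a direct sum is
-- not a field: it holds for Sym(V*), its invariant subrings, and the bimodules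
-- built from them by restriction, shift and tensor product, which are the only
-- graded objects used.

module GradedAlgebra (a : Level) where

  record GradedRing : Set (lsuc a) where
    field
      commutativeRing : CommutativeRing a a
    open CommutativeRing commutativeRing public
    field
      Homogeneous      : ℤ → Pred Carrier a
      homogeneous-resp : ∀ {d x y} → x ≈ y → Homogeneous d x → Homogeneous d y
      homogeneous-0    : ∀ {d} → Homogeneous d 0#
      homogeneous-+    : ∀ {d x y} → Homogeneous d x → Homogeneous d y → Homogeneous d (x + y)
      homogeneous-neg  : ∀ {d x} → Homogeneous d x → Homogeneous d (- x)
      homogeneous-1    : Homogeneous 0ℤ 1#
      homogeneous-*    : ∀ {i j x y} → Homogeneous i x → Homogeneous j y → Homogeneous (i +ℤ j) (x * y)

  record GradedBimodule (A B : GradedRing) : Set (lsuc a) where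
    private
      module A = GradedRing A
      module B = GradedRing B
    field
      bimodule : Bimodule A.ring B.ring a a
    open Bimodule bimodule public
    field
      Homogeneous      : ℤ → Pred Carrierᴹ a
      homogeneous-resp : ∀ {d x y} → x ≈ᴹ y → Homogeneous d x → Homogeneous d y
      homogeneous-0    : ∀ {d} → Homogeneous d 0ᴹ
      homogeneous-+    : ∀ {d x y} → Homogeneous d x → Homogeneous d y → Homogeneous d (x +ᴹ y)
      homogeneous-neg  : ∀ {d x} → Homogeneous d x → Homogeneous d (-ᴹ x)
      homogeneous-*ₗ   : ∀ {i j x y} → A.Homogeneous i x → Homogeneous j y → Homogeneous (i +ℤ j) (x *ₗ y)
      homogeneous-*ᵣ   : ∀ {i j x y} → Homogeneous i x → B.Homogeneous j y → Homogeneous (i +ℤ j) (x *ᵣ y)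

  open GradedBimodule using (bimodule)

  -- M ⟨ i ⟩ is the shift M(i), that is M(i)ʲ = Mⁱ⁺ʲ.
  _⟨_⟩ : ∀ {A B} → GradedBimodule A B → ℤ → GradedBimodule A B
  M ⟨ i ⟩ = record
    { bimodule         = bimodule M
    ; Homogeneous      = λ j → Homogeneous (i +ℤ j)
    ; homogeneous-resp = homogeneous-resp
    ; homogeneous-0    = homogeneous-0
    ; homogeneous-+    = homogeneous-+
    ; homogeneous-neg  = homogeneous-neg
    ; homogeneous-*ₗ   = λ {j} {l} x∈ y∈ →
        ≡.subst (λ d → Homogeneous d _) (left j l) (homogeneous-*ₗ x∈ y∈)
    ; homogeneous-*ᵣ   = λ {j} {l} x∈ y∈ →
        ≡.subst (λ d → Homogeneous d _) (ℤₚ.+-assoc i j l) (homogeneous-*ᵣ x∈ y∈)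
    }
    where
    open GradedBimodule M hiding (bimodule)
    left : ∀ j l → j +ℤ (i +ℤ l) ≡ i +ℤ (j +ℤ l)
    left j l = ≡.trans (≡.sym (ℤₚ.+-assoc j i l))
      (≡.trans (≡.cong (_+ℤ l) (ℤₚ.+-comm j i)) (ℤₚ.+-assoc i j l))

  record BimoduleMap {A B : Ring a a} (M N : Bimodule A B a a) : Set a where
    field
      fun            : Bimodule.Carrierᴹ M → Bimodule.Carrierᴹ N
      isHomomorphism : IsBimoduleHomomorphism (Bimodule.rawBimodule M) (Bimodule.rawBimodule N) fun
    open IsBimoduleHomomorphism isHomomorphism public

  open BimoduleMap using (fun)

  mkMap : ∀ {A B : Ring a a} (M N : Bimodule A B a a)
    (f : Bimodule.Carrierᴹ M → Bimodule.Carrierᴹ N) →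
    (∀ {x y} → Bimodule._≈ᴹ_ M x y → Bimodule._≈ᴹ_ N (f x) (f y)) →
    (∀ x y → Bimodule._≈ᴹ_ N (f (Bimodule._+ᴹ_ M x y)) (Bimodule._+ᴹ_ N (f x) (f y))) →
    (∀ r x → Bimodule._≈ᴹ_ N (f (Bimodule._*ₗ_ M r x)) (Bimodule._*ₗ_ N r (f x))) →
    (∀ r x → Bimodule._≈ᴹ_ N (f (Bimodule._*ᵣ_ M x r)) (Bimodule._*ᵣ_ N (f x) r)) →
    BimoduleMap M N
  mkMap M N f f-cong f-+ f-*ₗ f-*ᵣ = record
    { fun = f
    ; isHomomorphism = record
      { +ᴹ-isGroupHomomorphism =
          additive⇒isGroupHomomorphism (Bimodule.+ᴹ-abelianGroup M) (Bimodule.+ᴹ-abelianGroup N) f f-cong f-+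
      ; *ₗ-homo = f-*ₗ
      ; *ᵣ-homo = f-*ᵣ
      }
    }

  idMap : ∀ {A B : Ring a a} {M : Bimodule A B a a} → BimoduleMap M M
  idMap {M = M} = mkMap M M id id (λ _ _ → ≈ᴹ-refl) (λ _ _ → ≈ᴹ-refl) (λ _ _ → ≈ᴹ-refl)
    where open Bimodule M

  infixr 9 _∘ᴹ_
  _∘ᴹ_ : ∀ {A B : Ring a a} {M N P : Bimodule A B a a} →
    BimoduleMap N P → BimoduleMap M N → BimoduleMap M P
  _∘ᴹ_ {M = M} {N} {P} g f = mkMap M P (λ x → fun g (fun f x))
    (λ x≈y → g.⟦⟧-cong (f.⟦⟧-cong x≈y))
    (λ x y → P.≈ᴹ-trans (g.⟦⟧-cong (f.+ᴹ-homo x y)) (g.+ᴹ-homo (fun f x) (fun f y)))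
    (λ r x → P.≈ᴹ-trans (g.⟦⟧-cong (f.*ₗ-homo r x)) (g.*ₗ-homo r (fun f x)))
    (λ r x → P.≈ᴹ-trans (g.⟦⟧-cong (f.*ᵣ-homo r x)) (g.*ᵣ-homo r (fun f x)))
    where
    module f = BimoduleMap f
    module g = BimoduleMap g
    module P = Bimodule P

  IsDegreeZero : ∀ {A B} (M N : GradedBimodule A B) → BimoduleMap (bimodule M) (bimodule N) → Set a
  IsDegreeZero M N f = ∀ {d x} → GradedBimodule.Homogeneous M d x → GradedBimodule.Homogeneous N d (fun f x)

  Homⁱ : ∀ {A B} → ℤ → (M N : GradedBimodule A B) → Set a
  Homⁱ i M N = Σ[ f ∈ BimoduleMap (bimodule M) (bimodule (N ⟨ i ⟩)) ] IsDegreeZero M (N ⟨ i ⟩) f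

  IsSum : ∀ {A B : Ring a a} {M N : Bimodule A B a a} →
    BimoduleMap M N → List (BimoduleMap M N) → Set a
  IsSum {N = N} f fs = ∀ x → fun f x ≈ᴹ foldr (λ g y → fun g x +ᴹ y) 0ᴹ fs
    where open Bimodule N

  -- The direct sum of the Homⁱ, realised inside the bimodule maps: finite sums
  -- of homogeneous maps of possibly different degrees.
  record Hom {A B} (M N : GradedBimodule A B) : Set a where
    field
      underlying : BimoduleMap (bimodule M) (bimodule N)
      components : List (∃[ i ] Homⁱ i M N)
      isSum      : IsSum underlying (map (λ g → proj₁ (proj₂ g)) components)

  infix 4 _≅_
  record _≅_ {A B} (M N : GradedBimodule A B) : Set a where
    private
      module M = GradedBimodule M
      module N = GradedBimodule N
    field
      to        : BimoduleMap (bimodule M) (bimodule N)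
      from      : BimoduleMap (bimodule N) (bimodule M)
      to-deg    : IsDegreeZero M N to
      from-deg  : IsDegreeZero N M from
      to∘from   : ∀ x → fun to (fun from x) N.≈ᴹ x
      from∘to   : ∀ x → fun from (fun to x) M.≈ᴹ x

  ≅-refl : ∀ {A B} {M : GradedBimodule A B} → M ≅ M
  ≅-refl {M = M} = record
    { to = idMap ; from = idMap ; to-deg = id ; from-deg = id
    ; to∘from = λ _ → ≈ᴹ-refl ; from∘to = λ _ → ≈ᴹ-refl }
    where open GradedBimodule M hiding (bimodule)

  ≅-trans : ∀ {A B} {M N P : GradedBimodule A B} → M ≅ N → N ≅ P → M ≅ P
  ≅-trans {M = M} {N} {P} φ ψ = record
    { to = ψ.to ∘ᴹ φ.to
    ; from = φ.from ∘ᴹ ψ.from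
    ; to-deg = λ h → ψ.to-deg (φ.to-deg h)
    ; from-deg = λ h → φ.from-deg (ψ.from-deg h)
    ; to∘from = λ x → P.≈ᴹ-trans (BimoduleMap.⟦⟧-cong ψ.to (φ.to∘from _)) (ψ.to∘from x)
    ; from∘to = λ x → M.≈ᴹ-trans (BimoduleMap.⟦⟧-cong φ.from (ψ.from∘to _)) (φ.from∘to x)
    }
    where
    module φ = _≅_ φ
    module ψ = _≅_ ψ
    module M = GradedBimodule M
    module P = GradedBimodule P

  unit : (A : GradedRing) → GradedBimodule A A
  unit A = record
    { bimodule         = TensorUnit.bimodule {R = ring}
    ; Homogeneous      = Homogeneous
    ; homogeneous-resp = homogeneous-resp
    ; homogeneous-0    = homogeneous-0
    ; homogeneous-+    = homogeneous-+
    ; homogeneous-neg  = homogeneous-neg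
    ; homogeneous-*ₗ   = homogeneous-*
    ; homogeneous-*ᵣ   = homogeneous-*
    }
    where open GradedRing A

  module Tensor {A B C : GradedRing} (M : GradedBimodule A B) (N : GradedBimodule B C) where
    private
      module A = GradedRing A
      module B = GradedRing B
      module C = GradedRing C
      module M = GradedBimodule M
      module N = GradedBimodule N

    infixl 7 _⊗ₑ_
    infixl 6 _+ₑ_
    infix  8 -ₑ_
    infix  4 _≈ₑ_

    data Element : Set a where
      _⊗ₑ_ : M.Carrierᴹ → N.Carrierᴹ → Element
      0ₑ   : Element
      _+ₑ_ : Element → Element → Element
      -ₑ_  : Element → Element

    data _≈ₑ_ : Element → Element → Set a where
      ≈-refl     : ∀ {x} → x ≈ₑ x
      ≈-sym      : ∀ {x y} → x ≈ₑ y → y ≈ₑ x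
      ≈-trans    : ∀ {x y z} → x ≈ₑ y → y ≈ₑ z → x ≈ₑ z
      +-cong     : ∀ {x x′ y y′} → x ≈ₑ x′ → y ≈ₑ y′ → x +ₑ y ≈ₑ x′ +ₑ y′
      neg-cong   : ∀ {x x′} → x ≈ₑ x′ → -ₑ x ≈ₑ -ₑ x′
      +-assoc    : ∀ x y z → (x +ₑ y) +ₑ z ≈ₑ x +ₑ (y +ₑ z)
      +-comm     : ∀ x y → x +ₑ y ≈ₑ y +ₑ x
      +-idˡ      : ∀ x → 0ₑ +ₑ x ≈ₑ x
      +-invˡ     : ∀ x → -ₑ x +ₑ x ≈ₑ 0ₑ
      ⊗-cong     : ∀ {m m′ n n′} → m M.≈ᴹ m′ → n N.≈ᴹ n′ → m ⊗ₑ n ≈ₑ m′ ⊗ₑ n′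
      ⊗-distribʳ : ∀ m m′ n → (m M.+ᴹ m′) ⊗ₑ n ≈ₑ m ⊗ₑ n +ₑ m′ ⊗ₑ n
      ⊗-distribˡ : ∀ m n n′ → m ⊗ₑ (n N.+ᴹ n′) ≈ₑ m ⊗ₑ n +ₑ m ⊗ₑ n′
      ⊗-balanced : ∀ m b n → (m M.*ᵣ b) ⊗ₑ n ≈ₑ m ⊗ₑ (b N.*ₗ n)

    data Homogeneousₑ : ℤ → Element → Set a where
      resp : ∀ {d x y} → x ≈ₑ y → Homogeneousₑ d x → Homogeneousₑ d y
      zero : ∀ {d} → Homogeneousₑ d 0ₑ
      add  : ∀ {d x y} → Homogeneousₑ d x → Homogeneousₑ d y → Homogeneousₑ d (x +ₑ y)
      neg  : ∀ {d x} → Homogeneousₑ d x → Homogeneousₑ d (-ₑ x)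
      pure : ∀ {d i j m n} → i +ℤ j ≡ d → M.Homogeneous i m → N.Homogeneous j n →
             Homogeneousₑ d (m ⊗ₑ n)

    +-abelianGroup : AbelianGroup a a
    +-abelianGroup = record
      { Carrier = Element ; _≈_ = _≈ₑ_ ; _∙_ = _+ₑ_ ; ε = 0ₑ ; _⁻¹ = -ₑ_
      ; isAbelianGroup = record
        { isGroup = record
          { isMonoid = record
            { isSemigroup = record
              { isMagma = record
                { isEquivalence = record { refl = ≈-refl ; sym = ≈-sym ; trans = ≈-trans }
                ; ∙-cong = +-cong
                }
              ; assoc = +-assoc
              }
            ; identity = +-idˡ , λ x → ≈-trans (+-comm x 0ₑ) (+-idˡ x)
            }
          ; inverse = +-invˡ , λ x → ≈-trans (+-comm x (-ₑ x)) (+-invˡ x)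
          ; ⁻¹-cong = neg-cong
          }
        ; comm = +-comm
        }
      }

    private
      module G = AbelianGroup +-abelianGroup
      module GP = AbelianGroupProperties +-abelianGroup
      module SP = CommutativeSemigroupProperties G.commutativeSemigroup

    0⊗ : ∀ n → M.0ᴹ ⊗ₑ n ≈ₑ 0ₑ
    0⊗ n = GP.identityˡ-unique _ _
      (≈-trans (≈-sym (⊗-distribʳ M.0ᴹ M.0ᴹ n)) (⊗-cong (M.+ᴹ-identityˡ M.0ᴹ) N.≈ᴹ-refl))

    ⊗0 : ∀ m → m ⊗ₑ N.0ᴹ ≈ₑ 0ₑ
    ⊗0 m = GP.identityˡ-unique _ _
      (≈-trans (≈-sym (⊗-distribˡ m N.0ᴹ N.0ᴹ)) (⊗-cong M.≈ᴹ-refl (N.+ᴹ-identityˡ N.0ᴹ)))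

    neg⊗ : ∀ m n → (M.-ᴹ m) ⊗ₑ n ≈ₑ -ₑ (m ⊗ₑ n)
    neg⊗ m n = GP.inverseˡ-unique _ _ (≈-trans (≈-sym (⊗-distribʳ _ m n))
      (≈-trans (⊗-cong (M.-ᴹ‿inverseˡ m) N.≈ᴹ-refl) (0⊗ n)))

    ⊗neg : ∀ m n → m ⊗ₑ (N.-ᴹ n) ≈ₑ -ₑ (m ⊗ₑ n)
    ⊗neg m n = GP.inverseˡ-unique _ _ (≈-trans (≈-sym (⊗-distribˡ m _ n))
      (≈-trans (⊗-cong M.≈ᴹ-refl (N.-ᴹ‿inverseˡ n)) (⊗0 m)))

    infixr 7 _•ₗ_
    infixl 7 _•ᵣ_

    _•ₗ_ : A.Carrier → Element → Element
    r •ₗ (m ⊗ₑ n) = (r M.*ₗ m) ⊗ₑ n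
    r •ₗ 0ₑ       = 0ₑ
    r •ₗ (x +ₑ y) = (r •ₗ x) +ₑ (r •ₗ y)
    r •ₗ (-ₑ x)   = -ₑ (r •ₗ x)

    _•ᵣ_ : Element → C.Carrier → Element
    (m ⊗ₑ n) •ᵣ r = m ⊗ₑ (n N.*ᵣ r)
    0ₑ       •ᵣ r = 0ₑ
    (x +ₑ y) •ᵣ r = (x •ᵣ r) +ₑ (y •ᵣ r)
    (-ₑ x)   •ᵣ r = -ₑ (x •ᵣ r)

    private
      neg-+ : ∀ {x y z} → x ≈ₑ y +ₑ z → -ₑ x ≈ₑ -ₑ y +ₑ -ₑ z
      neg-+ {y = y} {z} p = ≈-trans (neg-cong p) (≈-sym (GP.⁻¹-∙-comm y z))

      •ₗ-congˡ : ∀ r {x y} → x ≈ₑ y → r •ₗ x ≈ₑ r •ₗ y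
      •ₗ-congˡ r ≈-refl              = ≈-refl
      •ₗ-congˡ r (≈-sym p)           = ≈-sym (•ₗ-congˡ r p)
      •ₗ-congˡ r (≈-trans p q)       = ≈-trans (•ₗ-congˡ r p) (•ₗ-congˡ r q)
      •ₗ-congˡ r (+-cong p q)        = +-cong (•ₗ-congˡ r p) (•ₗ-congˡ r q)
      •ₗ-congˡ r (neg-cong p)        = neg-cong (•ₗ-congˡ r p)
      •ₗ-congˡ r (+-assoc x y z)     = +-assoc (r •ₗ x) (r •ₗ y) (r •ₗ z)
      •ₗ-congˡ r (+-comm x y)        = +-comm (r •ₗ x) (r •ₗ y)
      •ₗ-congˡ r (+-idˡ x)           = +-idˡ (r •ₗ x)
      •ₗ-congˡ r (+-invˡ x)          = +-invˡ (r •ₗ x)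
      •ₗ-congˡ r (⊗-cong p q)        = ⊗-cong (M.*ₗ-congˡ p) q
      •ₗ-congˡ r (⊗-distribʳ m m′ n) =
        ≈-trans (⊗-cong (M.*ₗ-distribˡ r m m′) N.≈ᴹ-refl) (⊗-distribʳ _ _ n)
      •ₗ-congˡ r (⊗-distribˡ m n n′) = ⊗-distribˡ _ n n′
      •ₗ-congˡ r (⊗-balanced m b n)  =
        ≈-trans (⊗-cong (M.≈ᴹ-sym (M.*ₗ-*ᵣ-assoc r m b)) N.≈ᴹ-refl) (⊗-balanced _ b n)

      •ₗ-congʳ : ∀ {r r′} → r A.≈ r′ → ∀ x → r •ₗ x ≈ₑ r′ •ₗ x
      •ₗ-congʳ p (m ⊗ₑ n) = ⊗-cong (M.*ₗ-congʳ p) N.≈ᴹ-refl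
      •ₗ-congʳ p 0ₑ       = ≈-refl
      •ₗ-congʳ p (x +ₑ y) = +-cong (•ₗ-congʳ p x) (•ₗ-congʳ p y)
      •ₗ-congʳ p (-ₑ x)   = neg-cong (•ₗ-congʳ p x)

      •ₗ-zero : ∀ x → A.0# •ₗ x ≈ₑ 0ₑ
      •ₗ-zero (m ⊗ₑ n) = ≈-trans (⊗-cong (M.*ₗ-zeroˡ m) N.≈ᴹ-refl) (0⊗ n)
      •ₗ-zero 0ₑ       = ≈-refl
      •ₗ-zero (x +ₑ y) = ≈-trans (+-cong (•ₗ-zero x) (•ₗ-zero y)) (+-idˡ 0ₑ)
      •ₗ-zero (-ₑ x)   = ≈-trans (neg-cong (•ₗ-zero x)) GP.ε⁻¹≈ε

      •ₗ-distrib : ∀ x r r′ → (r A.+ r′) •ₗ x ≈ₑ (r •ₗ x) +ₑ (r′ •ₗ x)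
      •ₗ-distrib (m ⊗ₑ n) r r′ =
        ≈-trans (⊗-cong (M.*ₗ-distribʳ m r r′) N.≈ᴹ-refl) (⊗-distribʳ _ _ n)
      •ₗ-distrib 0ₑ       r r′ = ≈-sym (+-idˡ 0ₑ)
      •ₗ-distrib (x +ₑ y) r r′ =
        ≈-trans (+-cong (•ₗ-distrib x r r′) (•ₗ-distrib y r r′)) (SP.interchange _ _ _ _)
      •ₗ-distrib (-ₑ x)   r r′ = neg-+ (•ₗ-distrib x r r′)

      •ₗ-identity : ∀ x → A.1# •ₗ x ≈ₑ x
      •ₗ-identity (m ⊗ₑ n) = ⊗-cong (M.*ₗ-identityˡ m) N.≈ᴹ-refl
      •ₗ-identity 0ₑ       = ≈-refl
      •ₗ-identity (x +ₑ y) = +-cong (•ₗ-identity x) (•ₗ-identity y)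
      •ₗ-identity (-ₑ x)   = neg-cong (•ₗ-identity x)

      •ₗ-assoc : ∀ r r′ x → (r A.* r′) •ₗ x ≈ₑ r •ₗ (r′ •ₗ x)
      •ₗ-assoc r r′ (m ⊗ₑ n) = ⊗-cong (M.*ₗ-assoc r r′ m) N.≈ᴹ-refl
      •ₗ-assoc r r′ 0ₑ       = ≈-refl
      •ₗ-assoc r r′ (x +ₑ y) = +-cong (•ₗ-assoc r r′ x) (•ₗ-assoc r r′ y)
      •ₗ-assoc r r′ (-ₑ x)   = neg-cong (•ₗ-assoc r r′ x)

      •ᵣ-congʳ : ∀ r {x y} → x ≈ₑ y → x •ᵣ r ≈ₑ y •ᵣ r
      •ᵣ-congʳ r ≈-refl              = ≈-refl
      •ᵣ-congʳ r (≈-sym p)           = ≈-sym (•ᵣ-congʳ r p)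
      •ᵣ-congʳ r (≈-trans p q)       = ≈-trans (•ᵣ-congʳ r p) (•ᵣ-congʳ r q)
      •ᵣ-congʳ r (+-cong p q)        = +-cong (•ᵣ-congʳ r p) (•ᵣ-congʳ r q)
      •ᵣ-congʳ r (neg-cong p)        = neg-cong (•ᵣ-congʳ r p)
      •ᵣ-congʳ r (+-assoc x y z)     = +-assoc (x •ᵣ r) (y •ᵣ r) (z •ᵣ r)
      •ᵣ-congʳ r (+-comm x y)        = +-comm (x •ᵣ r) (y •ᵣ r)
      •ᵣ-congʳ r (+-idˡ x)           = +-idˡ (x •ᵣ r)
      •ᵣ-congʳ r (+-invˡ x)          = +-invˡ (x •ᵣ r)
      •ᵣ-congʳ r (⊗-cong p q)        = ⊗-cong p (N.*ᵣ-congʳ q)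
      •ᵣ-congʳ r (⊗-distribʳ m m′ n) = ⊗-distribʳ m m′ _
      •ᵣ-congʳ r (⊗-distribˡ m n n′) =
        ≈-trans (⊗-cong M.≈ᴹ-refl (N.*ᵣ-distribʳ r n n′)) (⊗-distribˡ m _ _)
      •ᵣ-congʳ r (⊗-balanced m b n)  =
        ≈-trans (⊗-balanced m b _) (⊗-cong M.≈ᴹ-refl (N.≈ᴹ-sym (N.*ₗ-*ᵣ-assoc b n r)))

      •ᵣ-congˡ : ∀ {r r′} → r C.≈ r′ → ∀ x → x •ᵣ r ≈ₑ x •ᵣ r′
      •ᵣ-congˡ p (m ⊗ₑ n) = ⊗-cong M.≈ᴹ-refl (N.*ᵣ-congˡ p)
      •ᵣ-congˡ p 0ₑ       = ≈-refl
      •ᵣ-congˡ p (x +ₑ y) = +-cong (•ᵣ-congˡ p x) (•ᵣ-congˡ p y)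
      •ᵣ-congˡ p (-ₑ x)   = neg-cong (•ᵣ-congˡ p x)

      •ᵣ-zero : ∀ x → x •ᵣ C.0# ≈ₑ 0ₑ
      •ᵣ-zero (m ⊗ₑ n) = ≈-trans (⊗-cong M.≈ᴹ-refl (N.*ᵣ-zeroʳ n)) (⊗0 m)
      •ᵣ-zero 0ₑ       = ≈-refl
      •ᵣ-zero (x +ₑ y) = ≈-trans (+-cong (•ᵣ-zero x) (•ᵣ-zero y)) (+-idˡ 0ₑ)
      •ᵣ-zero (-ₑ x)   = ≈-trans (neg-cong (•ᵣ-zero x)) GP.ε⁻¹≈ε

      •ᵣ-distrib : ∀ x r r′ → x •ᵣ (r C.+ r′) ≈ₑ (x •ᵣ r) +ₑ (x •ᵣ r′)
      •ᵣ-distrib (m ⊗ₑ n) r r′ =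
        ≈-trans (⊗-cong M.≈ᴹ-refl (N.*ᵣ-distribˡ n r r′)) (⊗-distribˡ m _ _)
      •ᵣ-distrib 0ₑ       r r′ = ≈-sym (+-idˡ 0ₑ)
      •ᵣ-distrib (x +ₑ y) r r′ =
        ≈-trans (+-cong (•ᵣ-distrib x r r′) (•ᵣ-distrib y r r′)) (SP.interchange _ _ _ _)
      •ᵣ-distrib (-ₑ x)   r r′ = neg-+ (•ᵣ-distrib x r r′)

      •ᵣ-identity : ∀ x → x •ᵣ C.1# ≈ₑ x
      •ᵣ-identity (m ⊗ₑ n) = ⊗-cong M.≈ᴹ-refl (N.*ᵣ-identityʳ n)
      •ᵣ-identity 0ₑ       = ≈-refl
      •ᵣ-identity (x +ₑ y) = +-cong (•ᵣ-identity x) (•ᵣ-identity y)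
      •ᵣ-identity (-ₑ x)   = neg-cong (•ᵣ-identity x)

      •ᵣ-assoc : ∀ x r r′ → (x •ᵣ r) •ᵣ r′ ≈ₑ x •ᵣ (r C.* r′)
      •ᵣ-assoc (m ⊗ₑ n) r r′ = ⊗-cong M.≈ᴹ-refl (N.*ᵣ-assoc n r r′)
      •ᵣ-assoc 0ₑ       r r′ = ≈-refl
      •ᵣ-assoc (x +ₑ y) r r′ = +-cong (•ᵣ-assoc x r r′) (•ᵣ-assoc y r r′)
      •ᵣ-assoc (-ₑ x)   r r′ = neg-cong (•ᵣ-assoc x r r′)

      •ₗ-•ᵣ-assoc : ∀ r x r′ → (r •ₗ x) •ᵣ r′ ≈ₑ r •ₗ (x •ᵣ r′)
      •ₗ-•ᵣ-assoc r (m ⊗ₑ n) r′ = ≈-refl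
      •ₗ-•ᵣ-assoc r 0ₑ       r′ = ≈-refl
      •ₗ-•ᵣ-assoc r (x +ₑ y) r′ = +-cong (•ₗ-•ᵣ-assoc r x r′) (•ₗ-•ᵣ-assoc r y r′)
      •ₗ-•ᵣ-assoc r (-ₑ x)   r′ = neg-cong (•ₗ-•ᵣ-assoc r x r′)

      homₑ-•ₗ : ∀ {i j r x} → A.Homogeneous i r → Homogeneousₑ j x → Homogeneousₑ (i +ℤ j) (r •ₗ x)
      homₑ-•ₗ {r = r} r∈ (resp p h) = resp (•ₗ-congˡ r p) (homₑ-•ₗ r∈ h)
      homₑ-•ₗ r∈ zero               = zero
      homₑ-•ₗ r∈ (add h h′)         = add (homₑ-•ₗ r∈ h) (homₑ-•ₗ r∈ h′)
      homₑ-•ₗ r∈ (neg h)            = neg (homₑ-•ₗ r∈ h)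
      homₑ-•ₗ {i = i} r∈ (pure {i = k} {j = l} ≡.refl m∈ n∈) =
        pure (ℤₚ.+-assoc i k l) (M.homogeneous-*ₗ r∈ m∈) n∈

      homₑ-•ᵣ : ∀ {i j x r} → Homogeneousₑ i x → C.Homogeneous j r → Homogeneousₑ (i +ℤ j) (x •ᵣ r)
      homₑ-•ᵣ {r = r} (resp p h) r∈ = resp (•ᵣ-congʳ r p) (homₑ-•ᵣ h r∈)
      homₑ-•ᵣ zero r∈               = zero
      homₑ-•ᵣ (add h h′) r∈         = add (homₑ-•ᵣ h r∈) (homₑ-•ᵣ h′ r∈)
      homₑ-•ᵣ (neg h) r∈            = neg (homₑ-•ᵣ h r∈)
      homₑ-•ᵣ {j = j} (pure {i = k} {j = l} ≡.refl m∈ n∈) r∈ =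
        pure (≡.sym (ℤₚ.+-assoc k l j)) m∈ (N.homogeneous-*ᵣ n∈ r∈)

    tensor : GradedBimodule A C
    tensor = record
      { bimodule = record
        { Carrierᴹ = Element ; _≈ᴹ_ = _≈ₑ_ ; _+ᴹ_ = _+ₑ_ ; _*ₗ_ = _•ₗ_ ; _*ᵣ_ = _•ᵣ_
        ; 0ᴹ = 0ₑ ; -ᴹ_ = -ₑ_
        ; isBimodule = record
          { isBisemimodule = record
            { +ᴹ-isCommutativeMonoid = G.isCommutativeMonoid
            ; isPreleftSemimodule = record
              { *ₗ-cong      = λ {r} {r′} {x} {y} p q → ≈-trans (•ₗ-congʳ p x) (•ₗ-congˡ r′ q)
              ; *ₗ-zeroˡ     = •ₗ-zero
              ; *ₗ-distribʳ  = •ₗ-distrib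
              ; *ₗ-identityˡ = •ₗ-identity
              ; *ₗ-assoc     = •ₗ-assoc
              ; *ₗ-zeroʳ     = λ _ → ≈-refl
              ; *ₗ-distribˡ  = λ _ _ _ → ≈-refl
              }
            ; isPrerightSemimodule = record
              { *ᵣ-cong      = λ {x} {y} {r} {r′} p q → ≈-trans (•ᵣ-congʳ r p) (•ᵣ-congˡ q y)
              ; *ᵣ-zeroʳ     = •ᵣ-zero
              ; *ᵣ-distribˡ  = •ᵣ-distrib
              ; *ᵣ-identityʳ = •ᵣ-identity
              ; *ᵣ-assoc     = •ᵣ-assoc
              ; *ᵣ-zeroˡ     = λ _ → ≈-refl
              ; *ᵣ-distribʳ  = λ _ _ _ → ≈-refl
              }
            ; *ₗ-*ᵣ-assoc = •ₗ-•ᵣ-assoc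
            }
          ; -ᴹ‿cong = neg-cong
          ; -ᴹ‿inverse = G.inverse
          }
        }
      ; Homogeneous      = Homogeneousₑ
      ; homogeneous-resp = resp
      ; homogeneous-0    = zero
      ; homogeneous-+    = add
      ; homogeneous-neg  = neg
      ; homogeneous-*ₗ   = homₑ-•ₗ
      ; homogeneous-*ᵣ   = homₑ-•ᵣ
      }

    -- The additive map out of the tensor product induced by a balanced
    -- biadditive map.
    module Lift (X : AbelianGroup a a) (β : M.Carrierᴹ → N.Carrierᴹ → AbelianGroup.Carrier X)
      (β-cong : ∀ {m m′ n n′} → m M.≈ᴹ m′ → n N.≈ᴹ n′ → AbelianGroup._≈_ X (β m n) (β m′ n′))
      (β-distribʳ : ∀ m m′ n → AbelianGroup._≈_ X (β (m M.+ᴹ m′) n) (AbelianGroup._∙_ X (β m n) (β m′ n)))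
      (β-distribˡ : ∀ m n n′ → AbelianGroup._≈_ X (β m (n N.+ᴹ n′)) (AbelianGroup._∙_ X (β m n) (β m n′)))
      (β-balanced : ∀ m b n → AbelianGroup._≈_ X (β (m M.*ᵣ b) n) (β m (b N.*ₗ n)))
      where
      private module X = AbelianGroup X

      lift : Element → X.Carrier
      lift (m ⊗ₑ n) = β m n
      lift 0ₑ       = X.ε
      lift (x +ₑ y) = lift x X.∙ lift y
      lift (-ₑ x)   = lift x X.⁻¹

      lift-cong : ∀ {x y} → x ≈ₑ y → lift x X.≈ lift y
      lift-cong ≈-refl              = X.refl
      lift-cong (≈-sym p)           = X.sym (lift-cong p)
      lift-cong (≈-trans p q)       = X.trans (lift-cong p) (lift-cong q)
      lift-cong (+-cong p q)        = X.∙-cong (lift-cong p) (lift-cong q)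
      lift-cong (neg-cong p)        = X.⁻¹-cong (lift-cong p)
      lift-cong (+-assoc x y z)     = X.assoc (lift x) (lift y) (lift z)
      lift-cong (+-comm x y)        = X.comm (lift x) (lift y)
      lift-cong (+-idˡ x)           = X.identityˡ (lift x)
      lift-cong (+-invˡ x)          = X.inverseˡ (lift x)
      lift-cong (⊗-cong p q)        = β-cong p q
      lift-cong (⊗-distribʳ m m′ n) = β-distribʳ m m′ n
      lift-cong (⊗-distribˡ m n n′) = β-distribˡ m n n′
      lift-cong (⊗-balanced m b n)  = β-balanced m b n

    module LiftBimodule (X : GradedBimodule A C) (β : M.Carrierᴹ → N.Carrierᴹ → GradedBimodule.Carrierᴹ X)
      (β-cong : ∀ {m m′ n n′} → m M.≈ᴹ m′ → n N.≈ᴹ n′ → GradedBimodule._≈ᴹ_ X (β m n) (β m′ n′))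
      (β-distribʳ : ∀ m m′ n → GradedBimodule._≈ᴹ_ X (β (m M.+ᴹ m′) n) (GradedBimodule._+ᴹ_ X (β m n) (β m′ n)))
      (β-distribˡ : ∀ m n n′ → GradedBimodule._≈ᴹ_ X (β m (n N.+ᴹ n′)) (GradedBimodule._+ᴹ_ X (β m n) (β m n′)))
      (β-balanced : ∀ m b n → GradedBimodule._≈ᴹ_ X (β (m M.*ᵣ b) n) (β m (b N.*ₗ n)))
      (β-*ₗ : ∀ r m n → GradedBimodule._≈ᴹ_ X (β (r M.*ₗ m) n) (GradedBimodule._*ₗ_ X r (β m n)))
      (β-*ᵣ : ∀ r m n → GradedBimodule._≈ᴹ_ X (β m (n N.*ᵣ r)) (GradedBimodule._*ᵣ_ X (β m n) r))
      where
      private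
        module X = GradedBimodule X
        module XP = GroupProperties X.+ᴹ-group
      open Lift X.+ᴹ-abelianGroup β β-cong β-distribʳ β-distribˡ β-balanced

      private
        *ₗ-neg : ∀ r x → r X.*ₗ (X.-ᴹ x) X.≈ᴹ X.-ᴹ (r X.*ₗ x)
        *ₗ-neg r x = XP.inverseˡ-unique _ _ (X.≈ᴹ-trans (X.≈ᴹ-sym (X.*ₗ-distribˡ r _ x))
          (X.≈ᴹ-trans (X.*ₗ-congˡ (X.-ᴹ‿inverseˡ x)) (X.*ₗ-zeroʳ r)))

        *ᵣ-neg : ∀ r x → (X.-ᴹ x) X.*ᵣ r X.≈ᴹ X.-ᴹ (x X.*ᵣ r)
        *ᵣ-neg r x = XP.inverseˡ-unique _ _ (X.≈ᴹ-trans (X.≈ᴹ-sym (X.*ᵣ-distribʳ r _ x))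
          (X.≈ᴹ-trans (X.*ᵣ-congʳ (X.-ᴹ‿inverseˡ x)) (X.*ᵣ-zeroˡ r)))

        lift-*ₗ : ∀ r x → lift (r •ₗ x) X.≈ᴹ r X.*ₗ lift x
        lift-*ₗ r (m ⊗ₑ n) = β-*ₗ r m n
        lift-*ₗ r 0ₑ       = X.≈ᴹ-sym (X.*ₗ-zeroʳ r)
        lift-*ₗ r (x +ₑ y) = X.≈ᴹ-trans (X.+ᴹ-cong (lift-*ₗ r x) (lift-*ₗ r y)) (X.≈ᴹ-sym (X.*ₗ-distribˡ r _ _))
        lift-*ₗ r (-ₑ x)   = X.≈ᴹ-trans (X.-ᴹ‿cong (lift-*ₗ r x)) (X.≈ᴹ-sym (*ₗ-neg r _))

        lift-*ᵣ : ∀ r x → lift (x •ᵣ r) X.≈ᴹ lift x X.*ᵣ r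
        lift-*ᵣ r (m ⊗ₑ n) = β-*ᵣ r m n
        lift-*ᵣ r 0ₑ       = X.≈ᴹ-sym (X.*ᵣ-zeroˡ r)
        lift-*ᵣ r (x +ₑ y) = X.≈ᴹ-trans (X.+ᴹ-cong (lift-*ᵣ r x) (lift-*ᵣ r y)) (X.≈ᴹ-sym (X.*ᵣ-distribʳ r _ _))
        lift-*ᵣ r (-ₑ x)   = X.≈ᴹ-trans (X.-ᴹ‿cong (lift-*ᵣ r x)) (X.≈ᴹ-sym (*ᵣ-neg r _))

      liftMap : BimoduleMap (bimodule tensor) (bimodule X)
      liftMap = mkMap (bimodule tensor) (bimodule X) lift lift-cong (λ _ _ → X.≈ᴹ-refl) lift-*ₗ lift-*ᵣ

      lift-deg : (∀ {i j m n} → M.Homogeneous i m → N.Homogeneous j n → X.Homogeneous (i +ℤ j) (β m n)) →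
        IsDegreeZero tensor X liftMap
      lift-deg β-deg (resp p h)              = X.homogeneous-resp (lift-cong p) (lift-deg β-deg h)
      lift-deg β-deg zero                    = X.homogeneous-0
      lift-deg β-deg (add h h′)              = X.homogeneous-+ (lift-deg β-deg h) (lift-deg β-deg h′)
      lift-deg β-deg (neg h)                 = X.homogeneous-neg (lift-deg β-deg h)
      lift-deg β-deg (pure ≡.refl m∈ n∈)     = β-deg m∈ n∈

    ext : (X : AbelianGroup a a) {f g : Element → AbelianGroup.Carrier X} →
      IsGroupHomomorphism G.rawGroup (AbelianGroup.rawGroup X) f →
      IsGroupHomomorphism G.rawGroup (AbelianGroup.rawGroup X) g →
      (∀ m n → AbelianGroup._≈_ X (f (m ⊗ₑ n)) (g (m ⊗ₑ n))) →
      ∀ x → AbelianGroup._≈_ X (f x) (g x)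
    ext X {f} {g} f-hom g-hom pure≈ = go
      where
      module X = AbelianGroup X
      module f = IsGroupHomomorphism f-hom
      module g = IsGroupHomomorphism g-hom
      go : ∀ x → f x X.≈ g x
      go (m ⊗ₑ n) = pure≈ m n
      go 0ₑ       = X.trans f.ε-homo (X.sym g.ε-homo)
      go (x +ₑ y) = X.trans (f.homo x y) (X.trans (X.∙-cong (go x) (go y)) (X.sym (g.homo x y)))
      go (-ₑ x)   = X.trans (f.⁻¹-homo x) (X.trans (X.⁻¹-cong (go x)) (X.sym (g.⁻¹-homo x)))

  infixr 7 _⊗_
  _⊗_ : ∀ {A B C} → GradedBimodule A B → GradedBimodule B C → GradedBimodule A C
  M ⊗ N = Tensor.tensor M N

  infixr 7 _⊗₁_
  _⊗₁_ : ∀ {A B C} {M M′ : GradedBimodule A B} {N N′ : GradedBimodule B C} →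
    BimoduleMap (bimodule M) (bimodule M′) → BimoduleMap (bimodule N) (bimodule N′) →
    BimoduleMap (bimodule (M ⊗ N)) (bimodule (M′ ⊗ N′))
  _⊗₁_ {M = M} {M′} {N} {N′} f g = liftMap
    where
    module f = BimoduleMap f
    module g = BimoduleMap g
    module M′ = GradedBimodule M′
    module N′ = GradedBimodule N′
    open Tensor M′ N′
    open Tensor.LiftBimodule M N (M′ ⊗ N′) (λ m n → fun f m ⊗ₑ fun g n)
      (λ p q → ⊗-cong (f.⟦⟧-cong p) (g.⟦⟧-cong q))
      (λ m m′ n → ≈-trans (⊗-cong (f.+ᴹ-homo m m′) N′.≈ᴹ-refl) (⊗-distribʳ _ _ _))
      (λ m n n′ → ≈-trans (⊗-cong M′.≈ᴹ-refl (g.+ᴹ-homo n n′)) (⊗-distribˡ _ _ _))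
      (λ m b n → ≈-trans (⊗-cong (f.*ᵣ-homo b m) N′.≈ᴹ-refl)
        (≈-trans (⊗-balanced _ b _) (⊗-cong M′.≈ᴹ-refl (N′.≈ᴹ-sym (g.*ₗ-homo b n)))))
      (λ r m n → ⊗-cong (f.*ₗ-homo r m) N′.≈ᴹ-refl)
      (λ r m n → ⊗-cong M′.≈ᴹ-refl (g.*ᵣ-homo r n))

  ⊗₁-deg : ∀ {A B C} (M M′ : GradedBimodule A B) (N N′ : GradedBimodule B C)
    (f : BimoduleMap (bimodule M) (bimodule M′)) (g : BimoduleMap (bimodule N) (bimodule N′)) →
    IsDegreeZero M M′ f → IsDegreeZero N N′ g →
    IsDegreeZero (M ⊗ N) (M′ ⊗ N′) (_⊗₁_ {M = M} {M′} {N} {N′} f g)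
  ⊗₁-deg M M′ N N′ f g f-deg g-deg = go
    where
    open Tensor
    fg = _⊗₁_ {M = M} {M′} {N} {N′} f g
    go : IsDegreeZero (M ⊗ N) (M′ ⊗ N′) fg
    go (resp p h)       = resp (BimoduleMap.⟦⟧-cong fg p) (go h)
    go zero             = zero
    go (add h h′)       = add (go h) (go h′)
    go (neg h)          = neg (go h)
    go (pure eq m∈ n∈)  = pure eq (f-deg m∈) (g-deg n∈)

  private
    homOf : ∀ {A B : Ring a a} {M N : Bimodule A B a a} (f : BimoduleMap M N) →
      IsGroupHomomorphism (Bimodule.+ᴹ-rawGroup M) (Bimodule.+ᴹ-rawGroup N) (fun f)
    homOf f = BimoduleMap.+ᴹ-isGroupHomomorphism f

  ⊗-≅ : ∀ {A B C} {M M′ : GradedBimodule A B} {N N′ : GradedBimodule B C} →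
    M ≅ M′ → N ≅ N′ → M ⊗ N ≅ M′ ⊗ N′
  ⊗-≅ {M = M} {M′} {N} {N′} φ ψ = record
    { to = to ; from = from
    ; to-deg = ⊗₁-deg M M′ N N′ φ.to ψ.to φ.to-deg ψ.to-deg
    ; from-deg = ⊗₁-deg M′ M N′ N φ.from ψ.from φ.from-deg ψ.from-deg
    ; to∘from = T′.ext T′.+-abelianGroup (homOf (to ∘ᴹ from)) (homOf (idMap {M = bimodule (M′ ⊗ N′)}))
        (λ m n → T′.⊗-cong (φ.to∘from m) (ψ.to∘from n))
    ; from∘to = T.ext T.+-abelianGroup (homOf (from ∘ᴹ to)) (homOf (idMap {M = bimodule (M ⊗ N)}))
        (λ m n → T.⊗-cong (φ.from∘to m) (ψ.from∘to n))
    }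
    where
    module φ = _≅_ φ
    module ψ = _≅_ ψ
    module T = Tensor M N
    module T′ = Tensor M′ N′
    to = _⊗₁_ {M = M} {M′} {N} {N′} φ.to ψ.to
    from = _⊗₁_ {M = M′} {M} {N′} {N} φ.from ψ.from

  ⊗-unitˡ : ∀ {A B} (M : GradedBimodule A B) → unit A ⊗ M ≅ M
  ⊗-unitˡ {A} M = record
    { to = L.liftMap
    ; from = from
    ; to-deg = L.lift-deg M.homogeneous-*ₗ
    ; from-deg = λ {d} → T.pure (ℤₚ.+-identityˡ d) A.homogeneous-1
    ; to∘from = M.*ₗ-identityˡ
    ; from∘to = T.ext T.+-abelianGroup (homOf (from ∘ᴹ L.liftMap)) (homOf (idMap {M = bimodule (unit A ⊗ M)}))
        (λ r m → T.≈-trans (T.≈-sym (T.⊗-balanced A.1# r m)) (T.⊗-cong (A.*-identityˡ r) M.≈ᴹ-refl))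
    }
    where
    module A = GradedRing A
    module M = GradedBimodule M
    module T = Tensor (unit A) M
    module L = T.LiftBimodule M M._*ₗ_ M.*ₗ-cong
      (λ r r′ m → M.*ₗ-distribʳ m r r′) M.*ₗ-distribˡ M.*ₗ-assoc M.*ₗ-assoc
      (λ r s m → M.≈ᴹ-sym (M.*ₗ-*ᵣ-assoc s m r))
    from : BimoduleMap (bimodule M) (bimodule (unit A ⊗ M))
    from = mkMap (bimodule M) (bimodule (unit A ⊗ M)) (A.1# T.⊗ₑ_) (T.⊗-cong A.refl) (T.⊗-distribˡ A.1#)
      (λ r m → T.≈-trans (T.≈-sym (T.⊗-balanced A.1# r m))
        (T.⊗-cong (A.trans (A.*-identityˡ r) (A.sym (A.*-identityʳ r))) M.≈ᴹ-refl))
      (λ r m → T.≈-refl)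

  ⊗-unitʳ : ∀ {A B} (M : GradedBimodule A B) → M ⊗ unit B ≅ M
  ⊗-unitʳ {B = B} M = record
    { to = L.liftMap
    ; from = from
    ; to-deg = L.lift-deg M.homogeneous-*ᵣ
    ; from-deg = λ {d} m∈ → T.pure (ℤₚ.+-identityʳ d) m∈ B.homogeneous-1
    ; to∘from = M.*ᵣ-identityʳ
    ; from∘to = T.ext T.+-abelianGroup (homOf (from ∘ᴹ L.liftMap)) (homOf (idMap {M = bimodule (M ⊗ unit B)}))
        (λ m r → T.≈-trans (T.⊗-balanced m r B.1#) (T.⊗-cong M.≈ᴹ-refl (B.*-identityʳ r)))
    }
    where
    module B = GradedRing B
    module M = GradedBimodule M
    module T = Tensor M (unit B)
    module L = T.LiftBimodule M M._*ᵣ_ M.*ᵣ-cong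
      (λ m m′ r → M.*ᵣ-distribʳ r m m′) M.*ᵣ-distribˡ M.*ᵣ-assoc
      M.*ₗ-*ᵣ-assoc (λ r m s → M.≈ᴹ-sym (M.*ᵣ-assoc m s r))
    from : BimoduleMap (bimodule M) (bimodule (M ⊗ unit B))
    from = mkMap (bimodule M) (bimodule (M ⊗ unit B)) (T._⊗ₑ B.1#) (λ p → T.⊗-cong p B.refl)
      (λ m m′ → T.⊗-distribʳ m m′ B.1#)
      (λ r m → T.≈-refl)
      (λ r m → T.≈-trans (T.⊗-balanced m r B.1#)
        (T.⊗-cong M.≈ᴹ-refl (B.trans (B.*-identityʳ r) (B.sym (B.*-identityˡ r)))))

  module Assoc {A B C D : GradedRing}
    (M : GradedBimodule A B) (N : GradedBimodule B C) (P : GradedBimodule C D) where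
    module M = GradedBimodule M
    module N = GradedBimodule N
    module P = GradedBimodule P
    module MN = Tensor M N
    module NP = Tensor N P
    module LP = Tensor (M ⊗ N) P
    module MR = Tensor M (N ⊗ P)

    module TO₁ (p : P.Carrierᴹ) = MN.Lift MR.+-abelianGroup (λ m n → m MR.⊗ₑ (n NP.⊗ₑ p))
      (λ q r → MR.⊗-cong q (NP.⊗-cong r P.≈ᴹ-refl))
      (λ m m′ n → MR.⊗-distribʳ m m′ _)
      (λ m n n′ → MR.≈-trans (MR.⊗-cong M.≈ᴹ-refl (NP.⊗-distribʳ n n′ p)) (MR.⊗-distribˡ m _ _))
      (λ m b n → MR.⊗-balanced m b _)
    module FROM₁ (m : M.Carrierᴹ) = NP.Lift LP.+-abelianGroup (λ n p → (m MN.⊗ₑ n) LP.⊗ₑ p)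
      (λ q r → LP.⊗-cong (MN.⊗-cong M.≈ᴹ-refl q) r)
      (λ n n′ p → LP.≈-trans (LP.⊗-cong (MN.⊗-distribˡ m n n′) P.≈ᴹ-refl) (LP.⊗-distribʳ _ _ p))
      (λ n p p′ → LP.⊗-distribˡ _ p p′)
      (λ n b p → LP.⊗-balanced _ b p)

    hom-to₁ : ∀ p → IsGroupHomomorphism (AbelianGroup.rawGroup MN.+-abelianGroup)
      (AbelianGroup.rawGroup MR.+-abelianGroup) (TO₁.lift p)
    hom-to₁ p = additive⇒isGroupHomomorphism MN.+-abelianGroup MR.+-abelianGroup
      (TO₁.lift p) (TO₁.lift-cong p) (λ _ _ → MR.≈-refl)
    hom-from₁ : ∀ m → IsGroupHomomorphism (AbelianGroup.rawGroup NP.+-abelianGroup)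
      (AbelianGroup.rawGroup LP.+-abelianGroup) (FROM₁.lift m)
    hom-from₁ m = additive⇒isGroupHomomorphism NP.+-abelianGroup LP.+-abelianGroup
      (FROM₁.lift m) (FROM₁.lift-cong m) (λ _ _ → LP.≈-refl)

    to₁ : MN.Element → P.Carrierᴹ → MR.Element
    to₁ x p = TO₁.lift p x
    from₁ : M.Carrierᴹ → NP.Element → LP.Element
    from₁ m y = FROM₁.lift m y

    module GMR = AbelianGroup MR.+-abelianGroup
    module GLP = AbelianGroup LP.+-abelianGroup
    module PMR = AbelianGroupProperties MR.+-abelianGroup
    module PLP = AbelianGroupProperties LP.+-abelianGroup
    module SMR = CommutativeSemigroupProperties GMR.commutativeSemigroup
    module SLP = CommutativeSemigroupProperties GLP.commutativeSemigroup

    to₁-congʳ : ∀ x {p p′} → p P.≈ᴹ p′ → to₁ x p MR.≈ₑ to₁ x p′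
    to₁-congʳ x {p} {p′} q = MN.ext MR.+-abelianGroup (hom-to₁ p) (hom-to₁ p′)
      (λ m n → MR.⊗-cong M.≈ᴹ-refl (NP.⊗-cong N.≈ᴹ-refl q)) x
    from₁-congˡ : ∀ {m m′} → m M.≈ᴹ m′ → ∀ y → from₁ m y LP.≈ₑ from₁ m′ y
    from₁-congˡ {m} {m′} q = NP.ext LP.+-abelianGroup (hom-from₁ m) (hom-from₁ m′)
      (λ n p → LP.⊗-cong (MN.⊗-cong q N.≈ᴹ-refl) P.≈ᴹ-refl)

    to₁-distrib : ∀ x p p′ → to₁ x (p P.+ᴹ p′) MR.≈ₑ to₁ x p MR.+ₑ to₁ x p′
    to₁-distrib (m MN.⊗ₑ n) p p′ =
      MR.≈-trans (MR.⊗-cong M.≈ᴹ-refl (NP.⊗-distribˡ n p p′)) (MR.⊗-distribˡ m _ _)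
    to₁-distrib MN.0ₑ p p′ = MR.≈-sym (MR.+-idˡ MR.0ₑ)
    to₁-distrib (x MN.+ₑ y) p p′ =
      MR.≈-trans (MR.+-cong (to₁-distrib x p p′) (to₁-distrib y p p′)) (SMR.interchange _ _ _ _)
    to₁-distrib (MN.-ₑ x) p p′ =
      MR.≈-trans (MR.neg-cong (to₁-distrib x p p′)) (MR.≈-sym (PMR.⁻¹-∙-comm _ _))

    from₁-distrib : ∀ m m′ y → from₁ (m M.+ᴹ m′) y LP.≈ₑ from₁ m y LP.+ₑ from₁ m′ y
    from₁-distrib m m′ (n NP.⊗ₑ p) =
      LP.≈-trans (LP.⊗-cong (MN.⊗-distribʳ m m′ n) P.≈ᴹ-refl) (LP.⊗-distribʳ _ _ p)
    from₁-distrib m m′ NP.0ₑ = LP.≈-sym (LP.+-idˡ LP.0ₑ)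
    from₁-distrib m m′ (x NP.+ₑ y) =
      LP.≈-trans (LP.+-cong (from₁-distrib m m′ x) (from₁-distrib m m′ y)) (SLP.interchange _ _ _ _)
    from₁-distrib m m′ (NP.-ₑ x) =
      LP.≈-trans (LP.neg-cong (from₁-distrib m m′ x)) (LP.≈-sym (PLP.⁻¹-∙-comm _ _))

    to₁-balanced : ∀ x c p → to₁ (x MN.•ᵣ c) p MR.≈ₑ to₁ x (c P.*ₗ p)
    to₁-balanced (m MN.⊗ₑ n) c p = MR.⊗-cong M.≈ᴹ-refl (NP.⊗-balanced n c p)
    to₁-balanced MN.0ₑ       c p = MR.≈-refl
    to₁-balanced (x MN.+ₑ y) c p = MR.+-cong (to₁-balanced x c p) (to₁-balanced y c p)
    to₁-balanced (MN.-ₑ x)   c p = MR.neg-cong (to₁-balanced x c p)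

    from₁-balanced : ∀ m b y → from₁ (m M.*ᵣ b) y LP.≈ₑ from₁ m (b NP.•ₗ y)
    from₁-balanced m b (n NP.⊗ₑ p) = LP.⊗-cong (MN.⊗-balanced m b n) P.≈ᴹ-refl
    from₁-balanced m b NP.0ₑ       = LP.≈-refl
    from₁-balanced m b (x NP.+ₑ y) = LP.+-cong (from₁-balanced m b x) (from₁-balanced m b y)
    from₁-balanced m b (NP.-ₑ x)   = LP.neg-cong (from₁-balanced m b x)

    to₁-*ₗ : ∀ r x p → to₁ (r MN.•ₗ x) p MR.≈ₑ r MR.•ₗ to₁ x p
    to₁-*ₗ r (m MN.⊗ₑ n) p = MR.≈-refl
    to₁-*ₗ r MN.0ₑ       p = MR.≈-refl
    to₁-*ₗ r (x MN.+ₑ y) p = MR.+-cong (to₁-*ₗ r x p) (to₁-*ₗ r y p)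
    to₁-*ₗ r (MN.-ₑ x)   p = MR.neg-cong (to₁-*ₗ r x p)

    to₁-*ᵣ : ∀ r x p → to₁ x (p P.*ᵣ r) MR.≈ₑ to₁ x p MR.•ᵣ r
    to₁-*ᵣ r (m MN.⊗ₑ n) p = MR.≈-refl
    to₁-*ᵣ r MN.0ₑ       p = MR.≈-refl
    to₁-*ᵣ r (x MN.+ₑ y) p = MR.+-cong (to₁-*ᵣ r x p) (to₁-*ᵣ r y p)
    to₁-*ᵣ r (MN.-ₑ x)   p = MR.neg-cong (to₁-*ᵣ r x p)

    from₁-*ₗ : ∀ r m y → from₁ (r M.*ₗ m) y LP.≈ₑ r LP.•ₗ from₁ m y
    from₁-*ₗ r m (n NP.⊗ₑ p) = LP.≈-refl
    from₁-*ₗ r m NP.0ₑ       = LP.≈-refl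
    from₁-*ₗ r m (x NP.+ₑ y) = LP.+-cong (from₁-*ₗ r m x) (from₁-*ₗ r m y)
    from₁-*ₗ r m (NP.-ₑ x)   = LP.neg-cong (from₁-*ₗ r m x)

    from₁-*ᵣ : ∀ r m y → from₁ m (y NP.•ᵣ r) LP.≈ₑ from₁ m y LP.•ᵣ r
    from₁-*ᵣ r m (n NP.⊗ₑ p) = LP.≈-refl
    from₁-*ᵣ r m NP.0ₑ       = LP.≈-refl
    from₁-*ᵣ r m (x NP.+ₑ y) = LP.+-cong (from₁-*ᵣ r m x) (from₁-*ᵣ r m y)
    from₁-*ᵣ r m (NP.-ₑ x)   = LP.neg-cong (from₁-*ᵣ r m x)

    to₁-deg : ∀ {i j x p} → MN.Homogeneousₑ i x → P.Homogeneous j p → MR.Homogeneousₑ (i +ℤ j) (to₁ x p)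
    to₁-deg {p = p} (MN.resp q h) p∈ = MR.resp (TO₁.lift-cong p q) (to₁-deg h p∈)
    to₁-deg MN.zero p∈ = MR.zero
    to₁-deg (MN.add h h′) p∈ = MR.add (to₁-deg h p∈) (to₁-deg h′ p∈)
    to₁-deg (MN.neg h) p∈ = MR.neg (to₁-deg h p∈)
    to₁-deg {j = j} (MN.pure {i = k} {j = l} ≡.refl m∈ n∈) p∈ =
      MR.pure (≡.sym (ℤₚ.+-assoc k l j)) m∈ (NP.pure ≡.refl n∈ p∈)

    from₁-deg : ∀ {i j m y} → M.Homogeneous i m → NP.Homogeneousₑ j y → LP.Homogeneousₑ (i +ℤ j) (from₁ m y)
    from₁-deg {m = m} m∈ (NP.resp q h) = LP.resp (FROM₁.lift-cong m q) (from₁-deg m∈ h)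
    from₁-deg m∈ NP.zero = LP.zero
    from₁-deg m∈ (NP.add h h′) = LP.add (from₁-deg m∈ h) (from₁-deg m∈ h′)
    from₁-deg m∈ (NP.neg h) = LP.neg (from₁-deg m∈ h)
    from₁-deg {i = i} m∈ (NP.pure {i = k} {j = l} ≡.refl n∈ p∈) =
      LP.pure (ℤₚ.+-assoc i k l) (MN.pure ≡.refl m∈ n∈) p∈

    module TO = LP.LiftBimodule (M ⊗ (N ⊗ P)) to₁
      (λ {x} {x′} {p} {p′} q r → MR.≈-trans (TO₁.lift-cong p q) (to₁-congʳ x′ r))
      (λ x y p → MR.≈-refl) to₁-distrib to₁-balanced to₁-*ₗ to₁-*ᵣ
    module FROM = MR.LiftBimodule ((M ⊗ N) ⊗ P) from₁
      (λ {m} {m′} {y} {y′} q r → LP.≈-trans (from₁-congˡ q y) (FROM₁.lift-cong m′ r))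
      from₁-distrib (λ m x y → LP.≈-refl) from₁-balanced from₁-*ₗ from₁-*ᵣ

    to : BimoduleMap (bimodule ((M ⊗ N) ⊗ P)) (bimodule (M ⊗ (N ⊗ P)))
    to = TO.liftMap
    from : BimoduleMap (bimodule (M ⊗ (N ⊗ P))) (bimodule ((M ⊗ N) ⊗ P))
    from = FROM.liftMap

    to∘from₁ : ∀ m y → fun to (from₁ m y) MR.≈ₑ m MR.⊗ₑ y
    to∘from₁ m (n NP.⊗ₑ p) = MR.≈-refl
    to∘from₁ m NP.0ₑ       = MR.≈-sym (MR.⊗0 m)
    to∘from₁ m (x NP.+ₑ y) = MR.≈-trans (MR.+-cong (to∘from₁ m x) (to∘from₁ m y)) (MR.≈-sym (MR.⊗-distribˡ m x y))
    to∘from₁ m (NP.-ₑ y)   = MR.≈-trans (MR.neg-cong (to∘from₁ m y)) (MR.≈-sym (MR.⊗neg m y))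

    from∘to₁ : ∀ x p → fun from (to₁ x p) LP.≈ₑ x LP.⊗ₑ p
    from∘to₁ (m MN.⊗ₑ n) p = LP.≈-refl
    from∘to₁ MN.0ₑ       p = LP.≈-sym (LP.0⊗ p)
    from∘to₁ (x MN.+ₑ y) p = LP.≈-trans (LP.+-cong (from∘to₁ x p) (from∘to₁ y p)) (LP.≈-sym (LP.⊗-distribʳ x y p))
    from∘to₁ (MN.-ₑ x)   p = LP.≈-trans (LP.neg-cong (from∘to₁ x p)) (LP.≈-sym (LP.neg⊗ x p))

    to∘from : ∀ z → fun to (fun from z) MR.≈ₑ z
    to∘from (m MR.⊗ₑ y) = to∘from₁ m y
    to∘from MR.0ₑ       = MR.≈-refl
    to∘from (x MR.+ₑ y) = MR.+-cong (to∘from x) (to∘from y)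
    to∘from (MR.-ₑ x)   = MR.neg-cong (to∘from x)

    from∘to : ∀ z → fun from (fun to z) LP.≈ₑ z
    from∘to (x LP.⊗ₑ p) = from∘to₁ x p
    from∘to LP.0ₑ       = LP.≈-refl
    from∘to (x LP.+ₑ y) = LP.+-cong (from∘to x) (from∘to y)
    from∘to (LP.-ₑ x)   = LP.neg-cong (from∘to x)

  ⊗-assoc : ∀ {A B C D} (M : GradedBimodule A B) (N : GradedBimodule B C) (P : GradedBimodule C D) →
    (M ⊗ N) ⊗ P ≅ M ⊗ (N ⊗ P)
  ⊗-assoc M N P = record
    { to = to ; from = from
    ; to-deg = TO.lift-deg to₁-deg ; from-deg = FROM.lift-deg from₁-deg
    ; to∘from = to∘from ; from∘to = from∘to
    }
    where open Assoc M N P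

  record IsGradedSubring (R : GradedRing) (P : Pred (GradedRing.Carrier R) a) : Set a where
    open GradedRing R
    field
      0∈ : 0# ∈ P
      1∈ : 1# ∈ P
      +∈ : ∀ {x y} → x ∈ P → y ∈ P → x + y ∈ P
      *∈ : ∀ {x y} → x ∈ P → y ∈ P → x * y ∈ P
      -∈ : ∀ {x} → x ∈ P → - x ∈ P

  subring : (R : GradedRing) (P : Pred (GradedRing.Carrier R) a) → IsGradedSubring R P → GradedRing
  subring R P isSubring = record
    { commutativeRing = record
      { Carrier = Σ[ x ∈ R.Carrier ] x ∈ P
      ; _≈_ = λ x y → proj₁ x R.≈ proj₁ y
      ; _+_ = λ (x , x∈) (y , y∈) → x R.+ y , +∈ x∈ y∈
      ; _*_ = λ (x , x∈) (y , y∈) → x R.* y , *∈ x∈ y∈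
      ; -_ = λ (x , x∈) → R.- x , -∈ x∈
      ; 0# = R.0# , 0∈
      ; 1# = R.1# , 1∈
      ; isCommutativeRing = record
        { isRing = record
          { +-isAbelianGroup = record
            { isGroup = record
              { isMonoid = record
                { isSemigroup = record
                  { isMagma = record
                    { isEquivalence = record { refl = R.refl ; sym = R.sym ; trans = R.trans }
                    ; ∙-cong = R.+-cong
                    }
                  ; assoc = λ x y z → R.+-assoc (proj₁ x) (proj₁ y) (proj₁ z)
                  }
                ; identity = (λ x → R.+-identityˡ (proj₁ x)) , (λ x → R.+-identityʳ (proj₁ x))
                }
              ; inverse = (λ x → R.-‿inverseˡ (proj₁ x)) , (λ x → R.-‿inverseʳ (proj₁ x))
              ; ⁻¹-cong = R.-‿cong
              }
            ; comm = λ x y → R.+-comm (proj₁ x) (proj₁ y)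
            }
          ; *-cong = R.*-cong
          ; *-assoc = λ x y z → R.*-assoc (proj₁ x) (proj₁ y) (proj₁ z)
          ; *-identity = (λ x → R.*-identityˡ (proj₁ x)) , (λ x → R.*-identityʳ (proj₁ x))
          ; distrib = (λ x y z → R.distribˡ (proj₁ x) (proj₁ y) (proj₁ z))
                    , (λ x y z → R.distribʳ (proj₁ x) (proj₁ y) (proj₁ z))
          }
        ; *-comm = λ x y → R.*-comm (proj₁ x) (proj₁ y)
        }
      }
    ; Homogeneous = λ d x → R.Homogeneous d (proj₁ x)
    ; homogeneous-resp = R.homogeneous-resp
    ; homogeneous-0 = R.homogeneous-0
    ; homogeneous-+ = R.homogeneous-+
    ; homogeneous-neg = R.homogeneous-neg
    ; homogeneous-1 = R.homogeneous-1
    ; homogeneous-* = R.homogeneous-*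
    }
    where
    module R = GradedRing R
    open IsGradedSubring isSubring

  -- The subring P as a bimodule over the smaller subrings Q and Q′.
  restricted : (R : GradedRing) {P Q Q′ : Pred (GradedRing.Carrier R) a}
    (p : IsGradedSubring R P) (q : IsGradedSubring R Q) (q′ : IsGradedSubring R Q′) →
    Q ⊆ P → Q′ ⊆ P → GradedBimodule (subring R Q q) (subring R Q′ q′)
  restricted R {P} p q q′ Q⊆P Q′⊆P = record
    { bimodule = record
      { Carrierᴹ = S.Carrier ; _≈ᴹ_ = S._≈_ ; _+ᴹ_ = S._+_ ; 0ᴹ = S.0# ; -ᴹ_ = S.-_
      ; _*ₗ_ = λ (r , r∈) x → (r , Q⊆P r∈) S.* x
      ; _*ᵣ_ = λ x (r , r∈) → x S.* (r , Q′⊆P r∈)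
      ; isBimodule = record
        { isBisemimodule = record
          { +ᴹ-isCommutativeMonoid = S.+-isCommutativeMonoid
          ; isPreleftSemimodule = record
            { *ₗ-cong = R.*-cong
            ; *ₗ-zeroˡ = λ x → R.zeroˡ (proj₁ x)
            ; *ₗ-distribʳ = λ x r s → R.distribʳ (proj₁ x) (proj₁ r) (proj₁ s)
            ; *ₗ-identityˡ = λ x → R.*-identityˡ (proj₁ x)
            ; *ₗ-assoc = λ r s x → R.*-assoc (proj₁ r) (proj₁ s) (proj₁ x)
            ; *ₗ-zeroʳ = λ r → R.zeroʳ (proj₁ r)
            ; *ₗ-distribˡ = λ r x y → R.distribˡ (proj₁ r) (proj₁ x) (proj₁ y)
            }
          ; isPrerightSemimodule = record
            { *ᵣ-cong = R.*-cong
            ; *ᵣ-zeroʳ = λ x → R.zeroʳ (proj₁ x)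
            ; *ᵣ-distribˡ = λ x r s → R.distribˡ (proj₁ x) (proj₁ r) (proj₁ s)
            ; *ᵣ-identityʳ = λ x → R.*-identityʳ (proj₁ x)
            ; *ᵣ-assoc = λ x r s → R.*-assoc (proj₁ x) (proj₁ r) (proj₁ s)
            ; *ᵣ-zeroˡ = λ r → R.zeroˡ (proj₁ r)
            ; *ᵣ-distribʳ = λ r x y → R.distribʳ (proj₁ r) (proj₁ x) (proj₁ y)
            }
          ; *ₗ-*ᵣ-assoc = λ r x s → R.*-assoc (proj₁ r) (proj₁ x) (proj₁ s)
          }
        ; -ᴹ‿cong = R.-‿cong
        ; -ᴹ‿inverse = S.-‿inverse
        }
      }
    ; Homogeneous = S.Homogeneous
    ; homogeneous-resp = R.homogeneous-resp
    ; homogeneous-0 = R.homogeneous-0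
    ; homogeneous-+ = R.homogeneous-+
    ; homogeneous-neg = R.homogeneous-neg
    ; homogeneous-*ₗ = R.homogeneous-*
    ; homogeneous-*ᵣ = R.homogeneous-*
    }
    where
    module R = GradedRing R
    module S = GradedRing (subring R P p)

record CoxeterMatrix : Set₁ where
  field
    S        : Set
    m        : S → S → ℕ     -- m s t ≡ 0 encodes m_st = ∞
    m-diag   : ∀ s → m s s ≡ 1
    m-sym    : ∀ s t → m s t ≡ m t s
    m-offdiag : ∀ {s t} → s ≢ t → m s t ≢ 1

-- The length function and everything built on it need the word problem to be
-- decidable; the classical metatheory is supplied as the parameter em.
module Coxeter (em : ExcludedMiddle 0ℓ) (𝒞 : CoxeterMatrix) where
  open CoxeterMatrix 𝒞 public

  Word : Set
  Word = List S

  relator : S → S → Word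
  relator s t = concat (replicate (m s t) (s ∷ t ∷ []))

  -- The group W is the set of words in S modulo _~_.  Since m s s ≡ 1, the
  -- relators include s², so the quotient of the free monoid is a group.
  infix 4 _~_
  data _~_ : Word → Word → Set where
    ~-refl  : ∀ {u} → u ~ u
    ~-sym   : ∀ {u v} → u ~ v → v ~ u
    ~-trans : ∀ {u v w} → u ~ v → v ~ w → u ~ w
    ++-cong : ∀ {u u′ v v′} → u ~ u′ → v ~ v′ → u ++ v ~ u′ ++ v′
    ~-rel   : ∀ s t → relator s t ~ []

  s²~ε : ∀ s → s ∷ s ∷ [] ~ []
  s²~ε s = ≡.subst (λ k → concat (replicate k (s ∷ s ∷ [])) ~ []) (m-diag s) (~-rel s s)

  private
    ~-reflexive : ∀ {u v} → u ≡ v → u ~ v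
    ~-reflexive ≡.refl = ~-refl

    inverseˡ : ∀ w → reverse w ++ w ~ []
    inverseˡ []      = ~-refl
    inverseˡ (s ∷ w) = ~-trans (~-reflexive eq)
      (~-trans (++-cong (~-refl {reverse w}) (++-cong (s²~ε s) (~-refl {w}))) (inverseˡ w))
      where
      eq : reverse (s ∷ w) ++ (s ∷ w) ≡ reverse w ++ ((s ∷ s ∷ []) ++ w)
      eq = ≡.trans (≡.cong (_++ (s ∷ w)) (Listₚ.unfold-reverse s w))
        (Listₚ.++-assoc (reverse w) (s ∷ []) (s ∷ w))

    inverseʳ : ∀ w → w ++ reverse w ~ []
    inverseʳ w = ≡.subst (λ v → v ++ reverse w ~ []) (Listₚ.reverse-involutive w) (inverseˡ (reverse w))

    reverse-cong : ∀ {u v} → u ~ v → reverse u ~ reverse v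
    reverse-cong {u} {v} u~v =
      ~-trans (~-reflexive (≡.sym (Listₚ.++-identityʳ (reverse u))))
      (~-trans (++-cong (~-refl {reverse u}) (~-sym (inverseʳ v)))
      (~-trans (~-reflexive (≡.sym (Listₚ.++-assoc (reverse u) v (reverse v))))
      (++-cong (~-trans (++-cong (~-refl {reverse u}) (~-sym u~v)) (inverseˡ u)) (~-refl {reverse v}))))

  W : Group 0ℓ 0ℓ
  W = record
    { Carrier = Word ; _≈_ = _~_ ; _∙_ = _++_ ; ε = [] ; _⁻¹ = reverse
    ; isGroup = record
      { isMonoid = record
        { isSemigroup = record
          { isMagma = record
            { isEquivalence = record { refl = ~-refl ; sym = ~-sym ; trans = ~-trans }
            ; ∙-cong = ++-cong
            }
          ; assoc = λ u v w → ~-reflexive (Listₚ.++-assoc u v w)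
          }
        ; identity = (λ _ → ~-refl) , (λ w → ~-reflexive (Listₚ.++-identityʳ w))
        }
      ; inverse = inverseˡ , inverseʳ
      ; ⁻¹-cong = reverse-cong
      }
    }

  open Group W public using (_∙_; _⁻¹; ε)

  IsReduced : Word → Set
  IsReduced u = ∀ v → v ~ u → length u ≤ length v

  reduction : ∀ w → Σ[ u ∈ Word ] (u ~ w × IsReduced u)
  reduction w = go (length w) w ℕₚ.≤-refl
    where
    -- n bounds the length of the word still to be shortened.
    go : ∀ n w → length w ≤ n → Σ[ u ∈ Word ] (u ~ w × IsReduced u)
    go n w w≤n with em {∃[ v ] (v ~ w × length v < length w)}
    ... | no minimal = w , ~-refl , λ v v~w → ℕₚ.≮⇒≥ (λ v<w → minimal (v , v~w , v<w))
    go zero w w≤n | yes (v , _ , v<w) = ⊥-elim (ℕₚ.n≮0 (ℕₚ.<-≤-trans v<w w≤n))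
    go (suc n) w w≤n | yes (v , v~w , v<w) =
      let u , u~v , red = go n v (ℕₚ.≤-pred (ℕₚ.<-≤-trans v<w w≤n))
      in u , ~-trans u~v v~w , red

  reducedWord : Word → Word
  reducedWord w = proj₁ (reduction w)

  ℓ : Word → ℕ
  ℓ w = length (reducedWord w)

  simple : S → Word
  simple s = s ∷ []

  IsReflection : Word → Set
  IsReflection t = ∃[ x ] ∃[ s ] t ~ x ∙ simple s ∙ x ⁻¹

  -- The Bruhat order: generated by v < vt for a reflection t with ℓ(v) < ℓ(vt).
  infix 4 _≤ᴮ_
  data _≤ᴮ_ : Word → Word → Set where
    ≤ᴮ-refl : ∀ {u w} → u ~ w → u ≤ᴮ w
    ≤ᴮ-step : ∀ {u v w t} → u ≤ᴮ v → IsReflection t → w ~ v ∙ t → ℓ v < ℓ w → u ≤ᴮ w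

  infixr 7 _⋆ˢ_ _⋆_
  _⋆ˢ_ : S → Word → Word
  s ⋆ˢ w with ℓ w ℕₚ.<? ℓ (simple s ∙ w)
  ... | yes _ = simple s ∙ w
  ... | no  _ = w

  -- The *-product, computed along a reduced word of the left factor.
  _⋆_ : Word → Word → Word
  u ⋆ w = foldr _⋆ˢ_ w (reducedWord u)

  -- W⟨ I ⟩ is W_I; generators are involutions, so no inverses are needed.
  W⟨_⟩ : Pred S 0ℓ → Pred Word 0ℓ
  W⟨ I ⟩ w = ∃[ u ] (All I u × u ~ w)

  record IsFinitary (I : Pred S 0ℓ) : Set where
    field
      elements : List Word
      sound    : All W⟨ I ⟩ elements
      complete : ∀ {w} → w ∈ W⟨ I ⟩ → Any (w ~_) elements

  record FinitarySubset : Set₁ where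
    field
      subset     : Pred S 0ℓ
      isFinitary : IsFinitary subset
    open IsFinitary isFinitary public

  open FinitarySubset using (subset)

  longest : FinitarySubset → Word
  longest I = argmax ℓ ε (FinitarySubset.elements I)

  ℓ̂ : FinitarySubset → ℕ
  ℓ̂ I = ℓ (longest I)

  -- An element of W_I \ W / W_J, given by a representative and compared by _≈ᶜ_.
  record DoubleCoset (I J : FinitarySubset) : Set where
    constructor coset
    field
      representative : Word

  open DoubleCoset using (representative)

  infix 4 _∈ᶜ_ _≈ᶜ_ _≤ᶜ_ _<ᶜ_

  _∈ᶜ_ : ∀ {I J} → Word → DoubleCoset I J → Set
  _∈ᶜ_ {I} {J} x p = ∃[ a ] ∃[ b ] (a ∈ W⟨ subset I ⟩ × b ∈ W⟨ subset J ⟩ × x ~ a ∙ representative p ∙ b)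

  _≈ᶜ_ : ∀ {I J} → DoubleCoset I J → DoubleCoset I J → Set
  p ≈ᶜ q = representative p ∈ᶜ q

  -- Maximal and minimal elements are the greatest and least ones in Bruhat order.
  IsMaximal : ∀ {I J} → DoubleCoset I J → Word → Set
  IsMaximal p x = x ∈ᶜ p × (∀ y → y ∈ᶜ p → y ≤ᴮ x)

  IsMinimal : ∀ {I J} → DoubleCoset I J → Word → Set
  IsMinimal p x = x ∈ᶜ p × (∀ y → y ∈ᶜ p → x ≤ᴮ y)

  _≤ᶜ_ : ∀ {I J} → DoubleCoset I J → DoubleCoset I J → Set
  p ≤ᶜ q = ∃[ x ] ∃[ y ] (IsMinimal p x × IsMinimal q y × x ≤ᴮ y)

  _<ᶜ_ : ∀ {I J} → DoubleCoset I J → DoubleCoset I J → Set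
  p <ᶜ q = p ≤ᶜ q × ¬ (p ≈ᶜ q)

  _⋖_ : FinitarySubset → FinitarySubset → Set
  I ⋖ J = ∃[ s ] (s ∉ subset I × subset J ≐ subset I ∪ ｛ s ｝)

  data Step (I J : FinitarySubset) : Set where
    up   : I ⋖ J → Step I J
    down : J ⋖ I → Step I J

  infixr 5 _∷_
  data Expr : FinitarySubset → FinitarySubset → Set₁ where
    [_] : ∀ I → Expr I I
    _∷_ : ∀ {I J K} → Step I J → Expr J K → Expr I K

  infixr 5 _∘ᴱ_
  _∘ᴱ_ : ∀ {I J K} → Expr I J → Expr J K → Expr I K
  [ _ ]   ∘ᴱ Q = Q
  (s ∷ P) ∘ᴱ Q = s ∷ (P ∘ᴱ Q)

  -- w_{I₀} * ⋯ * w_{I_d}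
  starProduct : ∀ {I J} → Expr I J → Word
  starProduct [ I ]         = longest I
  starProduct (_∷_ {I} _ P) = longest I ⋆ starProduct P

  Expresses : ∀ {I J} → Expr I J → DoubleCoset I J → Set
  Expresses P p = IsMaximal p (starProduct P)

  -- The pairs (K₁ , L₁) , … , (K_m , L_m) of local maxima and the local minima
  -- following them.  fall K processes an expression reached by descending from
  -- the local maximum K.
  climb : ∀ {I J} → Expr I J → List (FinitarySubset × FinitarySubset)
  fall  : ∀ {I J} → FinitarySubset → Expr I J → List (FinitarySubset × FinitarySubset)
  climb [ I ]              = (I , I) ∷ []
  climb (up _ ∷ P)         = climb P
  climb (_∷_ {I} (down _) P) = fall I P
  fall K [ L ]             = (K , L) ∷ []
  fall K (down _ ∷ P)      = fall K P
  fall K (_∷_ {L} (up _) P)  = (K , L) ∷ climb P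

  factors : List (FinitarySubset × FinitarySubset) → List Word
  factors []                     = []
  factors ((K , _) ∷ [])         = longest K ∷ []
  factors ((K , L) ∷ KLs@(_ ∷ _)) = longest K ∙ longest L ⁻¹ ∷ factors KLs

  Reduced : ∀ {I J} → Expr I J → Set
  Reduced P = starProduct P ~ concat ws × sum (map ℓ ws) ≡ ℓ (starProduct P)
    where ws = factors (climb P)

fieldRing : ∀ {c ℓ₁ ℓ₂ : Level} → HeytingField c ℓ₁ ℓ₂ → CommutativeRing c ℓ₁
fieldRing 𝕜 = HeytingCommutativeRing.commutativeRing (HeytingField.heytingCommutativeRing 𝕜)

module LinearAlgebra {c ℓ₁ : Level} (𝕂 : CommutativeRing c ℓ₁) where
  private module 𝕂 = CommutativeRing 𝕂

  record LinearMap {a b a′ b′ : Level} (V : Module 𝕂 a b) (V′ : Module 𝕂 a′ b′)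
    : Set (c ⊔ a ⊔ b ⊔ a′ ⊔ b′) where
    field
      fun      : Module.Carrierᴹ V → Module.Carrierᴹ V′
      isLinear : IsModuleHomomorphism (Module.rawModule V) (Module.rawModule V′) fun
    open IsModuleHomomorphism isLinear public

  mkLinear : ∀ {a b a′ b′ : Level} (V : Module 𝕂 a b) (V′ : Module 𝕂 a′ b′)
    (f : Module.Carrierᴹ V → Module.Carrierᴹ V′) →
    (∀ {x y} → Module._≈ᴹ_ V x y → Module._≈ᴹ_ V′ (f x) (f y)) →
    (∀ x y → Module._≈ᴹ_ V′ (f (Module._+ᴹ_ V x y)) (Module._+ᴹ_ V′ (f x) (f y))) →
    (∀ r x → Module._≈ᴹ_ V′ (f (Module._*ₗ_ V r x)) (Module._*ₗ_ V′ r (f x))) →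
    LinearMap V V′
  mkLinear V V′ f f-cong f-+ f-* = record
    { fun = f
    ; isLinear = record { isBimoduleHomomorphism = record
      { +ᴹ-isGroupHomomorphism = additive⇒isGroupHomomorphism V.+ᴹ-abelianGroup V′.+ᴹ-abelianGroup f f-cong f-+
      ; *ₗ-homo = f-*
      ; *ᵣ-homo = λ r x → V′.≈ᴹ-trans (f-cong (V.≈ᴹ-sym (V.*ₗ-*ᵣ-coincident r x)))
          (V′.≈ᴹ-trans (f-* r x) (V′.*ₗ-*ᵣ-coincident r (f x)))
      } }
    }
    where
    module V = Module V
    module V′ = Module V′

  idLinear : ∀ {a b : Level} (V : Module 𝕂 a b) → LinearMap V V
  idLinear V = mkLinear V V id id (λ _ _ → Module.≈ᴹ-refl V) (λ _ _ → Module.≈ᴹ-refl V)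

  infixr 9 _∘ᴸ_
  _∘ᴸ_ : ∀ {a b a′ b′ a″ b″ : Level} {V : Module 𝕂 a b} {V′ : Module 𝕂 a′ b′}
    {V″ : Module 𝕂 a″ b″} → LinearMap V′ V″ → LinearMap V V′ → LinearMap V V″
  _∘ᴸ_ {V = V} {V″ = V″} g f = mkLinear V V″ (λ x → g.fun (f.fun x))
    (λ p → g.⟦⟧-cong (f.⟦⟧-cong p))
    (λ x y → V″.≈ᴹ-trans (g.⟦⟧-cong (f.+ᴹ-homo x y)) (g.+ᴹ-homo _ _))
    (λ r x → V″.≈ᴹ-trans (g.⟦⟧-cong (f.*ₗ-homo r x)) (g.*ₗ-homo r _))
    where
    module f = LinearMap f
    module g = LinearMap g
    module V″ = Module V″

  module _ {v ℓv : Level} (V : Module 𝕂 v ℓv) where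
    open Module V

    Dual : Set (c ⊔ ℓ₁ ⊔ v ⊔ ℓv)
    Dual = LinearMap V (TensorUnit.⟨module⟩ {R = 𝕂})

    combination : ∀ {n : ℕ} → Vector Carrierᴹ n → Vector 𝕂.Carrier n → Carrierᴹ
    combination b x = RawMonoidSum.sum +ᴹ-rawMonoid (λ i → x i *ₗ b i)

    IsBasis : ∀ {n : ℕ} → Vector Carrierᴹ n → Set (c ⊔ ℓ₁ ⊔ v ⊔ ℓv)
    IsBasis b =
      (∀ u → ∃[ x ] u ≈ᴹ combination b x) ×
      (∀ x → combination b x ≈ᴹ 0ᴹ → ∀ i → x i 𝕂.≈ 𝕂.0#)

    -- For a subspace U: the quotient V / U is spanned by one nonzero class.
    HasCodimensionOne : Pred Carrierᴹ ℓv → Set (c ⊔ v ⊔ ℓv)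
    HasCodimensionOne U = ∃[ u₀ ] (u₀ ∉ U × (∀ u → ∃[ x ] (u +ᴹ -ᴹ (x *ₗ u₀)) ∈ U))

    reflection : Carrierᴹ → Dual → LinearMap V V
    reflection α∨ α = mkLinear V V (λ u → u +ᴹ -ᴹ (α.fun u *ₗ α∨))
      (λ p → +ᴹ-cong p (-ᴹ‿cong (*ₗ-congʳ (α.⟦⟧-cong p))))
      (λ x y → ≈ᴹ-trans
        (+ᴹ-congˡ (≈ᴹ-trans
          (-ᴹ‿cong (≈ᴹ-trans (*ₗ-congʳ (α.+ᴹ-homo x y)) (*ₗ-distribʳ α∨ _ _)))
          (≈ᴹ-sym (P.⁻¹-∙-comm _ _))))
        (SP.interchange x y _ _))
      (λ r x → ≈ᴹ-trans
        (+ᴹ-congˡ (≈ᴹ-trans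
          (-ᴹ‿cong (≈ᴹ-trans (*ₗ-congʳ (α.*ₗ-homo r x)) (*ₗ-assoc r _ α∨)))
          (≈ᴹ-sym (*ₗ-neg r _))))
        (≈ᴹ-sym (*ₗ-distribˡ r x _)))
      where
      module α = LinearMap α
      module P = AbelianGroupProperties +ᴹ-abelianGroup
      module SP = CommutativeSemigroupProperties (AbelianGroup.commutativeSemigroup +ᴹ-abelianGroup)
      *ₗ-neg : ∀ r x → r *ₗ (-ᴹ x) ≈ᴹ -ᴹ (r *ₗ x)
      *ₗ-neg r x = P.inverseˡ-unique _ _ (≈ᴹ-trans (≈ᴹ-sym (*ₗ-distribˡ r _ x))
        (≈ᴹ-trans (*ₗ-congˡ (-ᴹ‿inverseˡ x)) (*ₗ-zeroʳ r)))

-- Sym(V*), the free commutative algebra on the vector space V*: ring terms in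
-- linear forms, modulo the ring axioms and the linear relations of V*.
module SymmetricAlgebra {c ℓ₁ v ℓv : Level} (𝕂 : CommutativeRing c ℓ₁) (V : Module 𝕂 v ℓv) where
  open LinearAlgebra 𝕂
  open GradedAlgebra (c ⊔ ℓ₁ ⊔ v ⊔ ℓv)
  private
    module 𝕂 = CommutativeRing 𝕂
    module V = Module V
    _at_ : Dual V → V.Carrierᴹ → 𝕂.Carrier
    _at_ = LinearMap.fun

  infixl 6 _+ˢ_
  infixl 7 _*ˢ_
  infix  8 -ˢ_
  infix  4 _≈ˢ_

  data Sym : Set (c ⊔ ℓ₁ ⊔ v ⊔ ℓv) where
    const : 𝕂.Carrier → Sym
    var   : Dual V → Sym
    _+ˢ_  : Sym → Sym → Sym
    _*ˢ_  : Sym → Sym → Sym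
    -ˢ_   : Sym → Sym

  data _≈ˢ_ : Sym → Sym → Set (c ⊔ ℓ₁ ⊔ v ⊔ ℓv) where
    ≈-refl      : ∀ {f} → f ≈ˢ f
    ≈-sym       : ∀ {f g} → f ≈ˢ g → g ≈ˢ f
    ≈-trans     : ∀ {f g h} → f ≈ˢ g → g ≈ˢ h → f ≈ˢ h
    +-cong      : ∀ {f f′ g g′} → f ≈ˢ f′ → g ≈ˢ g′ → f +ˢ g ≈ˢ f′ +ˢ g′
    *-cong      : ∀ {f f′ g g′} → f ≈ˢ f′ → g ≈ˢ g′ → f *ˢ g ≈ˢ f′ *ˢ g′
    neg-cong    : ∀ {f f′} → f ≈ˢ f′ → -ˢ f ≈ˢ -ˢ f′
    +-assoc     : ∀ f g h → (f +ˢ g) +ˢ h ≈ˢ f +ˢ (g +ˢ h)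
    +-comm      : ∀ f g → f +ˢ g ≈ˢ g +ˢ f
    +-identityˡ : ∀ f → const 𝕂.0# +ˢ f ≈ˢ f
    +-inverseˡ  : ∀ f → -ˢ f +ˢ f ≈ˢ const 𝕂.0#
    *-assoc     : ∀ f g h → (f *ˢ g) *ˢ h ≈ˢ f *ˢ (g *ˢ h)
    *-comm      : ∀ f g → f *ˢ g ≈ˢ g *ˢ f
    *-identityˡ : ∀ f → const 𝕂.1# *ˢ f ≈ˢ f
    distribˡ    : ∀ f g h → f *ˢ (g +ˢ h) ≈ˢ f *ˢ g +ˢ f *ˢ h
    const-cong  : ∀ {x y} → x 𝕂.≈ y → const x ≈ˢ const y
    const-+     : ∀ x y → const (x 𝕂.+ y) ≈ˢ const x +ˢ const y
    const-*     : ∀ x y → const (x 𝕂.* y) ≈ˢ const x *ˢ const y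
    var-cong    : ∀ {φ ψ} → (∀ u → φ at u 𝕂.≈ ψ at u) → var φ ≈ˢ var ψ
    var-+       : ∀ {φ ψ χ} → (∀ u → χ at u 𝕂.≈ φ at u 𝕂.+ ψ at u) → var χ ≈ˢ var φ +ˢ var ψ
    var-*       : ∀ {x φ χ} → (∀ u → χ at u 𝕂.≈ x 𝕂.* φ at u) → var χ ≈ˢ const x *ˢ var φ

  data HomogeneousSym : ℤ → Sym → Set (c ⊔ ℓ₁ ⊔ v ⊔ ℓv) where
    resp     : ∀ {d f g} → f ≈ˢ g → HomogeneousSym d f → HomogeneousSym d g
    zero     : ∀ {d} → HomogeneousSym d (const 𝕂.0#)
    constant : ∀ x → HomogeneousSym 0ℤ (const x)
    linear   : ∀ φ → HomogeneousSym (+ 2) (var φ)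
    add      : ∀ {d f g} → HomogeneousSym d f → HomogeneousSym d g → HomogeneousSym d (f +ˢ g)
    neg      : ∀ {d f} → HomogeneousSym d f → HomogeneousSym d (-ˢ f)
    mul      : ∀ {i j f g} → HomogeneousSym i f → HomogeneousSym j g → HomogeneousSym (i +ℤ j) (f *ˢ g)

  symRing : GradedRing
  symRing = record
    { commutativeRing = record
      { Carrier = Sym ; _≈_ = _≈ˢ_ ; _+_ = _+ˢ_ ; _*_ = _*ˢ_ ; -_ = -ˢ_
      ; 0# = const 𝕂.0# ; 1# = const 𝕂.1#
      ; isCommutativeRing = record
        { isRing = record
          { +-isAbelianGroup = record
            { isGroup = record
              { isMonoid = record
                { isSemigroup = record
                  { isMagma = record
                    { isEquivalence = record { refl = ≈-refl ; sym = ≈-sym ; trans = ≈-trans }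
                    ; ∙-cong = +-cong
                    }
                  ; assoc = +-assoc
                  }
                ; identity = +-identityˡ , λ f → ≈-trans (+-comm f _) (+-identityˡ f)
                }
              ; inverse = +-inverseˡ , λ f → ≈-trans (+-comm f _) (+-inverseˡ f)
              ; ⁻¹-cong = neg-cong
              }
            ; comm = +-comm
            }
          ; *-cong = *-cong
          ; *-assoc = *-assoc
          ; *-identity = *-identityˡ , λ f → ≈-trans (*-comm f _) (*-identityˡ f)
          ; distrib = distribˡ , λ f g h → ≈-trans (*-comm (g +ˢ h) f)
              (≈-trans (distribˡ f g h) (+-cong (*-comm f g) (*-comm f h)))
          }
        ; *-comm = *-comm
        }
      }
    ; Homogeneous = HomogeneousSym
    ; homogeneous-resp = resp
    ; homogeneous-0 = zero
    ; homogeneous-+ = add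
    ; homogeneous-neg = neg
    ; homogeneous-1 = constant 𝕂.1#
    ; homogeneous-* = mul
    }

  -- The algebra map induced by φ ↦ φ ∘ g on linear forms.
  pullback : LinearMap V V → Sym → Sym
  pullback g (const x) = const x
  pullback g (var φ)   = var (φ ∘ᴸ g)
  pullback g (f +ˢ h)  = pullback g f +ˢ pullback g h
  pullback g (f *ˢ h)  = pullback g f *ˢ pullback g h
  pullback g (-ˢ f)    = -ˢ pullback g f

module Realizations (em : ExcludedMiddle 0ℓ) (𝒞 : CoxeterMatrix)
  {c ℓ₁ ℓ₂ : Level} (𝕜 : HeytingField c ℓ₁ ℓ₂) where
  open Coxeter em 𝒞
  open LinearAlgebra (fieldRing 𝕜)
  open CommutativeRing (fieldRing 𝕜) using (_≈_; _+_; _*_; -_; _-_; 0#; 1#) renaming (Carrier to K)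

  -- If x = [2]_s and y = [2]_t then quantum x y n = [n]_s.
  quantum : K → K → ℕ → K
  quantum x y zero          = 0#
  quantum x y (suc zero)    = 1#
  quantum x y (suc (suc n)) = x * quantum y x (suc n) - quantum x y n

  wordMap : ∀ {v ℓv : Level} (V : Module (fieldRing 𝕜) v ℓv) → (S → LinearMap V V) → Word → LinearMap V V
  wordMap V σ []      = idLinear V
  wordMap V σ (s ∷ w) = σ s ∘ᴸ wordMap V σ w

  record Realization (v ℓv : Level) : Set (lsuc (c ⊔ ℓ₁ ⊔ v ⊔ ℓv)) where
    field
      V       : Module (fieldRing 𝕜) v ℓv
      dim     : ℕ
      basis   : Vector (Module.Carrierᴹ V) dim
      isBasis : IsBasis V basis
      α∨      : S → Module.Carrierᴹ V
      α       : S → Dual V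

    open Module V public using (_≈ᴹ_)

    ⟨_,_⟩ : Module.Carrierᴹ V → Dual V → K
    ⟨ u , φ ⟩ = LinearMap.fun φ u

    actV : Word → LinearMap V V
    actV = wordMap V (λ s → reflection V (α∨ s) (α s))

    -- The two-coloured quantum number [n]_s for the pair s, t.
    [_]⟨_,_⟩ : ℕ → S → S → K
    [ n ]⟨ s , t ⟩ = quantum (- ⟨ α∨ s , α t ⟩) (- ⟨ α∨ t , α s ⟩) n

    field
      pairing          : ∀ s → ⟨ α∨ s , α s ⟩ ≈ 1# + 1#
      isRepresentation : ∀ {u w} → u ~ w → ∀ x → LinearMap.fun (actV u) x ≈ᴹ LinearMap.fun (actV w) x
      technical        : ∀ s t → s ≢ t → m s t ≢ 0 → [ m s t ]⟨ s , t ⟩ ≈ 0#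

  module _ {v ℓv : Level} (𝒱 : Realization v ℓv) where
    open Realization 𝒱

    IsBalanced : Set ℓ₁
    IsBalanced = ∀ s t → s ≢ t → m s t ≢ 0 → [ m s t ∸ 1 ]⟨ s , t ⟩ ≈ 1#

    FixedBy : Word → Pred (Module.Carrierᴹ V) ℓv
    FixedBy w x = LinearMap.fun (actV w) x ≈ᴹ x

    IsReflectionFaithful : Set (c ⊔ v ⊔ ℓv)
    IsReflectionFaithful =
      (∀ w → (∀ x → x ∈ FixedBy w) → w ~ ε) ×
      (∀ w → HasCodimensionOne V (FixedBy w) ⇔ IsReflection w)

module BottSamelson (em : ExcludedMiddle 0ℓ) (𝒞 : CoxeterMatrix)
  {c ℓ₁ ℓ₂ : Level} (𝕜 : HeytingField c ℓ₁ ℓ₂) {v ℓv : Level}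
  (𝒱 : Realizations.Realization em 𝒞 𝕜 v ℓv) where
  open Coxeter em 𝒞
  open FinitarySubset using (subset)
  open Realizations em 𝒞 𝕜
  open Realization 𝒱 using (V; α; actV)
  open SymmetricAlgebra (fieldRing 𝕜) V public
  open GradedAlgebra (c ⊔ ℓ₁ ⊔ v ⊔ ℓv) public
  open GradedBimodule using (bimodule)

  -- (w φ)(x) = φ(w⁻¹ x) on linear forms, extended to R = Sym(V*).
  actR : Word → Sym → Sym
  actR w = pullback (actV (w ⁻¹))

  Invariant : FinitarySubset → Pred Sym (c ⊔ ℓ₁ ⊔ v ⊔ ℓv)
  Invariant I f = ∀ {w} → w ∈ W⟨ subset I ⟩ → actR w f ≈ˢ f

  invariant-isSubring : ∀ I → IsGradedSubring symRing (Invariant I)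
  invariant-isSubring I = record
    { 0∈ = λ _ → ≈-refl
    ; 1∈ = λ _ → ≈-refl
    ; +∈ = λ f∈ g∈ w∈ → +-cong (f∈ w∈) (g∈ w∈)
    ; *∈ = λ f∈ g∈ w∈ → *-cong (f∈ w∈) (g∈ w∈)
    ; -∈ = λ f∈ w∈ → neg-cong (f∈ w∈)
    }

  R^ : FinitarySubset → GradedRing
  R^ I = subring symRing (Invariant I) (invariant-isSubring I)

  -- Demazure w f g says that ∂_{s₁} ⋯ ∂_{s_k} (f) = g for w = s₁ ⋯ s_k, where
  -- ∂_s(f) is characterised by α_s ∂_s(f) = f − s f.
  Demazure : Word → Sym → Sym → Set (c ⊔ ℓ₁ ⊔ v ⊔ ℓv)
  Demazure []      f g = f ≈ˢ g
  Demazure (s ∷ w) f g = ∃[ h ] (Demazure w f h × var (α s) *ˢ g ≈ˢ h +ˢ -ˢ actR (simple s) h)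

  GeneralizedDemazureSurjectivity : Set (lsuc 0ℓ ⊔ c ⊔ ℓ₁ ⊔ v ⊔ ℓv)
  GeneralizedDemazureSurjectivity =
    ∀ I g → g ∈ Invariant I → ∃[ f ] Demazure (reducedWord (longest I)) f g

  ⋖⇒⊇ : ∀ {I J} → I ⋖ J → Invariant J ⊆ Invariant I
  ⋖⇒⊇ (_ , _ , _ , I∪s⊆J) f∈ (u , u⊆I , u~w) = f∈ (u , All.map (λ t∈I → I∪s⊆J (inj₁ t∈I)) u⊆I , u~w)

  BSˢ : ∀ {I J} → Step I J → GradedBimodule (R^ I) (R^ J)
  BSˢ {I} {J} (up I⋖J) =
    restricted symRing (invariant-isSubring I) (invariant-isSubring I) (invariant-isSubring J) id (⋖⇒⊇ {I} {J} I⋖J)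
  BSˢ {J} {I} (down I⋖J) =
    restricted symRing (invariant-isSubring I) (invariant-isSubring J) (invariant-isSubring I) (⋖⇒⊇ {I} {J} I⋖J) id
      ⟨ + ℓ̂ J -ℤ + ℓ̂ I ⟩

  BS∷ : ∀ {I J K} → Step I J → Expr J K → GradedBimodule (R^ I) (R^ K)
  BS∷ s [ _ ]   = BSˢ s
  BS∷ s (t ∷ P) = BSˢ s ⊗ BS∷ t P

  BS : ∀ {I J} → Expr I J → GradedBimodule (R^ I) (R^ J)
  BS [ I ]   = unit (R^ I)
  BS (s ∷ P) = BS∷ s P

  join∷ : ∀ {I J K L} (s : Step I J) (P : Expr J K) (Q : Expr K L) → BS∷ s P ⊗ BS Q ≅ BS∷ s (P ∘ᴱ Q)
  join∷ s [ _ ]   [ _ ]   = ⊗-unitʳ (BSˢ s)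
  join∷ s [ _ ]   (t ∷ Q) = ≅-refl
  join∷ s (t ∷ P) Q       = ≅-trans (⊗-assoc (BSˢ s) (BS∷ t P) (BS Q)) (⊗-≅ ≅-refl (join∷ t P Q))

  -- The canonical identification of BS(P ∘ Q) with BS(P) ⊗ BS(Q).
  join : ∀ {I J K} (P : Expr I J) (Q : Expr J K) → BS P ⊗ BS Q ≅ BS (P ∘ᴱ Q)
  join [ _ ]   Q = ⊗-unitˡ (BS Q)
  join (s ∷ P) Q = join∷ s P Q

  join₃ : ∀ {I J K L} (P : Expr I J) (Q : Expr J K) (R : Expr K L) →
    BS P ⊗ (BS Q ⊗ BS R) ≅ BS (P ∘ᴱ Q ∘ᴱ R)
  join₃ P Q R = ≅-trans (⊗-≅ ≅-refl (join Q R)) (join P (Q ∘ᴱ R))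

  Map : ∀ {A B : GradedRing} → GradedBimodule A B → GradedBimodule A B → Set (c ⊔ ℓ₁ ⊔ v ⊔ ℓv)
  Map M N = BimoduleMap (bimodule M) (bimodule N)

  -- id ⊗ f ⊗ id, transported to an endomorphism of BS(P ∘ Q ∘ R).
  sandwich : ∀ {I J K L} (P : Expr I J) (Q : Expr J K) (R : Expr K L) →
    Map (BS Q) (BS Q) → Map (BS (P ∘ᴱ Q ∘ᴱ R)) (BS (P ∘ᴱ Q ∘ᴱ R))
  sandwich P Q R f =
    φ.to ∘ᴹ (_⊗₁_ {M = BS P} {BS P} {BS Q ⊗ BS R} {BS Q ⊗ BS R} idMap
              (_⊗₁_ {M = BS Q} {BS Q} {BS R} {BS R} f idMap)) ∘ᴹ φ.from
    where module φ = _≅_ (join₃ P Q R)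

  record Factorization {I J} (C : Pred (DoubleCoset I J) 0ℓ) (M N : GradedBimodule (R^ I) (R^ J))
    : Set (lsuc 0ℓ ⊔ c ⊔ ℓ₁ ⊔ v ⊔ ℓv) where
    field
      {q}        : DoubleCoset I J
      q∈C        : q ∈ C
      expression : Expr I J
      expresses  : Expresses expression q
      into       : Hom M (BS expression)
      outof      : Hom (BS expression) N

    composite : Map M N
    composite = Hom.underlying outof ∘ᴹ Hom.underlying into

  -- Finite sums of morphisms factoring through some BS(M), M expressing an element of C.
  Hom[_] : ∀ {I J} → Pred (DoubleCoset I J) 0ℓ → (M N : GradedBimodule (R^ I) (R^ J)) →
    Pred (Map M N) (lsuc 0ℓ ⊔ c ⊔ ℓ₁ ⊔ v ⊔ ℓv)
  Hom[ C ] M N f = ∃[ fs ] IsSum f (map (Factorization.composite {C = C} {M} {N}) fs)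

  End[<_] : ∀ {I J} → DoubleCoset I J → (M : GradedBimodule (R^ I) (R^ J)) →
    Pred (Map M M) (lsuc 0ℓ ⊔ c ⊔ ℓ₁ ⊔ v ⊔ ℓv)
  End[< p ] M = Hom[ _<ᶜ p ] M M

{-# OPTIONS --safe #-}

-- By the exchange condition, multiplication by s ∈ S respects the Bruhat order
-- up to replacing one side by the other, so v ⋆ w is the greatest of the v′w′
-- with v′ ≤ v and w′ ≤ w; in particular ⋆ is monotone and associative, and
-- M ↦ P ∘ M ∘ R is monotone on expressed cosets.  If f factors through BS(M)
-- with M expressing q′ < q, then id ⊗ f ⊗ id factors through BS(P ∘ M ∘ R), and
-- it remains to see that the coset expressed by P ∘ M ∘ R is not p.q.r.  This
-- is a comparison of lengths: one always has
--   ℓ(max of P ∘ M ∘ R) ≤ ℓ(p̄) − ℓ(J) + ℓ(q̄′) − ℓ(K) + ℓ(r̄),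
-- while reducedness of P ∘ Q ∘ R gives
--   ℓ(max of p.q.r) ≥ ℓ(p̄) − ℓ(J) + ℓ(q̄) − ℓ(K) + ℓ(r̄),
-- and ℓ(q̄′) < ℓ(q̄).
module Submission where

open import Level using (Level; 0ℓ; _⊔_)
open import Algebra.Apartness.Bundles using (HeytingField)
open import Algebra.Bundles using (AbelianGroup; Group; Ring)
open import Algebra.Module.Bundles using (Bimodule)
open import Algebra.Morphism.Structures using (IsGroupHomomorphism)
open import Axiom.ExcludedMiddle using (ExcludedMiddle)
open import Data.Bool.Base using (Bool; true; false; _xor_)
open import Data.Bool.Properties using (xor-assoc; xor-identityʳ; xor-same)
open import Data.Integer.Base using (ℤ; 0ℤ) renaming (_+_ to _+ℤ_)
open import Data.List.Base using (List; []; _∷_; _++_; concat; foldr; length; map; replicate; reverse)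
open import Data.List.Relation.Binary.Permutation.Propositional using (↭-sym)
open import Data.List.Relation.Binary.Permutation.Propositional.Properties using (All-resp-↭; ↭-reverse)
open import Data.List.Relation.Binary.Sublist.Propositional using (_⊆_; _∷_; _∷ʳ_; ⊆-refl)
open import Data.List.Relation.Binary.Sublist.Propositional.Properties using (All-resp-⊆)
open import Data.List.Relation.Unary.All as All using (All; []; _∷_)
open import Data.Nat.Base using (ℕ; zero; suc; _+_; _≤_; _<_; s≤s; z≤n)
open import Data.Nat.Induction using (<-wellFounded)
open import Data.Nat.ListAction using (sum)
open import Data.Nat.Solver using (module +-*-Solver)
open import Data.Product.Base using (∃-syntax; _×_; _,_; proj₁; proj₂)
open import Data.Sum.Base using (_⊎_; inj₁; inj₂; [_,_]′; swap)
open import Function.Base using (_∘_)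
open import Function.Bundles using (_⇔_; mk⇔; module Equivalence)
open import Induction.WellFounded using (Acc; acc)
open import Relation.Binary.PropositionalEquality using (_≡_; refl; sym; trans; cong; cong₂; subst; subst₂)
open import Relation.Nullary using (yes; no; does; contradiction)
open import Relation.Nullary.Decidable using (dec-true; does-⇔)
open import Relation.Unary using (Pred; _∈_)
import Algebra.Properties.CommutativeSemigroup as CommutativeSemigroupProperties
import Algebra.Properties.Group as GroupProperties
import Data.Integer.Properties as ℤ
import Data.List.Extrema.Nat as Extrema
import Data.List.Properties as List
import Data.List.Relation.Unary.All.Properties as All
import Data.Nat.Properties as ℕ
import Relation.Binary.Reasoning.Setoid as SetoidReasoning
open import Defs

-- Since W is given only by a presentation, the exchange condition has to be extracted from the
-- relators. To a word w and an element t one attaches the parity of the number of letters of w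
-- whose deletion realises right multiplication by t. This parity obeys a cocycle rule under
-- concatenation and vanishes on relators, so it depends only on the group element; for a reflection
-- t it is odd exactly when wt is shorter than w.
--
-- The terms ℓ(J) and ℓ(K) in the estimates come from the junctions. A star product ending in J has
-- a reduced word that ends in one for w_J, and a star product starting in J absorbs that suffix, so
-- the junction saves at least ℓ(J). For the other estimate, sum ℓ(I) - ℓ(J) over the descending
-- steps from I to J. This quantity is additive under composition and, together with the length of
-- the last longest element, bounds the length of every star product from above. For a reduced
-- expression it is also a lower bound, because ℓ(w_K w_L⁻¹) ≥ ℓ(w_K) - ℓ(w_L).

module StrongExchange (em : ExcludedMiddle 0ℓ) (𝒞 : CoxeterMatrix) where
  open Coxeter em 𝒞
  private
    module W = Group W
  open GroupProperties W using (⁻¹-anti-homo-∙; ⁻¹-involutive; ∙-cancelˡ)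
  open SetoidReasoning W.setoid

  -- Cancellation and conjugation in W.

  ≡⇒~ : ∀ {u v} → u ≡ v → u ~ v
  ≡⇒~ refl = ~-refl

  ∙-congˡ : ∀ u {v v′} → v ~ v′ → u ∙ v ~ u ∙ v′
  ∙-congˡ u = W.∙-congˡ {u}

  ∙-congʳ : ∀ v {u u′} → u ~ u′ → u ∙ v ~ u′ ∙ v
  ∙-congʳ v = W.∙-congʳ {v}

  cancelˡ : ∀ u v → u ⁻¹ ∙ (u ∙ v) ~ v
  cancelˡ u v = begin
    u ⁻¹ ∙ (u ∙ v) ≈⟨ W.assoc (u ⁻¹) u v ⟨
    (u ⁻¹ ∙ u) ∙ v ≈⟨ ∙-congʳ v (W.inverseˡ u) ⟩
    v              ∎

  cancelˡ′ : ∀ u v → u ∙ (u ⁻¹ ∙ v) ~ v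
  cancelˡ′ u v = begin
    u ∙ (u ⁻¹ ∙ v) ≈⟨ W.assoc u (u ⁻¹) v ⟨
    (u ∙ u ⁻¹) ∙ v ≈⟨ ∙-congʳ v (W.inverseʳ u) ⟩
    v              ∎

  cancelʳ : ∀ u v → u ∙ v ⁻¹ ∙ v ~ u
  cancelʳ u v = begin
    u ∙ v ⁻¹ ∙ v   ≈⟨ W.assoc u (v ⁻¹) v ⟩
    u ∙ (v ⁻¹ ∙ v) ≈⟨ ∙-congˡ u (W.inverseˡ v) ⟩
    u ∙ ε          ≈⟨ W.identityʳ u ⟩
    u              ∎

  cancelʳ′ : ∀ u v → u ∙ v ∙ v ⁻¹ ~ u
  cancelʳ′ u v = begin
    u ∙ v ∙ v ⁻¹   ≈⟨ W.assoc u v (v ⁻¹) ⟩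
    u ∙ (v ∙ v ⁻¹) ≈⟨ ∙-congˡ u (W.inverseʳ v) ⟩
    u ∙ ε          ≈⟨ W.identityʳ u ⟩
    u              ∎

  simple-cancelˡ : ∀ s w → simple s ∙ (simple s ∙ w) ~ w
  simple-cancelˡ s w = ∙-congʳ w (s²~ε s)

  conj : Word → Word → Word
  conj w t = w ∙ t ∙ w ⁻¹

  conj-cong : ∀ w {t t′} → t ~ t′ → conj w t ~ conj w t′
  conj-cong w t~t′ = ∙-congʳ (w ⁻¹) (∙-congˡ w t~t′)

  conj-congˡ : ∀ {w w′} t → w ~ w′ → conj w t ~ conj w′ t
  conj-congˡ t w~w′ = W.∙-cong (∙-congʳ t w~w′) (W.⁻¹-cong w~w′)

  conj-ε : ∀ t → conj ε t ~ t
  conj-ε t = W.identityʳ t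

  conj-∙ : ∀ u w t → conj (u ∙ w) t ~ conj u (conj w t)
  conj-∙ u w t = begin
    u ∙ w ∙ t ∙ (u ∙ w) ⁻¹       ≈⟨ ∙-congˡ (u ∙ w ∙ t) (⁻¹-anti-homo-∙ u w) ⟩
    u ∙ w ∙ t ∙ (w ⁻¹ ∙ u ⁻¹)    ≈⟨ W.assoc (u ∙ w ∙ t) (w ⁻¹) (u ⁻¹) ⟨
    u ∙ w ∙ t ∙ w ⁻¹ ∙ u ⁻¹      ≈⟨ ∙-congʳ (u ⁻¹) (begin
      u ∙ w ∙ t ∙ w ⁻¹             ≈⟨ ∙-congʳ (w ⁻¹) (W.assoc u w t) ⟩
      u ∙ (w ∙ t) ∙ w ⁻¹           ≈⟨ W.assoc u (w ∙ t) (w ⁻¹) ⟩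
      u ∙ (w ∙ t ∙ w ⁻¹)           ∎) ⟩
    u ∙ conj w t ∙ u ⁻¹          ∎

  conj-inverse : ∀ w t → conj (w ⁻¹) (conj w t) ~ t
  conj-inverse w t = begin
    conj (w ⁻¹) (conj w t) ≈⟨ conj-∙ (w ⁻¹) w t ⟨
    conj (w ⁻¹ ∙ w) t      ≈⟨ conj-congˡ t (W.inverseˡ w) ⟩
    conj ε t               ≈⟨ conj-ε t ⟩
    t                      ∎

  conj⇒commute : ∀ w t x → conj w t ~ x → w ∙ t ~ x ∙ w
  conj⇒commute w t x eq = begin
    w ∙ t            ≈⟨ cancelʳ (w ∙ t) w ⟨
    conj w t ∙ w     ≈⟨ ∙-congʳ w eq ⟩
    x ∙ w            ∎

  commute⇒conj : ∀ w t x → w ∙ t ~ x ∙ w → conj w t ~ x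
  commute⇒conj w t x eq = begin
    w ∙ t ∙ w ⁻¹     ≈⟨ ∙-congʳ (w ⁻¹) eq ⟩
    x ∙ w ∙ w ⁻¹     ≈⟨ cancelʳ′ x w ⟩
    x                ∎

  -- The parity of the number of suffixes s ∷ v of w with v⁻¹ s v = t.
  parity : Word → Word → Bool
  parity []      t = false
  parity (s ∷ w) t = does (em {conj w t ~ simple s}) xor parity w t

  -- `em` is opaque, so its answers at two types can be compared only through a logical equivalence
  -- of the types.
  does-cong : ∀ {u u′ v v′} → u ~ u′ → v ~ v′ → does (em {u ~ v}) ≡ does (em {u′ ~ v′})
  does-cong u~ v~ = does-⇔ (mk⇔ (λ p → ~-trans (~-sym u~) (~-trans p v~))
    (λ p → ~-trans u~ (~-trans p (~-sym v~)))) em em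

  parity-congʳ : ∀ w {t t′} → t ~ t′ → parity w t ≡ parity w t′
  parity-congʳ []      t~t′ = refl
  parity-congʳ (s ∷ w) t~t′ = cong₂ _xor_ (does-cong (conj-cong w t~t′) ~-refl) (parity-congʳ w t~t′)

  -- Cocycle rule: a suffix that reaches into `u` carries all of `w` behind it, and testing it
  -- against `t` amounts to testing its part in `u` against `conj w t`.
  parity-∙ : ∀ u w t → parity (u ∙ w) t ≡ parity u (conj w t) xor parity w t
  parity-∙ []      w t = refl
  parity-∙ (s ∷ u) w t = trans
    (cong₂ _xor_ (does-cong (conj-∙ u w t) ~-refl) (parity-∙ u w t))
    (sym (xor-assoc (does (em {conj u (conj w t) ~ simple s})) (parity u (conj w t)) (parity w t)))

  -- For a dihedral relator the inverted elements are (ts)ʲt for j < 2m, and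
  -- those with indices j and j + m agree.
  module Dihedral (s t : S) (x : Word) where

    xorSum : ℕ → (ℕ → Bool) → Bool
    xorSum zero    g = false
    xorSum (suc n) g = g n xor xorSum n g

    xorSum-+ : ∀ m n g → xorSum (m + n) g ≡ xorSum m (g ∘ (_+ n)) xor xorSum n g
    xorSum-+ zero    n g = refl
    xorSum-+ (suc m) n g = trans (cong (g (m + n) xor_) (xorSum-+ m n g))
      (sym (xor-assoc (g (m + n)) (xorSum m (g ∘ (_+ n))) (xorSum n g)))

    xorSum-cong : ∀ n {g h : ℕ → Bool} → (∀ i → g i ≡ h i) → xorSum n g ≡ xorSum n h
    xorSum-cong zero    eq = refl
    xorSum-cong (suc n) eq = cong₂ _xor_ (eq n) (xorSum-cong n eq)

    power : ℕ → S → S → Word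
    power k a b = concat (replicate k (a ∷ b ∷ []))

    power-+ : ∀ k l a b → power (k + l) a b ≡ power k a b ++ power l a b
    power-+ zero    l a b = refl
    power-+ (suc k) l a b = cong (λ w → a ∷ b ∷ w) (power-+ k l a b)

    power-snoc : ∀ k a b → power (suc k) a b ≡ power k a b ++ (a ∷ b ∷ [])
    power-snoc k a b = trans (cong (λ n → power n a b) (ℕ.+-comm 1 k)) (power-+ k 1 a b)

    power-swap : ∀ k → power k s t ∙ power k t s ~ ε
    power-swap zero    = ~-refl
    power-swap (suc k) = begin
      power (suc k) s t ∙ power (suc k) t s
        ≡⟨ cong (_∙ power (suc k) t s) (power-snoc k s t) ⟩
      power k s t ∙ (s ∷ t ∷ []) ∙ (t ∷ s ∷ power k t s)
        ≈⟨ W.assoc (power k s t) (s ∷ t ∷ []) (t ∷ s ∷ power k t s) ⟩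
      power k s t ∙ (simple s ∙ (simple t ∙ (simple t ∙ (simple s ∙ power k t s))))
        ≈⟨ ∙-congˡ (power k s t) (∙-congˡ (simple s) (simple-cancelˡ t (simple s ∙ power k t s))) ⟩
      power k s t ∙ (simple s ∙ (simple s ∙ power k t s))
        ≈⟨ ∙-congˡ (power k s t) (simple-cancelˡ s (power k t s)) ⟩
      power k s t ∙ power k t s
        ≈⟨ power-swap k ⟩
      ε ∎

    power-reflect : ∀ k → simple t ∙ power k s t ~ power k t s ∙ simple t
    power-reflect zero    = ~-refl
    power-reflect (suc k) = ∙-congˡ (t ∷ s ∷ []) (power-reflect k)

    rotated : ℕ → Word
    rotated j = power j t s ∙ simple t

    inverted : ℕ → Bool
    inverted j = does (em {x ~ rotated j})

    solve-conj : ∀ k y → (conj (power k s t) x ~ y) ⇔ (x ~ power k t s ∙ (y ∙ power k s t))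
    solve-conj k y = mk⇔
      (λ eq → ∙-cancelˡ c _ _ (begin
        c ∙ x                     ≈⟨ conj⇒commute c x y eq ⟩
        y ∙ c                     ≈⟨ c-d (y ∙ c) ⟨
        c ∙ (d ∙ (y ∙ c))         ∎))
      (λ eq → commute⇒conj c x y (begin
        c ∙ x                     ≈⟨ ∙-congˡ c eq ⟩
        c ∙ (d ∙ (y ∙ c))         ≈⟨ c-d (y ∙ c) ⟩
        y ∙ c                     ∎))
      where
      c = power k s t
      d = power k t s
      c-d : ∀ z → c ∙ (d ∙ z) ~ z
      c-d z = begin
        c ∙ (d ∙ z) ≈⟨ W.assoc c d z ⟨
        c ∙ d ∙ z   ≈⟨ ∙-congʳ z (power-swap k) ⟩
        z           ∎

    rotate-even : ∀ k → power k t s ∙ (simple t ∙ power k s t) ~ rotated (k + k)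
    rotate-even k = begin
      d ∙ (simple t ∙ power k s t) ≈⟨ ∙-congˡ d (power-reflect k) ⟩
      d ∙ (d ∙ simple t)           ≈⟨ W.assoc d d (simple t) ⟨
      d ∙ d ∙ simple t             ≡⟨ cong (_∙ simple t) (power-+ k k t s) ⟨
      rotated (k + k)              ∎
      where d = power k t s

    rotate-odd : ∀ k → power k t s ∙ ((t ∷ s ∷ t ∷ []) ∙ power k s t) ~ rotated (suc (k + k))
    rotate-odd k = begin
      d ∙ ((t ∷ s ∷ []) ∙ (simple t ∙ power k s t)) ≈⟨ W.assoc d (t ∷ s ∷ []) (simple t ∙ power k s t) ⟨
      d ∙ (t ∷ s ∷ []) ∙ (simple t ∙ power k s t)   ≡⟨ cong (_∙ (simple t ∙ power k s t)) (power-snoc k t s) ⟨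
      (t ∷ s ∷ []) ∙ (d ∙ (simple t ∙ power k s t)) ≈⟨ ∙-congˡ (t ∷ s ∷ []) (rotate-even k) ⟩
      rotated (suc (k + k))                         ∎
      where d = power k t s

    conj-t⇔ : ∀ y → (conj (simple t) y ~ simple s) ⇔ (y ~ t ∷ s ∷ t ∷ [])
    conj-t⇔ y = mk⇔
      (λ eq → begin
        y                            ≈⟨ simple-cancelˡ t y ⟨
        simple t ∙ (simple t ∙ y)    ≈⟨ ∙-congˡ (simple t) (conj⇒commute (simple t) y (simple s) eq) ⟩
        t ∷ s ∷ t ∷ []               ∎)
      (λ eq → commute⇒conj (simple t) y (simple s)
        (~-trans (∙-congˡ (simple t) eq) (simple-cancelˡ t (s ∷ t ∷ []))))

    parity-power : ∀ k → parity (power k s t) x ≡ xorSum (k + k) inverted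
    parity-power zero    = refl
    parity-power (suc k) = trans (parity-∙ (s ∷ t ∷ []) c x) (trans
      -- The two new suffixes `s ∷ t ∷ c` and `t ∷ c` contribute the indices 2k+1 and 2k.
      (cong₂ _xor_
        (cong₂ _xor_
          (does-⇔ (mk⇔ (λ p → ~-trans (to (solve-conj k _) (to (conj-t⇔ _) p)) (rotate-odd k))
                       (λ p → from (conj-t⇔ _) (from (solve-conj k _) (~-trans p (~-sym (rotate-odd k))))))
            em em)
          (trans (xor-identityʳ _)
          (does-⇔ (mk⇔ (λ p → ~-trans (to (solve-conj k _) (~-trans (~-sym (conj-ε _)) p)) (rotate-even k))
                       (λ p → ~-trans (conj-ε _) (from (solve-conj k _) (~-trans p (~-sym (rotate-even k))))))
            em em)))
        (parity-power k))
      (trans (xor-assoc (inverted (suc (k + k))) (inverted (k + k)) (xorSum (k + k) inverted))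
        (cong (λ n → xorSum (suc n) inverted) (sym (ℕ.+-suc k k)))))
      where
      c = power k s t
      open Equivalence

    -- The 2m indices form two runs of length m, which agree termwise because (ts)ᵐ = 1, and so
    -- cancel modulo 2. For m = ∞, encoded by 0, the relator and the sum are both empty.
    parity-relator : parity (relator s t) x ≡ false
    parity-relator = trans (parity-power (m s t)) (trans (xorSum-+ (m s t) (m s t) inverted)
      (trans (cong (_xor xorSum (m s t) inverted) (xorSum-cong (m s t) periodic)) (xor-same (xorSum (m s t) inverted))))
      where
      ts~ε : power (m s t) t s ~ ε
      ts~ε = ~-trans (≡⇒~ (cong (λ n → power n t s) (m-sym s t))) (~-rel t s)
      periodic : ∀ j → inverted (j + m s t) ≡ inverted j
      periodic j = does-cong {u = x} ~-refl (begin
        power (j + m s t) t s ∙ simple t           ≡⟨ cong (_∙ simple t) (power-+ j (m s t) t s) ⟩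
        power j t s ∙ power (m s t) t s ∙ simple t ≈⟨ ∙-congʳ (simple t) (∙-congˡ (power j t s) ts~ε) ⟩
        power j t s ∙ ε ∙ simple t                 ≈⟨ ∙-congʳ (simple t) (W.identityʳ (power j t s)) ⟩
        rotated j                                  ∎)

  -- Induction on the derivation of `u ~ u′`: concatenation is handled by the cocycle rule, the
  -- relators by the dihedral count.
  parity-congˡ : ∀ {u u′} → u ~ u′ → ∀ t → parity u t ≡ parity u′ t
  parity-congˡ ~-refl        t = refl
  parity-congˡ (~-sym p)     t = sym (parity-congˡ p t)
  parity-congˡ (~-trans p q) t = trans (parity-congˡ p t) (parity-congˡ q t)
  parity-congˡ (++-cong {u} {u′} {v} {v′} p q) t = trans (parity-∙ u v t) (trans
    (cong₂ _xor_ (trans (parity-congˡ p (conj v t)) (parity-congʳ u′ (conj-congˡ t q))) (parity-congˡ q t))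
    (sym (parity-∙ u′ v′ t)))
  parity-congˡ (~-rel r s)   t = Dihedral.parity-relator r s t

  -- An odd count is nonzero, so some suffix `s ∷ v` satisfies `conj v t ~ simple s`; omitting that
  -- `s` gives the product with `t`. The result is recorded as a sublist so that its letters stay in
  -- any parabolic subset containing those of `w`.
  deletion : ∀ w t → parity w t ≡ true → ∃[ v ] (v ⊆ w × length w ≡ suc (length v) × w ∙ t ~ v)
  deletion (s ∷ w) t odd with em {conj w t ~ simple s}
  ... | yes wt~sw = w , s ∷ʳ ⊆-refl , refl ,
    ~-trans (∙-congˡ (simple s) (conj⇒commute w t (simple s) wt~sw)) (simple-cancelˡ s w)
  ... | no _ = let v , v⊆w , eq , wt~v = deletion w t odd in
    s ∷ v , refl ∷ v⊆w , cong suc eq , ∙-congˡ (simple s) wt~v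

  reflection-involutive : ∀ {t} → IsReflection t → t ∙ t ~ ε
  reflection-involutive {t} (x , s , t~) = begin
    t ∙ t                              ≈⟨ W.∙-cong t~ t~ ⟩
    conj x (simple s) ∙ conj x (simple s) ≈⟨ W.assoc (conj x (simple s)) (x ∙ simple s) (x ⁻¹) ⟨
    x ∙ simple s ∙ x ⁻¹ ∙ (x ∙ simple s) ∙ x ⁻¹ ≈⟨ ∙-congʳ (x ⁻¹) (begin
      x ∙ simple s ∙ x ⁻¹ ∙ (x ∙ simple s)  ≈⟨ W.assoc (x ∙ simple s) (x ⁻¹) (x ∙ simple s) ⟩
      x ∙ simple s ∙ (x ⁻¹ ∙ (x ∙ simple s)) ≈⟨ ∙-congˡ (x ∙ simple s) (cancelˡ x (simple s)) ⟩
      x ∙ simple s ∙ simple s               ≈⟨ W.assoc x (simple s) (simple s) ⟩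
      x ∙ (simple s ∙ simple s)             ≈⟨ ∙-congˡ x (s²~ε s) ⟩
      x ∙ ε                                 ≈⟨ W.identityʳ x ⟩
      x                                     ∎) ⟩
    x ∙ x ⁻¹                           ≈⟨ W.inverseʳ x ⟩
    ε                                  ∎

  -- Write t = x s x⁻¹. The contributions of `x` and `x ⁻¹` are equal, since `x ∙ x ⁻¹` has even
  -- parity, and cancel; the middle letter `s` contributes exactly once.
  parity-reflection : ∀ {t} → IsReflection t → parity t t ≡ true
  parity-reflection {t} (x , s , t~) = trans (parity-congˡ t~ t)
    (trans (parity-∙ (x ∙ simple s) (x ⁻¹) t)
    (trans (cong (_xor parity (x ⁻¹) t) (parity-congʳ (x ∙ simple s) t′~s))
    (trans (cong₂ _xor_ (parity-∙ x (simple s) (simple s)) x⁻¹-parity)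
    (trans (cong₂ (λ a b → (a xor b) xor p)
      (parity-congʳ x (commute⇒conj (simple s) (simple s) (simple s) ~-refl))
      (trans (xor-identityʳ _) (dec-true em (conj-ε (simple s)))))
    (lemma p)))))
    where
    p = parity x (simple s)
    t′~s : conj (x ⁻¹) t ~ simple s
    t′~s = ~-trans (conj-cong (x ⁻¹) t~) (conj-inverse x (simple s))
    lemma : ∀ b → (b xor true) xor b ≡ true
    lemma true  = refl
    lemma false = refl
    xor≡false : ∀ a b → false ≡ a xor b → b ≡ a
    xor≡false true  true  _ = refl
    xor≡false false false _ = refl
    x⁻¹-parity : parity (x ⁻¹) t ≡ p
    x⁻¹-parity = xor≡false p (parity (x ⁻¹) t)
      (trans (sym (parity-congˡ (W.inverseʳ x) t))
      (trans (parity-∙ x (x ⁻¹) t) (cong (_xor parity (x ⁻¹) t) (parity-congʳ x t′~s))))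

  -- The length function and its change under reflections.

  reducedWord-~ : ∀ w → reducedWord w ~ w
  reducedWord-~ w = proj₁ (proj₂ (reduction w))

  reducedWord-reduced : ∀ w → IsReduced (reducedWord w)
  reducedWord-reduced w = proj₂ (proj₂ (reduction w))

  ℓ≤length : ∀ {w v} → w ~ v → ℓ w ≤ length v
  ℓ≤length {w} {v} w~v = reducedWord-reduced w v (~-trans (~-sym w~v) (~-sym (reducedWord-~ w)))

  ℓ-cong : ∀ {u v} → u ~ v → ℓ u ≡ ℓ v
  ℓ-cong {u} {v} u~v = ℕ.≤-antisym (ℓ≤length (~-trans u~v (~-sym (reducedWord-~ v))))
    (ℓ≤length (~-trans (~-sym u~v) (~-sym (reducedWord-~ u))))

  ℓ-reduced : ∀ {w} → IsReduced w → ℓ w ≡ length w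
  ℓ-reduced {w} red = ℕ.≤-antisym (ℓ≤length {w} ~-refl) (red _ (reducedWord-~ w))

  ℓ-∙ : ∀ u v → ℓ (u ∙ v) ≤ ℓ u + ℓ v
  ℓ-∙ u v = subst (ℓ (u ∙ v) ≤_) (List.length-++ (reducedWord u))
    (ℓ≤length (~-sym (W.∙-cong (reducedWord-~ u) (reducedWord-~ v))))

  ℓ-⁻¹ : ∀ w → ℓ (w ⁻¹) ≡ ℓ w
  ℓ-⁻¹ w = ℕ.≤-antisym (ℓ⁻¹≤ w)
    (subst (_≤ ℓ (w ⁻¹)) (ℓ-cong (⁻¹-involutive w)) (ℓ⁻¹≤ (w ⁻¹)))
    where
    ℓ⁻¹≤ : ∀ w → ℓ (w ⁻¹) ≤ ℓ w
    ℓ⁻¹≤ w = subst (ℓ (w ⁻¹) ≤_) (List.length-reverse (reducedWord w))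
      (ℓ≤length (W.⁻¹-cong (~-sym (reducedWord-~ w))))

  parity⇒descent : ∀ w t → parity w t ≡ true → ℓ (w ∙ t) < ℓ w
  parity⇒descent w t odd =
    let v , _ , eq , wt~v = deletion (reducedWord w) t (trans (parity-congˡ (reducedWord-~ w) t) odd)
    in subst (ℓ (w ∙ t) <_) (sym eq)
      (s≤s (ℓ≤length (~-trans (∙-congʳ t (~-sym (reducedWord-~ w))) wt~v)))

  -- Multiplying by `t` flips the parity at `t`, so `t` is a descent of `w ∙ t`, and descending
  -- along it returns to `w`.
  parity⇒ascent : ∀ w {t} → IsReflection t → parity w t ≡ false → ℓ w < ℓ (w ∙ t)
  parity⇒ascent w {t} t-refl even = subst (_< ℓ (w ∙ t)) (ℓ-cong wtt~w) (parity⇒descent (w ∙ t) t odd)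
    where
    tt~ε = reflection-involutive t-refl
    wtt~w : w ∙ t ∙ t ~ w
    wtt~w = ~-trans (W.assoc w t t) (~-trans (∙-congˡ w tt~ε) (W.identityʳ w))
    odd : parity (w ∙ t) t ≡ true
    odd = trans (parity-∙ w t t)
      (cong₂ _xor_ (trans (parity-congʳ w (commute⇒conj t t t ~-refl)) even) (parity-reflection t-refl))

  parity-ascent : ∀ w {t} → ℓ w < ℓ (w ∙ t) → parity w t ≡ false
  parity-ascent w {t} w<wt with parity w t in eq
  ... | false = refl
  ... | true  = contradiction (parity⇒descent w t eq) (ℕ.<-asym w<wt)

  ascent⊎descent : ∀ w {t} → IsReflection t → ℓ w < ℓ (w ∙ t) ⊎ ℓ (w ∙ t) < ℓ w
  ascent⊎descent w {t} t-refl with parity w t in eq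
  ... | false = inj₁ (parity⇒ascent w t-refl eq)
  ... | true  = inj₂ (parity⇒descent w t eq)

-- The Bruhat order and its lifting properties.

module Bruhat (em : ExcludedMiddle 0ℓ) (𝒞 : CoxeterMatrix) where
  open Coxeter em 𝒞
  private
    module W = Group W
  open GroupProperties W using (⁻¹-anti-homo-∙; ⁻¹-involutive)
  open SetoidReasoning W.setoid
  open StrongExchange em 𝒞

  reflection-conj : ∀ w {t} → IsReflection t → IsReflection (conj w t)
  reflection-conj w {t} (x , s , t~) = w ∙ x , s , ~-trans (conj-cong w t~) (~-sym (conj-∙ w x (simple s)))

  reflection-simple : ∀ s → IsReflection (simple s)
  reflection-simple s = [] , s , ~-refl

  -- Bruhat steps multiply on the right; conjugation turns left multiplication by a reflection into
  -- such a step.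
  left⇒right : ∀ w t → t ∙ w ~ w ∙ conj (w ⁻¹) t
  left⇒right w t = ~-sym (begin
    w ∙ (w ⁻¹ ∙ t ∙ w ⁻¹ ⁻¹) ≈⟨ ∙-congˡ w (∙-congˡ (w ⁻¹ ∙ t) (⁻¹-involutive w)) ⟩
    w ∙ (w ⁻¹ ∙ t ∙ w)       ≈⟨ ∙-congˡ w (W.assoc (w ⁻¹) t w) ⟩
    w ∙ (w ⁻¹ ∙ (t ∙ w))     ≈⟨ cancelˡ′ w (t ∙ w) ⟩
    t ∙ w                    ∎)

  ascent⊎descentˡ : ∀ s w → ℓ w < ℓ (simple s ∙ w) ⊎ ℓ (simple s ∙ w) < ℓ w
  ascent⊎descentˡ s w = subst (λ n → ℓ w < n ⊎ n < ℓ w) (sym (ℓ-cong (left⇒right w (simple s))))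
    (ascent⊎descent w (reflection-conj (w ⁻¹) (reflection-simple s)))

  ≤ᴮ-trans : ∀ {u v w} → u ≤ᴮ v → v ≤ᴮ w → u ≤ᴮ w
  ≤ᴮ-trans (≤ᴮ-refl u~v) (≤ᴮ-refl v~w) = ≤ᴮ-refl (~-trans u~v v~w)
  ≤ᴮ-trans {u} {v} {w} (≤ᴮ-step u≤x r v~xt x<v) (≤ᴮ-refl v~w) =
    ≤ᴮ-step u≤x r (~-trans (~-sym v~w) v~xt) (subst (_ <_) (ℓ-cong v~w) x<v)
  ≤ᴮ-trans u≤v (≤ᴮ-step v≤x r w~xt x<w) = ≤ᴮ-step (≤ᴮ-trans u≤v v≤x) r w~xt x<w

  ≤ᴮ-respʳ : ∀ {u v w} → v ~ w → u ≤ᴮ v → u ≤ᴮ w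
  ≤ᴮ-respʳ v~w u≤v = ≤ᴮ-trans u≤v (≤ᴮ-refl v~w)

  ≤ᴮ-respˡ : ∀ {u v w} → u ~ v → u ≤ᴮ w → v ≤ᴮ w
  ≤ᴮ-respˡ u~v = ≤ᴮ-trans (≤ᴮ-refl (~-sym u~v))

  ≤ᴮ⇒~⊎< : ∀ {u w} → u ≤ᴮ w → u ~ w ⊎ ℓ u < ℓ w
  ≤ᴮ⇒~⊎< (≤ᴮ-refl u~w) = inj₁ u~w
  ≤ᴮ⇒~⊎< (≤ᴮ-step u≤v _ _ v<w) with ≤ᴮ⇒~⊎< u≤v
  ... | inj₁ u~v = inj₂ (subst (_< _) (sym (ℓ-cong u~v)) v<w)
  ... | inj₂ u<v = inj₂ (ℕ.<-trans u<v v<w)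

  ℓ-mono : ∀ {u w} → u ≤ᴮ w → ℓ u ≤ ℓ w
  ℓ-mono u≤w with ≤ᴮ⇒~⊎< u≤w
  ... | inj₁ u~w = ℕ.≤-reflexive (ℓ-cong u~w)
  ... | inj₂ u<w = ℕ.<⇒≤ u<w

  ≤ᴮ-antisym : ∀ {u w} → u ≤ᴮ w → w ≤ᴮ u → u ~ w
  ≤ᴮ-antisym u≤w w≤u with ≤ᴮ⇒~⊎< u≤w
  ... | inj₁ u~w = u~w
  ... | inj₂ u<w = contradiction u<w (ℕ.≤⇒≯ (ℓ-mono w≤u))

  ℓ≡0⇒~ε : ∀ {w} → ℓ w ≤ 0 → w ~ ε
  ℓ≡0⇒~ε {w} ℓ≤0 with reducedWord w | reducedWord-~ w | ℓ≤0
  ... | [] | ε~w | _ = ~-sym ε~w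

  ≤ᴮ-⁻¹ : ∀ {u w} → u ≤ᴮ w → u ⁻¹ ≤ᴮ w ⁻¹
  ≤ᴮ-⁻¹ (≤ᴮ-refl u~w) = ≤ᴮ-refl (W.⁻¹-cong u~w)
  ≤ᴮ-⁻¹ {u} {w} (≤ᴮ-step {v = v} {t = t} u≤v r w~vt v<w) = ≤ᴮ-step (≤ᴮ-⁻¹ u≤v) (reflection-conj v r) eq
    (subst₂ _<_ (sym (ℓ-⁻¹ v)) (sym (ℓ-⁻¹ w)) v<w)
    where
    t⁻¹~t : t ⁻¹ ~ t
    t⁻¹~t = ~-trans (∙-congʳ (t ⁻¹) (~-sym (reflection-involutive r))) (cancelʳ′ t t)
    eq : w ⁻¹ ~ v ⁻¹ ∙ conj v t
    eq = begin
      w ⁻¹                     ≈⟨ W.⁻¹-cong w~vt ⟩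
      (v ∙ t) ⁻¹               ≈⟨ ⁻¹-anti-homo-∙ v t ⟩
      t ⁻¹ ∙ v ⁻¹              ≈⟨ ∙-congʳ (v ⁻¹) t⁻¹~t ⟩
      t ∙ v ⁻¹                 ≈⟨ cancelˡ v (t ∙ v ⁻¹) ⟨
      v ⁻¹ ∙ (v ∙ (t ∙ v ⁻¹))  ≈⟨ ∙-congˡ (v ⁻¹) (W.assoc v t (v ⁻¹)) ⟨
      v ⁻¹ ∙ conj v t          ∎

  ≤ᴮ-ascent : ∀ {s w} → ℓ w < ℓ (simple s ∙ w) → w ≤ᴮ simple s ∙ w
  ≤ᴮ-ascent {s} {w} w<sw = ≤ᴮ-step (≤ᴮ-refl ~-refl) (reflection-conj (w ⁻¹) (reflection-simple s))
    (left⇒right w (simple s)) w<sw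

  ≤ᴮ-descent : ∀ {s w} → ℓ (simple s ∙ w) < ℓ w → simple s ∙ w ≤ᴮ w
  ≤ᴮ-descent {s} {w} sw<w = ≤ᴮ-respʳ (simple-cancelˡ s w)
    (≤ᴮ-ascent (subst (ℓ (simple s ∙ w) <_) (sym (ℓ-cong (simple-cancelˡ s w))) sw<w))

  ≤ᴮ-total : ∀ s w → w ≤ᴮ simple s ∙ w ⊎ simple s ∙ w ≤ᴮ w
  ≤ᴮ-total s w with ascent⊎descentˡ s w
  ... | inj₁ w<sw = inj₁ (≤ᴮ-ascent w<sw)
  ... | inj₂ sw<w = inj₂ (≤ᴮ-descent sw<w)

  -- Left multiplication by s changes the inversion parity of v only at v⁻¹ s v.
  ascent-∙ˡ : ∀ s v {t} → IsReflection t → ℓ v < ℓ (v ∙ t) →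
    ℓ (simple s ∙ v) < ℓ (simple s ∙ v ∙ t) ⊎ v ∙ t ~ simple s ∙ v
  ascent-∙ˡ s v {t} r v<vt with em {conj v t ~ simple s} in eq
  ... | yes p = inj₂ (conj⇒commute v t (simple s) p)
  ... | no  _ = inj₁ (parity⇒ascent (s ∷ v) r
    (trans (cong (λ d → does d xor parity v t) eq) (parity-ascent v v<vt)))

  ≤ᴮ-step-∙ˡ : ∀ s {v w t} → IsReflection t → w ~ v ∙ t → ℓ v < ℓ w →
    simple s ∙ v ≤ᴮ simple s ∙ w ⊎ w ~ simple s ∙ v
  ≤ᴮ-step-∙ˡ s {v} {w} {t} r w~vt v<w with ascent-∙ˡ s v r (subst (ℓ v <_) (ℓ-cong w~vt) v<w)
  ... | inj₁ sv<svt = inj₁ (≤ᴮ-step (≤ᴮ-refl ~-refl) r (∙-congˡ (simple s) w~vt)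
    (subst (ℓ (simple s ∙ v) <_) (sym (ℓ-cong (∙-congˡ (simple s) w~vt))) sv<svt))
  ... | inj₂ vt~sv  = inj₂ (~-trans w~vt vt~sv)

  -- Lifting property as a dichotomy, free of descent conditions. Along a chain of reflection steps
  -- from v to w, either the step survives left multiplication by `s`, or w = sv, and then sw is v
  -- again.
  lift↓ : ∀ s {u w} → u ≤ᴮ w → u ≤ᴮ simple s ∙ w ⊎ simple s ∙ u ≤ᴮ simple s ∙ w
  lift↓ s (≤ᴮ-refl u~w) = inj₂ (≤ᴮ-refl (∙-congˡ (simple s) u~w))
  lift↓ s {u} {w} (≤ᴮ-step {v = v} u≤v r w~vt v<w) with ≤ᴮ-step-∙ˡ s r w~vt v<w | lift↓ s u≤v
  ... | inj₂ w~sv  | _            = inj₁ (≤ᴮ-respʳ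
    (~-sym (~-trans (∙-congˡ (simple s) w~sv) (simple-cancelˡ s v))) u≤v)
  ... | inj₁ sv≤sw | inj₁ u≤sv    = inj₁ (≤ᴮ-trans u≤sv sv≤sw)
  ... | inj₁ sv≤sw | inj₂ su≤sv   = inj₂ (≤ᴮ-trans su≤sv sv≤sw)

  lift↑ : ∀ s {u w} → u ≤ᴮ w → simple s ∙ u ≤ᴮ w ⊎ simple s ∙ u ≤ᴮ simple s ∙ w
  lift↑ s (≤ᴮ-refl u~w) = inj₂ (≤ᴮ-refl (∙-congˡ (simple s) u~w))
  lift↑ s {u} {w} (≤ᴮ-step {v = v} u≤v r w~vt v<w) with lift↑ s u≤v | ≤ᴮ-step-∙ˡ s r w~vt v<w
  ... | inj₁ su≤v  | _            = inj₁ (≤ᴮ-step su≤v r w~vt v<w)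
  ... | inj₂ su≤sv | inj₁ sv≤sw   = inj₂ (≤ᴮ-trans su≤sv sv≤sw)
  ... | inj₂ su≤sv | inj₂ w~sv    = inj₁ (≤ᴮ-respʳ (~-sym w~sv) su≤sv)

  ≤ᴮ-⁻¹-cancel : ∀ {u w} → u ⁻¹ ≤ᴮ w ⁻¹ → u ≤ᴮ w
  ≤ᴮ-⁻¹-cancel {u} {w} p = ≤ᴮ-respˡ (⁻¹-involutive u) (≤ᴮ-respʳ (⁻¹-involutive w) (≤ᴮ-⁻¹ p))

  ⁻¹-simple : ∀ w s → (w ∙ simple s) ⁻¹ ~ simple s ∙ w ⁻¹
  ⁻¹-simple w s = ⁻¹-anti-homo-∙ w (simple s)

  lift↓ʳ : ∀ s {u w} → u ≤ᴮ w → u ≤ᴮ w ∙ simple s ⊎ u ∙ simple s ≤ᴮ w ∙ simple s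
  lift↓ʳ s {u} {w} u≤w with lift↓ s (≤ᴮ-⁻¹ u≤w)
  ... | inj₁ p = inj₁ (≤ᴮ-⁻¹-cancel (≤ᴮ-respʳ (~-sym (⁻¹-simple w s)) p))
  ... | inj₂ p = inj₂ (≤ᴮ-⁻¹-cancel (≤ᴮ-respˡ (~-sym (⁻¹-simple u s)) (≤ᴮ-respʳ (~-sym (⁻¹-simple w s)) p)))

  lift↑ʳ : ∀ s {u w} → u ≤ᴮ w → u ∙ simple s ≤ᴮ w ⊎ u ∙ simple s ≤ᴮ w ∙ simple s
  lift↑ʳ s {u} {w} u≤w with lift↑ s (≤ᴮ-⁻¹ u≤w)
  ... | inj₁ p = inj₁ (≤ᴮ-⁻¹-cancel (≤ᴮ-respˡ (~-sym (⁻¹-simple u s)) p))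
  ... | inj₂ p = inj₂ (≤ᴮ-⁻¹-cancel (≤ᴮ-respˡ (~-sym (⁻¹-simple u s)) (≤ᴮ-respʳ (~-sym (⁻¹-simple w s)) p)))

  -- Extremality against generators and against parabolic subgroups.

  MaxˡIn MaxʳIn MinˡIn MinʳIn : Pred S 0ℓ → Pred Word 0ℓ
  MaxˡIn I y = ∀ {s} → s ∈ I → simple s ∙ y ≤ᴮ y
  MaxʳIn I y = ∀ {s} → s ∈ I → y ∙ simple s ≤ᴮ y
  MinˡIn I y = ∀ {s} → s ∈ I → y ≤ᴮ simple s ∙ y
  MinʳIn I y = ∀ {s} → s ∈ I → y ≤ᴮ y ∙ simple s

  -- The letters of a word for `a` are prepended one at a time: by `lift↑` the new product lies
  -- below `y` or below `simple s ∙ y`, and the latter lies below `y` by maximality.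
  maxˡ-absorbs : ∀ {I y a x} → MaxˡIn I y → a ∈ W⟨ I ⟩ → x ≤ᴮ y → a ∙ x ≤ᴮ y
  maxˡ-absorbs {I} {y} {a} {x} max (u , u⊆I , u~a) x≤y = ≤ᴮ-respˡ (∙-congʳ x u~a) (go u⊆I)
    where
    go : ∀ {u} → All I u → u ∙ x ≤ᴮ y
    go [] = x≤y
    go {s ∷ u} (s∈I ∷ u⊆I) with lift↑ s (go u⊆I)
    ... | inj₁ p = p
    ... | inj₂ p = ≤ᴮ-trans p (max s∈I)

  maxʳ-absorbs : ∀ {I y b x} → MaxʳIn I y → b ∈ W⟨ I ⟩ → x ≤ᴮ y → x ∙ b ≤ᴮ y
  maxʳ-absorbs {I} {y} {b} {x} max (u , u⊆I , u~b) x≤y = ≤ᴮ-respˡ (∙-congˡ x u~b) (go u⊆I x≤y)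
    where
    go : ∀ {u x} → All I u → x ≤ᴮ y → x ∙ u ≤ᴮ y
    go [] x≤y = ≤ᴮ-respˡ (~-sym (W.identityʳ _)) x≤y
    go {s ∷ u} {x} (s∈I ∷ u⊆I) x≤y = ≤ᴮ-respˡ (W.assoc x (simple s) u) (go u⊆I xs≤y)
      where
      xs≤y : x ∙ simple s ≤ᴮ y
      xs≤y with lift↑ʳ s x≤y
      ... | inj₁ p = p
      ... | inj₂ p = ≤ᴮ-trans p (max s∈I)

  minˡ-absorbs : ∀ {I y a x} → MinˡIn I y → a ∈ W⟨ I ⟩ → y ≤ᴮ x → y ≤ᴮ a ∙ x
  minˡ-absorbs {I} {y} {a} {x} min (u , u⊆I , u~a) y≤x = ≤ᴮ-respʳ (∙-congʳ x u~a) (go u⊆I)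
    where
    go : ∀ {u} → All I u → y ≤ᴮ u ∙ x
    go [] = y≤x
    go {s ∷ u} (s∈I ∷ u⊆I) with lift↓ s (go u⊆I)
    ... | inj₁ p = p
    ... | inj₂ p = ≤ᴮ-trans (min s∈I) p

  minʳ-absorbs : ∀ {I y b x} → MinʳIn I y → b ∈ W⟨ I ⟩ → y ≤ᴮ x → y ≤ᴮ x ∙ b
  minʳ-absorbs {I} {y} {b} {x} min (u , u⊆I , u~b) y≤x = ≤ᴮ-respʳ (∙-congˡ x u~b) (go u⊆I y≤x)
    where
    go : ∀ {u x} → All I u → y ≤ᴮ x → y ≤ᴮ x ∙ u
    go [] y≤x = ≤ᴮ-respʳ (~-sym (W.identityʳ _)) y≤x
    go {s ∷ u} {x} (s∈I ∷ u⊆I) y≤x = ≤ᴮ-respʳ (W.assoc x (simple s) u) (go u⊆I y≤xs)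
      where
      y≤xs : y ≤ᴮ x ∙ simple s
      y≤xs with lift↓ʳ s y≤x
      ... | inj₁ p = p
      ... | inj₂ p = ≤ᴮ-trans (min s∈I) p

  W⟨⟩-ε : ∀ {I} → ε ∈ W⟨ I ⟩
  W⟨⟩-ε = [] , [] , ~-refl

  W⟨⟩-simple : ∀ {I s} → s ∈ I → simple s ∈ W⟨ I ⟩
  W⟨⟩-simple {s = s} s∈I = simple s , s∈I ∷ [] , ~-refl

  W⟨⟩-∙ : ∀ {I a b} → a ∈ W⟨ I ⟩ → b ∈ W⟨ I ⟩ → a ∙ b ∈ W⟨ I ⟩
  W⟨⟩-∙ (u , u⊆I , u~a) (v , v⊆I , v~b) = u ++ v , All.++⁺ u⊆I v⊆I , W.∙-cong u~a v~b

  W⟨⟩-⁻¹ : ∀ {I a} → a ∈ W⟨ I ⟩ → a ⁻¹ ∈ W⟨ I ⟩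
  W⟨⟩-⁻¹ (u , u⊆I , u~a) = reverse u , All-resp-↭ (↭-sym (↭-reverse u)) u⊆I , W.⁻¹-cong u~a

  -- Allows coset comparison to start from arbitrary representatives. For each letter by which `y`
  -- is multiplied, lifting decides whether `x` is multiplied by it too, so `a′` and `b′` are
  -- spelled by subwords.
  translate-≤ᴮ : ∀ {I L x y a b} → a ∈ W⟨ I ⟩ → b ∈ W⟨ L ⟩ → x ≤ᴮ y →
    ∃[ a′ ] ∃[ b′ ] (a′ ∈ W⟨ I ⟩ × b′ ∈ W⟨ L ⟩ × a′ ∙ x ∙ b′ ≤ᴮ a ∙ y ∙ b)
  translate-≤ᴮ {I} {L} {x} {y} {a} {b} (u , u⊆I , u~a) (v , v⊆L , v~b) x≤y =
    let a′ , a′∈ , p = goˡ u⊆I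
        b′ , b′∈ , q = goʳ v⊆L p
    in a′ , b′ , a′∈ , b′∈ , ≤ᴮ-respʳ (W.∙-cong (∙-congʳ y u~a) v~b) q
    where
    goˡ : ∀ {u} → All I u → ∃[ a′ ] (a′ ∈ W⟨ I ⟩ × a′ ∙ x ≤ᴮ u ∙ y)
    goˡ [] = ε , W⟨⟩-ε , x≤y
    goˡ {s ∷ u} (s∈I ∷ u⊆I) with goˡ u⊆I
    ... | a′ , a′∈ , p with lift↓ s p
    ... | inj₁ q = a′ , a′∈ , q
    ... | inj₂ q = simple s ∙ a′ , W⟨⟩-∙ (W⟨⟩-simple s∈I) a′∈ , q
    goʳ : ∀ {v x y} → All L v → x ≤ᴮ y → ∃[ b′ ] (b′ ∈ W⟨ L ⟩ × x ∙ b′ ≤ᴮ y ∙ v)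
    goʳ [] p = ε , W⟨⟩-ε , ≤ᴮ-respˡ (~-sym (W.identityʳ _)) (≤ᴮ-respʳ (~-sym (W.identityʳ _)) p)
    goʳ {s ∷ v} {x} {y} (s∈L ∷ v⊆L) p with lift↓ʳ s p
    ... | inj₁ q = let b′ , b′∈ , r = goʳ v⊆L q in b′ , b′∈ , ≤ᴮ-respʳ (W.assoc y (simple s) v) r
    ... | inj₂ q = let b′ , b′∈ , r = goʳ v⊆L q in simple s ∙ b′ , W⟨⟩-∙ (W⟨⟩-simple s∈L) b′∈ ,
      ≤ᴮ-respˡ (W.assoc x (simple s) b′) (≤ᴮ-respʳ (W.assoc y (simple s) v) r)

  -- The star product as a greatest element.

  ⋆ˢ-cases : ∀ s w → (ℓ w < ℓ (simple s ∙ w) × s ⋆ˢ w ≡ simple s ∙ w) ⊎ (ℓ (simple s ∙ w) < ℓ w × s ⋆ˢ w ≡ w)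
  ⋆ˢ-cases s w with ℓ w ℕ.<? ℓ (simple s ∙ w)
  ... | yes w<sw = inj₁ (w<sw , refl)
  ... | no  w≮sw with ascent⊎descentˡ s w
  ...   | inj₁ w<sw = contradiction w<sw w≮sw
  ...   | inj₂ sw<w = inj₂ (sw<w , refl)

  ≤-⋆ˢ : ∀ s w → w ≤ᴮ s ⋆ˢ w
  ≤-⋆ˢ s w with ⋆ˢ-cases s w
  ... | inj₁ (w<sw , eq) rewrite eq = ≤ᴮ-ascent w<sw
  ... | inj₂ (sw<w , eq) rewrite eq = ≤ᴮ-refl ~-refl

  ∙≤⋆ˢ : ∀ s w → simple s ∙ w ≤ᴮ s ⋆ˢ w
  ∙≤⋆ˢ s w with ⋆ˢ-cases s w
  ... | inj₁ (w<sw , eq) rewrite eq = ≤ᴮ-refl ~-refl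
  ... | inj₂ (sw<w , eq) rewrite eq = ≤ᴮ-descent sw<w

  ≤-⋆ˢ′ : ∀ s {v w} → v ≤ᴮ w → v ≤ᴮ s ⋆ˢ w
  ≤-⋆ˢ′ s {w = w} v≤w = ≤ᴮ-trans v≤w (≤-⋆ˢ s w)

  ∙≤⋆ˢ′ : ∀ s {v w} → v ≤ᴮ w → simple s ∙ v ≤ᴮ s ⋆ˢ w
  ∙≤⋆ˢ′ s {v} {w} v≤w with lift↑ s v≤w
  ... | inj₁ p = ≤ᴮ-trans p (≤-⋆ˢ s w)
  ... | inj₂ p = ≤ᴮ-trans p (∙≤⋆ˢ s w)

  ⋆ˢ-mono : ∀ s {v w} → v ≤ᴮ w → s ⋆ˢ v ≤ᴮ s ⋆ˢ w
  ⋆ˢ-mono s {v} {w} v≤w with ⋆ˢ-cases s v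
  ... | inj₂ (_ , eq) = ≤ᴮ-respˡ (≡⇒~ (sym eq)) (≤-⋆ˢ′ s v≤w)
  ... | inj₁ (_ , eq) = ≤ᴮ-respˡ (≡⇒~ (sym eq)) (∙≤⋆ˢ′ s v≤w)

  ⋆ˢ-absorbed : ∀ {s w} → simple s ∙ w ≤ᴮ w → s ⋆ˢ w ≡ w
  ⋆ˢ-absorbed {s} {w} sw≤w with ⋆ˢ-cases s w
  ... | inj₁ (w<sw , _) = contradiction w<sw (ℕ.≤⇒≯ (ℓ-mono sw≤w))
  ... | inj₂ (_ , eq)   = eq

  ℓ-⋆ˢ : ∀ s w → ℓ (s ⋆ˢ w) ≤ suc (ℓ w)
  ℓ-⋆ˢ s w with ⋆ˢ-cases s w
  ... | inj₁ (_ , eq) = subst (λ x → ℓ x ≤ suc (ℓ w)) (sym eq)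
    (ℕ.≤-trans (ℓ-∙ (simple s) w) (ℕ.+-monoˡ-≤ (ℓ w) (ℓ≤length {simple s} ~-refl)))
  ... | inj₂ (_ , eq) = subst (λ x → ℓ x ≤ suc (ℓ w)) (sym eq) (ℕ.n≤1+n (ℓ w))

  act : Word → Word → Word
  act u w = foldr _⋆ˢ_ w u

  reduced-tail : ∀ {s u} → IsReduced (s ∷ u) → IsReduced u
  reduced-tail {s} red v v~u = ℕ.≤-pred (red (s ∷ v) (∙-congˡ (simple s) v~u))

  reduced-ascent : ∀ {s u} → IsReduced (s ∷ u) → ℓ u < ℓ (s ∷ u)
  reduced-ascent {s} {u} red = subst₂ _<_ (sym (ℓ-reduced (reduced-tail red))) (sym (ℓ-reduced red)) ℕ.≤-refl

  -- Peel off the first letter `s` of the reduced word: `lift↓` puts `v′` or `simple s ∙ v′` below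
  -- the remaining word, and `s ⋆ˢ_` dominates both its argument and the `s`-multiple of it.
  act-upper : ∀ {v w v′ w′} → IsReduced v → v′ ≤ᴮ v → w′ ≤ᴮ w → v′ ∙ w′ ≤ᴮ act v w
  act-upper {[]} {w} {v′} {w′} red v′≤v w′≤w =
    ≤ᴮ-respˡ (∙-congʳ w′ (~-sym (ℓ≡0⇒~ε (ℕ.≤-trans (ℓ-mono v′≤v) (ℓ≤length {ε} ~-refl))))) w′≤w
  act-upper {s ∷ v} {w} {v′} {w′} red v′≤v w′≤w with lift↓ s v′≤v
  ... | inj₁ v′≤ssv = ≤-⋆ˢ′ s
    (act-upper (reduced-tail red) (≤ᴮ-respʳ (simple-cancelˡ s v) v′≤ssv) w′≤w)
  ... | inj₂ sv′≤ssv = ≤ᴮ-respˡ (simple-cancelˡ s (v′ ∙ w′)) (∙≤⋆ˢ′ s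
    (act-upper (reduced-tail red) (≤ᴮ-respʳ (simple-cancelˡ s v) sv′≤ssv) w′≤w))

  -- Letters that `⋆ˢ` ignores are dropped from `v` alone, so `w` stays intact; `lift↑` keeps the
  -- product of the retained letters below `v`.
  act-attained : ∀ {v} w → IsReduced v → ∃[ v′ ] (v′ ≤ᴮ v × act v w ~ v′ ∙ w)
  act-attained {[]}    w red = ε , ≤ᴮ-refl ~-refl , ~-refl
  act-attained {s ∷ v} w red = extend (act-attained w (reduced-tail red)) (⋆ˢ-cases s (act v w))
    where
    v≤sv = ≤ᴮ-ascent (reduced-ascent red)
    extend : ∀ {x y} → ∃[ v′ ] (v′ ≤ᴮ v × x ~ v′ ∙ w) →
      (ℓ x < ℓ (simple s ∙ x) × y ≡ simple s ∙ x) ⊎ (ℓ (simple s ∙ x) < ℓ x × y ≡ x) →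
      ∃[ v′ ] (v′ ≤ᴮ s ∷ v × y ~ v′ ∙ w)
    extend (v′ , v′≤v , eq) (inj₂ (_ , refl)) = v′ , ≤ᴮ-trans v′≤v v≤sv , eq
    extend (v′ , v′≤v , eq) (inj₁ (_ , refl)) with lift↑ s v′≤v
    ... | inj₁ p = simple s ∙ v′ , ≤ᴮ-trans p v≤sv , ∙-congˡ (simple s) eq
    ... | inj₂ p = simple s ∙ v′ , p , ∙-congˡ (simple s) eq

  ⋆-upper : ∀ {v w v′ w′} → v′ ≤ᴮ v → w′ ≤ᴮ w → v′ ∙ w′ ≤ᴮ v ⋆ w
  ⋆-upper {v} v′≤v = act-upper (reducedWord-reduced v) (≤ᴮ-respʳ (~-sym (reducedWord-~ v)) v′≤v)

  ⋆-attained : ∀ v w → ∃[ v′ ] (v′ ≤ᴮ v × v ⋆ w ~ v′ ∙ w)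
  ⋆-attained v w = let v′ , v′≤ , eq = act-attained w (reducedWord-reduced v)
    in v′ , ≤ᴮ-respʳ (reducedWord-~ v) v′≤ , eq

  ⋆-mono : ∀ {v v′ w w′} → v′ ≤ᴮ v → w′ ≤ᴮ w → v′ ⋆ w′ ≤ᴮ v ⋆ w
  ⋆-mono {v′ = v′} {w′ = w′} v′≤v w′≤w = let v″ , v″≤v′ , eq = ⋆-attained v′ w′
    in ≤ᴮ-respˡ (~-sym eq) (⋆-upper (≤ᴮ-trans v″≤v′ v′≤v) w′≤w)

  ⋆-cong : ∀ {v v′ w w′} → v ~ v′ → w ~ w′ → v ⋆ w ~ v′ ⋆ w′
  ⋆-cong v~ w~ = ≤ᴮ-antisym (⋆-mono (≤ᴮ-refl v~) (≤ᴮ-refl w~)) (⋆-mono (≤ᴮ-refl (~-sym v~)) (≤ᴮ-refl (~-sym w~)))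

  -- Independence of the chosen reduced word: both sides are greatest among the products v′w with v′
  -- ≤ v.
  act-⋆ : ∀ {u v} w → IsReduced u → u ~ v → act u w ~ v ⋆ w
  act-⋆ {u} {v} w red u~v =
    let u′ , u′≤u , eq = act-attained w red
        v′ , v′≤v , eq′ = ⋆-attained v w
    in ≤ᴮ-antisym
      (≤ᴮ-respˡ (~-sym eq) (⋆-upper (≤ᴮ-respʳ u~v u′≤u) (≤ᴮ-refl ~-refl)))
      (≤ᴮ-respˡ (~-sym eq′) (act-upper red (≤ᴮ-respʳ (~-sym u~v) v′≤v) (≤ᴮ-refl ~-refl)))

  ⋆ˢ-cong : ∀ s {v w} → v ~ w → s ⋆ˢ v ~ s ⋆ˢ w
  ⋆ˢ-cong s v~w = ≤ᴮ-antisym (⋆ˢ-mono s (≤ᴮ-refl v~w)) (⋆ˢ-mono s (≤ᴮ-refl (~-sym v~w)))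

  ⋆ˢ-idem : ∀ s w → s ⋆ˢ (s ⋆ˢ w) ≡ s ⋆ˢ w
  ⋆ˢ-idem s w = ⋆ˢ-absorbed (lemma (⋆ˢ-cases s w))
    where
    lemma : (ℓ w < ℓ (simple s ∙ w) × s ⋆ˢ w ≡ simple s ∙ w) ⊎ (ℓ (simple s ∙ w) < ℓ w × s ⋆ˢ w ≡ w) →
      simple s ∙ (s ⋆ˢ w) ≤ᴮ s ⋆ˢ w
    lemma (inj₁ (w<sw , eq)) rewrite eq = ≤ᴮ-respˡ (~-sym (simple-cancelˡ s w)) (≤ᴮ-ascent w<sw)
    lemma (inj₂ (sw<w , eq)) rewrite eq = ≤ᴮ-descent sw<w

  ascent⇒reduced : ∀ {s u} → IsReduced u → ℓ u < ℓ (s ∷ u) → IsReduced (s ∷ u)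
  ascent⇒reduced {s} {u} red u<su v v~su = ℕ.≤-trans
    (subst (_< ℓ (s ∷ u)) (ℓ-reduced red) u<su) (ℓ≤length (~-sym v~su))

  ascent-⋆ : ∀ {s v} w → ℓ v < ℓ (simple s ∙ v) → (simple s ∙ v) ⋆ w ~ s ⋆ˢ (v ⋆ w)
  ascent-⋆ {s} {v} w v<sv = ~-sym (act-⋆ w (ascent⇒reduced (reducedWord-reduced v)
    (subst₂ _<_ (sym (ℓ-cong (reducedWord-~ v))) (sym (ℓ-cong s-red~)) v<sv)) s-red~)
    where
    s-red~ : s ∷ reducedWord v ~ simple s ∙ v
    s-red~ = ∙-congˡ (simple s) (reducedWord-~ v)

  -- If `s` is a descent of `v`, write v = s(sv), where the step from sv to v ascends. Then `v ⋆ w`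
  -- lies in the image of `s ⋆ˢ_`, which is idempotent, so a further `s` changes nothing.
  ⋆ˢ-assoc : ∀ s v w → (s ⋆ˢ v) ⋆ w ~ s ⋆ˢ (v ⋆ w)
  ⋆ˢ-assoc s v w = [ ascending , descending ]′ (⋆ˢ-cases s v)
    where
    fixed : ∀ {x y} → y ~ s ⋆ˢ x → y ~ s ⋆ˢ y
    fixed {x} y~ = ~-trans y~ (~-trans (≡⇒~ (sym (⋆ˢ-idem s x))) (⋆ˢ-cong s (~-sym y~)))
    ascending : ℓ v < ℓ (simple s ∙ v) × s ⋆ˢ v ≡ simple s ∙ v → (s ⋆ˢ v) ⋆ w ~ s ⋆ˢ (v ⋆ w)
    ascending (v<sv , eq) = ~-trans (⋆-cong (≡⇒~ eq) ~-refl) (ascent-⋆ w v<sv)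
    descending : ℓ (simple s ∙ v) < ℓ v × s ⋆ˢ v ≡ v → (s ⋆ˢ v) ⋆ w ~ s ⋆ˢ (v ⋆ w)
    descending (sv<v , eq) = ~-trans (⋆-cong (≡⇒~ eq) ~-refl) (fixed
      (~-trans (⋆-cong (~-sym (simple-cancelˡ s v)) ~-refl)
        (ascent-⋆ w (subst (ℓ (simple s ∙ v) <_) (sym (ℓ-cong (simple-cancelˡ s v))) sv<v))))

  ⋆-assoc : ∀ u v w → (u ⋆ v) ⋆ w ~ u ⋆ (v ⋆ w)
  ⋆-assoc u v w = go (reducedWord u)
    where
    go : ∀ u → act u v ⋆ w ~ act u (v ⋆ w)
    go []      = ~-refl
    go (s ∷ u) = ~-trans (⋆ˢ-assoc s (act u v) w) (⋆ˢ-cong s (go u))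

  ℓ-act : ∀ u w → ℓ (act u w) ≤ length u + ℓ w
  ℓ-act []      w = ℕ.≤-refl
  ℓ-act (s ∷ u) w = ℕ.≤-trans (ℓ-⋆ˢ s (act u w)) (s≤s (ℓ-act u w))

  -- Build the word letter by letter. Where a letter would shorten the product, the exchange
  -- condition deletes a letter instead, so no letter outside `I` ever enters.
  reducedIn : ∀ {I w} → w ∈ W⟨ I ⟩ → ∃[ u ] (All I u × u ~ w × IsReduced u)
  reducedIn {I} {w} (v , v⊆I , v~w) = let u , u⊆I , u~v , red = go v⊆I
    in u , u⊆I , ~-trans u~v v~w , red
    where
    go : ∀ {v} → All I v → ∃[ u ] (All I u × u ~ v × IsReduced u)
    go []                    = [] , [] , ~-refl , λ _ _ → z≤n
    go {s ∷ v} (s∈I ∷ v⊆I) with go v⊆I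
    ... | u , u⊆I , u~v , red with ascent⊎descentˡ s u
    ...   | inj₁ u<su = s ∷ u , s∈I ∷ u⊆I , ∙-congˡ (simple s) u~v , ascent⇒reduced red u<su
    ...   | inj₂ su<u with deletion u (conj (u ⁻¹) (simple s)) odd
      where
      odd : parity u (conj (u ⁻¹) (simple s)) ≡ true
      odd with parity u (conj (u ⁻¹) (simple s)) in eq
      ... | true  = refl
      ... | false = contradiction
        (subst (ℓ u <_) (sym (ℓ-cong (left⇒right u (simple s))))
          (parity⇒ascent u (reflection-conj (u ⁻¹) (reflection-simple s)) eq))
        (ℕ.<-asym su<u)
    ...     | x , x⊆u , len , ut~x = x , All-resp-⊆ x⊆u u⊆I , x~ ,
      -- For any word `y` representing the shortened element, `s ∷ y` represents `u`, so reducedness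
      -- of `u` bounds its length.
      λ y y~x → ℕ.≤-pred (ℕ.≤-trans (ℕ.≤-reflexive (sym len))
        (red (s ∷ y) (~-trans
          (∙-congˡ (simple s) (~-trans y~x (~-trans (~-sym ut~x) (~-sym (left⇒right u (simple s))))))
          (simple-cancelˡ s u))))
      where
      x~ : x ~ s ∷ v
      x~ = ~-trans (~-sym ut~x) (~-trans (~-sym (left⇒right u (simple s))) (∙-congˡ (simple s) u~v))

-- Longest elements and star products of expressions.

module Expressions (em : ExcludedMiddle 0ℓ) (𝒞 : CoxeterMatrix) where
  open Coxeter em 𝒞
  open FinitarySubset using (subset)
  open DoubleCoset using (representative)
  private
    module W = Group W
  open SetoidReasoning W.setoid
  open StrongExchange em 𝒞
  open Bruhat em 𝒞

  ≤ᴮ-totalʳ : ∀ s w → w ≤ᴮ w ∙ simple s ⊎ w ∙ simple s ≤ᴮ w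
  ≤ᴮ-totalʳ s w with ≤ᴮ-total s (w ⁻¹)
  ... | inj₁ p = inj₁ (≤ᴮ-⁻¹-cancel (≤ᴮ-respʳ (~-sym (⁻¹-simple w s)) p))
  ... | inj₂ p = inj₂ (≤ᴮ-⁻¹-cancel (≤ᴮ-respˡ (~-sym (⁻¹-simple w s)) p))

  comparable⇒≤ᴮ : ∀ {u w} → u ≤ᴮ w ⊎ w ≤ᴮ u → ℓ u ≤ ℓ w → u ≤ᴮ w
  comparable⇒≤ᴮ (inj₁ u≤w) _ = u≤w
  comparable⇒≤ᴮ (inj₂ w≤u) ℓu≤ℓw with ≤ᴮ⇒~⊎< w≤u
  ... | inj₁ w~u = ≤ᴮ-refl (~-sym w~u)
  ... | inj₂ w<u = contradiction w<u (ℕ.≤⇒≯ ℓu≤ℓw)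

  longest∈ : ∀ I → longest I ∈ W⟨ subset I ⟩
  longest∈ I = Extrema.argmax-all ℓ W⟨⟩-ε (FinitarySubset.sound I)

  ℓ≤ℓ̂ : ∀ I {w} → w ∈ W⟨ subset I ⟩ → ℓ w ≤ ℓ̂ I
  ℓ≤ℓ̂ I {w} w∈ =
    let ≤ℓ̂ , w~ = All.lookupAny (Extrema.f[xs]≤f[argmax] {f = ℓ} ε (FinitarySubset.elements I))
          (FinitarySubset.complete I w∈)
    in subst (_≤ ℓ̂ I) (sym (ℓ-cong w~)) ≤ℓ̂

  longest-maxˡ : ∀ I → MaxˡIn (subset I) (longest I)
  longest-maxˡ I {s} s∈I = comparable⇒≤ᴮ (swap (≤ᴮ-total s (longest I)))
    (ℓ≤ℓ̂ I (W⟨⟩-∙ (W⟨⟩-simple s∈I) (longest∈ I)))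

  longest-maxʳ : ∀ I → MaxʳIn (subset I) (longest I)
  longest-maxʳ I {s} s∈I = comparable⇒≤ᴮ (swap (≤ᴮ-totalʳ s (longest I)))
    (ℓ≤ℓ̂ I (W⟨⟩-∙ (longest∈ I) (W⟨⟩-simple s∈I)))

  act-absorbed : ∀ {I u y} → MaxˡIn I y → All I u → act u y ≡ y
  act-absorbed max []            = refl
  act-absorbed {y = y} max (_∷_ {x = s} s∈I u⊆I) =
    trans (cong (s ⋆ˢ_) (act-absorbed max u⊆I)) (⋆ˢ-absorbed (max s∈I))

  -- The reduced word fixed by `_⋆_` is exchanged for one with letters in `I`, each of which `y`
  -- absorbs.
  ⋆-absorbed : ∀ {I v y} → MaxˡIn I y → v ∈ W⟨ I ⟩ → v ⋆ y ~ y
  ⋆-absorbed {y = y} max v∈ = let u , u⊆I , u~v , red = reducedIn v∈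
    in ~-trans (~-sym (act-⋆ y red u~v)) (≡⇒~ (act-absorbed max u⊆I))

  ⋆-maxˡ : ∀ {I v} w → MaxˡIn I v → MaxˡIn I (v ⋆ w)
  ⋆-maxˡ {v = v} w max {s} s∈I = let v′ , v′≤v , eq = ⋆-attained v w in
    ≤ᴮ-respˡ (∙-congˡ (simple s) (~-sym eq))
      (⋆-upper (maxˡ-absorbs max (W⟨⟩-simple s∈I) v′≤v) (≤ᴮ-refl (~-refl {w})))

  ⋆-maxʳ : ∀ {I} v {w} → MaxʳIn I w → MaxʳIn I (v ⋆ w)
  ⋆-maxʳ v {w} max {s} s∈I = let v′ , v′≤v , eq = ⋆-attained v w in
    ≤ᴮ-respˡ (~-trans (~-sym (W.assoc v′ w (simple s))) (∙-congʳ (simple s) (~-sym eq)))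
      (⋆-upper v′≤v (max s∈I))

  starProduct-maxˡ : ∀ {I J} (P : Expr I J) → MaxˡIn (subset I) (starProduct P)
  starProduct-maxˡ [ I ]         = longest-maxˡ I
  starProduct-maxˡ (_∷_ {I} _ P) = ⋆-maxˡ (starProduct P) (longest-maxˡ I)

  starProduct-maxʳ : ∀ {I J} (P : Expr I J) → MaxʳIn (subset J) (starProduct P)
  starProduct-maxʳ [ I ]         = longest-maxʳ I
  starProduct-maxʳ (_∷_ {I} _ P) = ⋆-maxʳ (longest I) (starProduct-maxʳ P)

  -- The longest element at the junction occurs in both factors on the right; one copy is absorbed
  -- by the star product of `Q`.
  starProduct-∘ : ∀ {I J K} (P : Expr I J) (Q : Expr J K) →
    starProduct (P ∘ᴱ Q) ~ starProduct P ⋆ starProduct Q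
  starProduct-∘ [ I ]         Q = ~-sym (⋆-absorbed (starProduct-maxˡ Q) (longest∈ I))
  starProduct-∘ (_∷_ {I} _ P) Q = ~-trans (⋆-cong (~-refl {longest I}) (starProduct-∘ P Q))
    (~-sym (⋆-assoc (longest I) (starProduct P) (starProduct Q)))

  -- An element with all right descents in K ends in every element of W_K: for
  -- b ∈ W_K with b < bs, the reflection b s b⁻¹ ∈ W_K is an inversion of y, so
  -- s is one of yb.
  ℓ-∙-reverse : ∀ {K y a} → MaxʳIn K y → All K a → IsReduced a → ℓ (y ∙ reverse a) + length a ≤ ℓ y
  ℓ-∙-reverse {y = y} max [] red = ℕ.≤-reflexive
    (trans (ℕ.+-identityʳ (ℓ (y ∙ ε))) (ℓ-cong (W.identityʳ y)))
  ℓ-∙-reverse {K} {y} {s ∷ a} max (s∈K ∷ a⊆K) red = ℕ.≤-trans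
    (ℕ.≤-reflexive (ℕ.+-suc (ℓ (y ∙ reverse (s ∷ a))) (length a)))
    (ℕ.≤-trans (ℕ.+-monoˡ-≤ (length a) descent) (ℓ-∙-reverse max a⊆K (reduced-tail red)))
    where
    b = reverse a
    bs : reverse (s ∷ a) ≡ b ∙ simple s
    bs = List.unfold-reverse s a
    b∈K : b ∈ W⟨ K ⟩
    b∈K = W⟨⟩-⁻¹ (a , a⊆K , ~-refl)
    b-even : parity b (simple s) ≡ false
    b-even = parity-ascent b (subst₂ _<_ (sym (ℓ-⁻¹ a))
      (trans (sym (ℓ-⁻¹ (s ∷ a))) (ℓ-cong (≡⇒~ bs))) (reduced-ascent red))
    y-odd : parity y (conj b (simple s)) ≡ true
    y-odd with parity y (conj b (simple s)) in eq
    ... | true  = refl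
    ... | false = contradiction (parity⇒ascent y (reflection-conj b (reflection-simple s)) eq)
      (ℕ.≤⇒≯ (ℓ-mono (maxʳ-absorbs max
        (W⟨⟩-∙ (W⟨⟩-∙ b∈K (W⟨⟩-simple s∈K)) (W⟨⟩-⁻¹ b∈K)) (≤ᴮ-refl (~-refl {y})))))
    descent : ℓ (y ∙ reverse (s ∷ a)) < ℓ (y ∙ b)
    descent = subst (_< ℓ (y ∙ b)) (ℓ-cong (~-trans (W.assoc y b (simple s)) (∙-congˡ y (≡⇒~ (sym bs)))))
      (parity⇒descent (y ∙ b) (simple s)
        (trans (parity-∙ y b (simple s)) (cong₂ _xor_ y-odd b-even)))

  -- Choose a reduced word `r ++ a` of `y` with `a` a reduced word of w_K. The letters of `a` act
  -- trivially on `z`, so only the ℓ(y) - ℓ(w_K) letters of `r` can increase the length.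
  ℓ-⋆-overlap : ∀ K {y z} → MaxʳIn (subset K) y → MaxˡIn (subset K) z → ℓ (y ⋆ z) + ℓ̂ K ≤ ℓ y + ℓ z
  ℓ-⋆-overlap K {y} {z} y-max z-max with reducedIn (longest∈ K)
  ... | a , a⊆K , a~ , a-red = ℕ.≤-trans (ℕ.+-monoˡ-≤ (ℓ̂ K) step) (ℕ.≤-trans (ℕ.≤-reflexive rearrange)
      (ℕ.+-monoˡ-≤ (ℓ z) shorter))
    where
    u = y ∙ reverse a
    r = reducedWord u
    ra~y : r ++ a ~ y
    ra~y = ~-trans (∙-congʳ a (reducedWord-~ u)) (cancelʳ y a)
    shorter : ℓ u + length a ≤ ℓ y
    shorter = ℓ-∙-reverse y-max a⊆K a-red
    ra-red : IsReduced (r ++ a)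
    ra-red v v~ra = ℕ.≤-trans (ℕ.≤-reflexive (List.length-++ r))
      (ℕ.≤-trans shorter (ℓ≤length (~-trans (~-sym ra~y) (~-sym v~ra))))
    step : ℓ (y ⋆ z) ≤ ℓ u + ℓ z
    step = subst (_≤ ℓ u + ℓ z)
      (ℓ-cong (~-trans (≡⇒~ (trans (cong (act r) (sym (act-absorbed z-max a⊆K))) (sym (List.foldr-++ _⋆ˢ_ z r a))))
        (act-⋆ z ra-red ra~y)))
      (ℓ-act r z)
    rearrange : ℓ u + ℓ z + ℓ̂ K ≡ ℓ u + length a + ℓ z
    rearrange = trans (cong (ℓ u + ℓ z +_) (trans (sym (ℓ-cong a~)) (ℓ-reduced a-red)))
      (trans (ℕ.+-assoc (ℓ u) (ℓ z) (length a))
      (trans (cong (ℓ u +_) (ℕ.+-comm (ℓ z) (length a))) (sym (ℕ.+-assoc (ℓ u) (length a) (ℓ z)))))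

  ⋖⇒⊆ : ∀ {I J s} → I ⋖ J → s ∈ subset I → s ∈ subset J
  ⋖⇒⊆ (_ , _ , _ , I∪t⊆J) s∈I = I∪t⊆J (inj₁ s∈I)

  -- Sums over the descending steps, so that ℓ(starProduct P) = uppers P − lowers P + ℓ̂ J
  -- for reduced P ending in J.
  uppers lowers : ∀ {I J} → Expr I J → ℕ
  uppers [ _ ]              = 0
  uppers (up _ ∷ P)         = uppers P
  uppers (_∷_ {I} (down _) P) = ℓ̂ I + uppers P
  lowers [ _ ]              = 0
  lowers (up _ ∷ P)         = lowers P
  lowers (_∷_ {J = J} (down _) P) = ℓ̂ J + lowers P

  uppers-∘ : ∀ {I J K} (P : Expr I J) (Q : Expr J K) → uppers (P ∘ᴱ Q) ≡ uppers P + uppers Q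
  uppers-∘ [ _ ]        Q = refl
  uppers-∘ (up _ ∷ P)   Q = uppers-∘ P Q
  uppers-∘ (_∷_ {I} (down _) P) Q = trans (cong (ℓ̂ I +_) (uppers-∘ P Q)) (sym (ℕ.+-assoc (ℓ̂ I) (uppers P) (uppers Q)))

  lowers-∘ : ∀ {I J K} (P : Expr I J) (Q : Expr J K) → lowers (P ∘ᴱ Q) ≡ lowers P + lowers Q
  lowers-∘ [ _ ]        Q = refl
  lowers-∘ (up _ ∷ P)   Q = lowers-∘ P Q
  lowers-∘ (_∷_ {J = J} (down _) P) Q = trans (cong (ℓ̂ J +_) (lowers-∘ P Q)) (sym (ℕ.+-assoc (ℓ̂ J) (lowers P) (lowers Q)))

  -- At an ascending step the smaller longest element is absorbed; at a descending step from `I` to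
  -- `J` the two factors overlap in w_J.
  ℓ-starProduct : ∀ {I J} (P : Expr I J) → ℓ (starProduct P) + lowers P ≤ uppers P + ℓ̂ J
  ℓ-starProduct [ I ] = ℕ.≤-reflexive (ℕ.+-identityʳ (ℓ̂ I))
  ℓ-starProduct (_∷_ {I} {J} (up I⋖J) P) = subst (λ n → n + lowers P ≤ _)
    (sym (ℓ-cong (⋆-absorbed (λ s∈I → starProduct-maxˡ P (⋖⇒⊆ {I} {J} I⋖J s∈I)) (longest∈ I)))) (ℓ-starProduct P)
  ℓ-starProduct {J = K} (_∷_ {I} {J} (down J⋖I) P) = lemma
    {ℓ (longest I ⋆ starProduct P)} {ℓ̂ I} {ℓ̂ J} {ℓ (starProduct P)} {lowers P} {uppers P} {ℓ̂ K}
    (ℓ-⋆-overlap J (λ s∈J → longest-maxʳ I (⋖⇒⊆ {J} {I} J⋖I s∈J)) (starProduct-maxˡ P)) (ℓ-starProduct P)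
    where
    lemma : ∀ {x i j y l u k} → x + j ≤ i + y → y + l ≤ u + k → x + (j + l) ≤ i + u + k
    lemma {x} {i} {j} {y} {l} {u} {k} p q = ℕ.≤-trans (ℕ.≤-reflexive (sym (ℕ.+-assoc x j l)))
      (ℕ.≤-trans (ℕ.+-monoˡ-≤ l p) (ℕ.≤-trans (ℕ.≤-reflexive (ℕ.+-assoc i y l))
      (ℕ.≤-trans (ℕ.+-monoʳ-≤ i q) (ℕ.≤-reflexive (sym (ℕ.+-assoc i u k))))))

  ℓ-factors : ∀ {I J} → Expr I J → ℕ
  ℓ-factors P = sum (map ℓ (factors (climb P)))

  ℓ-factors-fall : ∀ {I J} → FinitarySubset → Expr I J → ℕ
  ℓ-factors-fall K P = sum (map ℓ (factors (fall K P)))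

  -- `factors` treats the last pair specially, so it unfolds at a pair only once the rest of the
  -- list is known to be nonempty.
  climb≢[] : ∀ {I J} (P : Expr I J) → ∃[ x ] ∃[ xs ] climb P ≡ x ∷ xs
  fall≢[] : ∀ {I J} K (P : Expr I J) → ∃[ x ] ∃[ xs ] fall K P ≡ x ∷ xs
  climb≢[] [ _ ]                = _ , _ , refl
  climb≢[] (up _ ∷ P)           = climb≢[] P
  climb≢[] (_∷_ {I} (down _) P) = fall≢[] I P
  fall≢[] K [ _ ]               = _ , _ , refl
  fall≢[] K (up _ ∷ P)          = _ , _ , refl
  fall≢[] K (down _ ∷ P)        = fall≢[] K P

  ℓ-factors-∷ : ∀ {I J} K L (P : Expr I J) →
    sum (map ℓ (factors ((K , L) ∷ climb P))) ≡ ℓ (longest K ∙ longest L ⁻¹) + ℓ-factors P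
  ℓ-factors-∷ K L P with climb P | climb≢[] P
  ... | .(_ ∷ _) | _ , _ , refl = refl

  ℓ̂≤ : ∀ K L → ℓ̂ K ≤ ℓ (longest K ∙ longest L ⁻¹) + ℓ̂ L
  ℓ̂≤ K L = subst (_≤ ℓ (longest K ∙ longest L ⁻¹) + ℓ̂ L) (ℓ-cong (cancelʳ (longest K) (longest L)))
    (ℓ-∙ (longest K ∙ longest L ⁻¹) (longest L))

  -- Within a descending run every intermediate set occurs once among the uppers and once among the
  -- lowers, so only the local maximum K and the local minimum L remain; the factor w_K w_L⁻¹ covers
  -- their difference by the triangle inequality. A run at the end of the expression has the factor
  -- w_K alone, and its L cancels against the final term.
  ℓ-factors-≥ : ∀ {I J} (P : Expr I J) → uppers P + ℓ̂ J ≤ ℓ-factors P + lowers P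
  ℓ-factors-fall-≥ : ∀ {I J} K (P : Expr I J) →
    ℓ̂ K + (uppers P + ℓ̂ J) ≤ ℓ-factors-fall K P + (ℓ̂ I + lowers P)
  ℓ-factors-≥ [ I ] = ℕ.≤-reflexive (sym (trans (ℕ.+-identityʳ _) (ℕ.+-identityʳ (ℓ̂ I))))
  ℓ-factors-≥ (up _ ∷ P) = ℓ-factors-≥ P
  ℓ-factors-≥ {J = K} (_∷_ {I} (down _) P) =
    ℕ.≤-trans (ℕ.≤-reflexive (ℕ.+-assoc (ℓ̂ I) (uppers P) (ℓ̂ K))) (ℓ-factors-fall-≥ I P)
  ℓ-factors-fall-≥ K [ L ] = ℕ.≤-reflexive
    (sym (cong₂ _+_ (ℕ.+-identityʳ (ℓ̂ K)) (ℕ.+-identityʳ (ℓ̂ L))))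
  ℓ-factors-fall-≥ {J = J} K (_∷_ {L} {L′} (down _) P) = ℕ.≤-trans
    (ℕ.≤-reflexive (eq₁ (ℓ̂ K) (ℓ̂ L) (uppers P) (ℓ̂ J)))
    (ℕ.≤-trans (ℕ.+-monoʳ-≤ (ℓ̂ L) (ℓ-factors-fall-≥ K P))
      (ℕ.≤-reflexive (eq₂ (ℓ̂ L) (ℓ-factors-fall K P) (ℓ̂ L′ + lowers P))))
    where
    open +-*-Solver
    eq₁ : ∀ k l u j → k + (l + u + j) ≡ l + (k + (u + j))
    eq₁ = solve 4 (λ k l u j → k :+ (l :+ u :+ j) := l :+ (k :+ (u :+ j))) refl
    eq₂ : ∀ l f x → l + (f + x) ≡ f + (l + x)
    eq₂ = solve 3 (λ l f x → l :+ (f :+ x) := f :+ (l :+ x)) refl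
  ℓ-factors-fall-≥ {J = J} K (_∷_ {L} (up _) P) = ℕ.≤-trans
    (ℕ.+-mono-≤ (ℓ̂≤ K L) (ℓ-factors-≥ P)) (ℕ.≤-reflexive
    (trans (eq (ℓ (longest K ∙ longest L ⁻¹)) (ℓ̂ L) (ℓ-factors P) (lowers P))
      (cong (_+ (ℓ̂ L + lowers P)) (sym (ℓ-factors-∷ K L P)))))
    where
    open +-*-Solver
    eq : ∀ x l f d → x + l + (f + d) ≡ x + f + (l + d)
    eq = solve 4 (λ x l f d → x :+ l :+ (f :+ d) := x :+ f :+ (l :+ d)) refl

  -- Additivity of `uppers` and `lowers` lets the upper bounds for the three pieces be added and
  -- compared with the lower bound for the composite. The final terms of `P` and `Q` leave the
  -- excess `ℓ̂ J + ℓ̂ K`.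
  ℓ-reduced-composition : ∀ {I J K L} (P : Expr I J) (Q : Expr J K) (R : Expr K L) → Reduced (P ∘ᴱ Q ∘ᴱ R) →
    ℓ (starProduct P) + ℓ (starProduct Q) + ℓ (starProduct R) ≤ ℓ (starProduct (P ∘ᴱ Q ∘ᴱ R)) + (ℓ̂ J + ℓ̂ K)
  ℓ-reduced-composition {J = J} {K} {L} P Q R (_ , lengths) = lemma
    (ℓ (starProduct P)) (ℓ (starProduct Q)) (ℓ (starProduct R)) (ℓ (starProduct (P ∘ᴱ Q ∘ᴱ R)))
    (lowers P) (lowers Q) (lowers R) (uppers P) (uppers Q) (uppers R) (ℓ̂ J) (ℓ̂ K) (ℓ̂ L)
    (ℓ-starProduct P) (ℓ-starProduct Q) (ℓ-starProduct R)
    (subst (λ n → uppers (P ∘ᴱ Q ∘ᴱ R) + ℓ̂ L ≤ n + lowers (P ∘ᴱ Q ∘ᴱ R)) lengths (ℓ-factors-≥ (P ∘ᴱ Q ∘ᴱ R)))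
    (trans (uppers-∘ P (Q ∘ᴱ R)) (cong (uppers P +_) (uppers-∘ Q R)))
    (trans (lowers-∘ P (Q ∘ᴱ R)) (cong (lowers P +_) (lowers-∘ Q R)))
    where
    open +-*-Solver
    lemma : ∀ p q r y d₁ d₂ d₃ u₁ u₂ u₃ j k l {u d} → p + d₁ ≤ u₁ + j → q + d₂ ≤ u₂ + k → r + d₃ ≤ u₃ + l →
      u + l ≤ y + d → u ≡ u₁ + (u₂ + u₃) → d ≡ d₁ + (d₂ + d₃) → p + q + r ≤ y + (j + k)
    lemma p q r y d₁ d₂ d₃ u₁ u₂ u₃ j k l p≤ q≤ r≤ y≤ refl refl =
      ℕ.+-cancelʳ-≤ (d₁ + (d₂ + d₃)) _ _ (ℕ.≤-trans
        (ℕ.≤-reflexive (solve 6 (λ p q r d₁ d₂ d₃ →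
          p :+ q :+ r :+ (d₁ :+ (d₂ :+ d₃)) := (p :+ d₁) :+ (q :+ d₂) :+ (r :+ d₃)) refl p q r d₁ d₂ d₃))
        (ℕ.≤-trans (ℕ.+-mono-≤ (ℕ.+-mono-≤ p≤ q≤) r≤)
        (ℕ.≤-trans (ℕ.≤-reflexive (solve 6 (λ u₁ u₂ u₃ j k l →
          (u₁ :+ j) :+ (u₂ :+ k) :+ (u₃ :+ l) := (u₁ :+ (u₂ :+ u₃) :+ l) :+ (j :+ k)) refl u₁ u₂ u₃ j k l))
        (ℕ.≤-trans (ℕ.+-monoˡ-≤ (j + k) y≤)
        (ℕ.≤-reflexive (solve 4 (λ y d j k → y :+ d :+ (j :+ k) := y :+ (j :+ k) :+ d) refl
          y (d₁ + (d₂ + d₃)) j k))))))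

  ℓ-starProduct-∘ : ∀ {I J K L} (P : Expr I J) (Q : Expr J K) (R : Expr K L) →
    ℓ (starProduct (P ∘ᴱ Q ∘ᴱ R)) + (ℓ̂ J + ℓ̂ K) ≤ ℓ (starProduct P) + ℓ (starProduct Q) + ℓ (starProduct R)
  ℓ-starProduct-∘ {J = J} {K} P Q R = lemma {ℓ (starProduct (P ∘ᴱ Q ∘ᴱ R))} {ℓ (starProduct (Q ∘ᴱ R))}
    {ℓ (starProduct P)} {ℓ (starProduct Q)} {ℓ (starProduct R)} {ℓ̂ J} {ℓ̂ K}
    (subst (λ n → n + ℓ̂ J ≤ ℓ (starProduct P) + ℓ (starProduct (Q ∘ᴱ R))) (sym (ℓ-cong (starProduct-∘ P (Q ∘ᴱ R))))
      (ℓ-⋆-overlap J (starProduct-maxʳ P) (starProduct-maxˡ (Q ∘ᴱ R))))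
    (subst (λ n → n + ℓ̂ K ≤ ℓ (starProduct Q) + ℓ (starProduct R)) (sym (ℓ-cong (starProduct-∘ Q R)))
      (ℓ-⋆-overlap K (starProduct-maxʳ Q) (starProduct-maxˡ R)))
    where
    lemma : ∀ {x y p q r j k} → x + j ≤ p + y → y + k ≤ q + r → x + (j + k) ≤ p + q + r
    lemma {x} {y} {p} {q} {r} {j} {k} x≤ y≤ = ℕ.≤-trans (ℕ.≤-reflexive (sym (ℕ.+-assoc x j k)))
      (ℕ.≤-trans (ℕ.+-monoˡ-≤ k x≤) (ℕ.≤-trans (ℕ.≤-reflexive (ℕ.+-assoc p y k))
      (ℕ.≤-trans (ℕ.+-monoʳ-≤ p y≤) (ℕ.≤-reflexive (sym (ℕ.+-assoc p q r))))))

  starProduct-mono : ∀ {I J K L} (P : Expr I J) (Q Q′ : Expr J K) (R : Expr K L) →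
    starProduct Q′ ≤ᴮ starProduct Q → starProduct (P ∘ᴱ Q′ ∘ᴱ R) ≤ᴮ starProduct (P ∘ᴱ Q ∘ᴱ R)
  starProduct-mono P Q Q′ R Q′≤Q = ≤ᴮ-respˡ (~-sym (split Q′)) (≤ᴮ-respʳ (~-sym (split Q))
    (⋆-mono (≤ᴮ-refl (~-refl {starProduct P})) (⋆-mono Q′≤Q (≤ᴮ-refl (~-refl {starProduct R})))))
    where
    split : ∀ Q → starProduct (P ∘ᴱ Q ∘ᴱ R) ~ starProduct P ⋆ (starProduct Q ⋆ starProduct R)
    split Q = ~-trans (starProduct-∘ P (Q ∘ᴱ R)) (⋆-cong (~-refl {starProduct P}) (starProduct-∘ Q R))

  starProduct-expresses : ∀ {I J} (P : Expr I J) → Expresses P (coset (starProduct P))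
  starProduct-expresses P =
    (ε , ε , W⟨⟩-ε , W⟨⟩-ε , ~-sym (W.identityʳ (starProduct P))) ,
    λ y (a , b , a∈ , b∈ , y~) → ≤ᴮ-respˡ (~-sym y~) (maxʳ-absorbs (starProduct-maxʳ P) b∈
      (maxˡ-absorbs (starProduct-maxˡ P) a∈ (≤ᴮ-refl (~-refl {starProduct P}))))

  -- Double cosets: representatives, extremal elements and order.

  ∈ᶜ-resp : ∀ {I J} {p : DoubleCoset I J} {x y} → x ~ y → x ∈ᶜ p → y ∈ᶜ p
  ∈ᶜ-resp x~y (a , b , a∈ , b∈ , x~) = a , b , a∈ , b∈ , ~-trans (~-sym x~y) x~

  ∈ᶜ-translate : ∀ {I J} {p : DoubleCoset I J} {x a b} → a ∈ W⟨ subset I ⟩ → b ∈ W⟨ subset J ⟩ →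
    x ∈ᶜ p → a ∙ x ∙ b ∈ᶜ p
  ∈ᶜ-translate {p = p} {x} {a} {b} a∈ b∈ (c , d , c∈ , d∈ , x~) =
    a ∙ c , d ∙ b , W⟨⟩-∙ a∈ c∈ , W⟨⟩-∙ d∈ b∈ , (begin
      a ∙ x ∙ b              ≈⟨ ∙-congʳ b (∙-congˡ a x~) ⟩
      a ∙ (c ∙ y ∙ d) ∙ b    ≈⟨ ∙-congʳ b (W.assoc a (c ∙ y) d) ⟨
      a ∙ (c ∙ y) ∙ d ∙ b    ≈⟨ W.assoc (a ∙ (c ∙ y)) d b ⟩
      a ∙ (c ∙ y) ∙ (d ∙ b)  ≈⟨ ∙-congʳ (d ∙ b) (W.assoc a c y) ⟨
      a ∙ c ∙ y ∙ (d ∙ b)    ∎)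
    where y = representative p

  untranslate : ∀ a b {x y} → x ~ a ∙ y ∙ b → y ~ a ⁻¹ ∙ x ∙ b ⁻¹
  untranslate a b {x} {y} x~ = ~-sym (begin
    a ⁻¹ ∙ x ∙ b ⁻¹              ≈⟨ W.assoc (a ⁻¹) x (b ⁻¹) ⟩
    a ⁻¹ ∙ (x ∙ b ⁻¹)            ≈⟨ ∙-congˡ (a ⁻¹) (∙-congʳ (b ⁻¹) x~) ⟩
    a ⁻¹ ∙ (a ∙ y ∙ b ∙ b ⁻¹)    ≈⟨ ∙-congˡ (a ⁻¹) (cancelʳ′ (a ∙ y) b) ⟩
    a ⁻¹ ∙ (a ∙ y)               ≈⟨ cancelˡ a y ⟩
    y                            ∎)

  ∈ᶜ-connect : ∀ {I J} {p : DoubleCoset I J} {x y} → x ∈ᶜ p → y ∈ᶜ p →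
    ∃[ a ] ∃[ b ] (a ∈ W⟨ subset I ⟩ × b ∈ W⟨ subset J ⟩ × y ~ a ∙ x ∙ b)
  ∈ᶜ-connect {p = p} {x} {y} (a , b , a∈ , b∈ , x~) (c , d , c∈ , d∈ , y~) =
    c ∙ a ⁻¹ , b ⁻¹ ∙ d , W⟨⟩-∙ c∈ (W⟨⟩-⁻¹ a∈) , W⟨⟩-∙ (W⟨⟩-⁻¹ b∈) d∈ ,
    ~-trans y~ (~-trans (∙-congʳ d (∙-congˡ c (untranslate a b x~)))
      (begin
        c ∙ (a ⁻¹ ∙ x ∙ b ⁻¹) ∙ d     ≈⟨ ∙-congʳ d (W.assoc c (a ⁻¹ ∙ x) (b ⁻¹)) ⟨
        c ∙ (a ⁻¹ ∙ x) ∙ b ⁻¹ ∙ d     ≈⟨ W.assoc (c ∙ (a ⁻¹ ∙ x)) (b ⁻¹) d ⟩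
        c ∙ (a ⁻¹ ∙ x) ∙ (b ⁻¹ ∙ d)   ≈⟨ ∙-congʳ (b ⁻¹ ∙ d) (W.assoc c (a ⁻¹) x) ⟨
        c ∙ a ⁻¹ ∙ x ∙ (b ⁻¹ ∙ d)     ∎))

  ≈ᶜ-sym : ∀ {I J} {p q : DoubleCoset I J} → p ≈ᶜ q → q ≈ᶜ p
  ≈ᶜ-sym (a , b , a∈ , b∈ , p~) = a ⁻¹ , b ⁻¹ , W⟨⟩-⁻¹ a∈ , W⟨⟩-⁻¹ b∈ , untranslate a b p~

  ≈ᶜ-∈ᶜ : ∀ {I J} {p q : DoubleCoset I J} {x} → p ≈ᶜ q → x ∈ᶜ p → x ∈ᶜ q
  ≈ᶜ-∈ᶜ {q = q} p≈q (a , b , a∈ , b∈ , x~) = ∈ᶜ-resp {p = q} (~-sym x~) (∈ᶜ-translate {p = q} a∈ b∈ p≈q)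

  ∈ᶜ-common : ∀ {I J} {p q : DoubleCoset I J} {x} → x ∈ᶜ p → x ∈ᶜ q → p ≈ᶜ q
  ∈ᶜ-common {q = q} (a , b , a∈ , b∈ , x~) x∈q =
    ∈ᶜ-resp {p = q} (~-sym (untranslate a b x~)) (∈ᶜ-translate {p = q} (W⟨⟩-⁻¹ a∈) (W⟨⟩-⁻¹ b∈) x∈q)

  shortest : (X : Pred Word 0ℓ) → ∀ {w} → w ∈ X → ∃[ x ] (x ∈ X × (∀ y → y ∈ X → ℓ x ≤ ℓ y))
  shortest X w∈ = go (<-wellFounded _) w∈
    where
    go : ∀ {w} → Acc _<_ (ℓ w) → w ∈ X → ∃[ x ] (x ∈ X × (∀ y → y ∈ X → ℓ x ≤ ℓ y))
    go {w} (acc rec) w∈ with em {∃[ y ] (y ∈ X × ℓ y < ℓ w)}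
    ... | yes (y , y∈ , y<w) = go (rec y<w) y∈
    ... | no  none           = w , w∈ , λ y y∈ → ℕ.≮⇒≥ (λ y<w → none (y , y∈ , y<w))

  -- An element of least length in the coset is comparable with its product by any generator, hence
  -- lies below it; absorption extends this to all translates.
  minimal : ∀ {I J} (p : DoubleCoset I J) → ∃[ x ] IsMinimal p x
  minimal {I} {J} p with shortest (_∈ᶜ p) {representative p}
    (ε , ε , W⟨⟩-ε , W⟨⟩-ε , ~-sym (W.identityʳ (representative p)))
  ... | x , x∈ , x≤ = x , x∈ , least
    where
    minˡ : MinˡIn (subset I) x
    minˡ {s} s∈I = comparable⇒≤ᴮ (≤ᴮ-total s x) (x≤ _ (∈ᶜ-resp {p = p} (W.identityʳ (simple s ∙ x))
      (∈ᶜ-translate {p = p} (W⟨⟩-simple s∈I) W⟨⟩-ε x∈)))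
    minʳ : MinʳIn (subset J) x
    minʳ {s} s∈J = comparable⇒≤ᴮ (≤ᴮ-totalʳ s x) (x≤ _ (∈ᶜ-translate {p = p} (W⟨⟩-ε) (W⟨⟩-simple s∈J) x∈))
    least : ∀ y → y ∈ᶜ p → x ≤ᴮ y
    least y y∈ = let a , b , a∈ , b∈ , y~ = ∈ᶜ-connect {p = p} x∈ y∈ in
      ≤ᴮ-respʳ (~-sym y~) (minʳ-absorbs minʳ b∈ (minˡ-absorbs minˡ a∈ (≤ᴮ-refl (~-refl {x}))))

  -- Carry `y` to the minimal element of `q`; translation yields an element of `p` below it, and the
  -- minimal element of `p` is lower still.
  ≤ᴮ⇒≤ᶜ : ∀ {I J} {p q : DoubleCoset I J} {x y} → x ∈ᶜ p → y ∈ᶜ q → x ≤ᴮ y → p ≤ᶜ q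
  ≤ᴮ⇒≤ᶜ {p = p} {q} x∈p y∈q x≤y =
    let x₀ , x₀-min = minimal p
        y₀ , y₀-min = minimal q
        a , b , a∈ , b∈ , y₀~ = ∈ᶜ-connect {p = q} y∈q (proj₁ y₀-min)
        a′ , b′ , a′∈ , b′∈ , below = translate-≤ᴮ a∈ b∈ x≤y
    in x₀ , y₀ , x₀-min , y₀-min , ≤ᴮ-trans
      (proj₂ x₀-min _ (∈ᶜ-translate {p = p} a′∈ b′∈ x∈p)) (≤ᴮ-respʳ (~-sym y₀~) below)

  -- Passes from minimal to maximal elements: the star product of `P` is a two-sided translate of
  -- the minimal `x`, and that of `Q` lies above `x` and absorbs the translating elements.
  ≤ᶜ⇒starProduct-≤ᴮ : ∀ {I J} {p q : DoubleCoset I J} (P Q : Expr I J) → Expresses P p → Expresses Q q →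
    p ≤ᶜ q → starProduct P ≤ᴮ starProduct Q
  ≤ᶜ⇒starProduct-≤ᴮ {p = p} P Q (P∈p , _) (_ , Q-max) (x , y , (x∈p , _) , (y∈q , _) , x≤y) =
    let a , b , a∈ , b∈ , P~ = ∈ᶜ-connect {p = p} x∈p P∈p in
    ≤ᴮ-respˡ (~-sym P~) (maxʳ-absorbs (starProduct-maxʳ Q) b∈
      (maxˡ-absorbs (starProduct-maxˡ Q) a∈ (≤ᴮ-trans x≤y (Q-max y y∈q))))

  <ᶜ⇒ℓ-starProduct-< : ∀ {I J} {p q : DoubleCoset I J} (P Q : Expr I J) → Expresses P p → Expresses Q q →
    p <ᶜ q → ℓ (starProduct P) < ℓ (starProduct Q)
  <ᶜ⇒ℓ-starProduct-< {p = p} {q} P Q eP eQ (p≤q , p≉q) with ≤ᴮ⇒~⊎< (≤ᶜ⇒starProduct-≤ᴮ P Q eP eQ p≤q)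
  ... | inj₂ P<Q = P<Q
  ... | inj₁ P~Q = contradiction
    (∈ᶜ-common {p = p} {q} (proj₁ eP) (∈ᶜ-resp {p = q} (~-sym P~Q) (proj₁ eQ))) p≉q

  compose-<ᶜ : ∀ {I J K L} (P : Expr I J) (Q Q′ : Expr J K) (R : Expr K L)
    {q q′ : DoubleCoset J K} {x : DoubleCoset I L} → Expresses Q q → Expresses Q′ q′ → q′ <ᶜ q →
    Reduced (P ∘ᴱ Q ∘ᴱ R) → Expresses (P ∘ᴱ Q ∘ᴱ R) x → coset (starProduct (P ∘ᴱ Q′ ∘ᴱ R)) <ᶜ x
  compose-<ᶜ {I} {J} {K} {L} P Q Q′ R {q} {q′} {x} eQ eQ′ q′<q reduced (PQR∈x , _) =
    ≤ᴮ⇒≤ᶜ {p = y} {x} (proj₁ (starProduct-expresses (P ∘ᴱ Q′ ∘ᴱ R))) PQR∈x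
      (starProduct-mono P Q Q′ R (≤ᶜ⇒starProduct-≤ᴮ Q′ Q eQ′ eQ (proj₁ q′<q))) ,
    -- Were the cosets equal, the star product of `P ∘ᴱ Q ∘ᴱ R` would lie below the maximal element
    -- of `y`, which is shorter.
    λ y≈x → ℕ.≤⇒≯ (ℓ-mono (proj₂ (starProduct-expresses (P ∘ᴱ Q′ ∘ᴱ R)) _
      (≈ᶜ-∈ᶜ {p = x} {y} (≈ᶜ-sym {p = y} {x} y≈x) PQR∈x))) shorter
    where
    y : DoubleCoset I L
    y = coset (starProduct (P ∘ᴱ Q′ ∘ᴱ R))
    shorter : ℓ (starProduct (P ∘ᴱ Q′ ∘ᴱ R)) < ℓ (starProduct (P ∘ᴱ Q ∘ᴱ R))
    shorter = ℕ.+-cancelʳ-< (ℓ̂ J + ℓ̂ K) _ _ (ℕ.≤-<-trans (ℓ-starProduct-∘ P Q′ R)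
      (ℕ.<-≤-trans (ℕ.+-monoˡ-< (ℓ (starProduct R)) (ℕ.+-monoʳ-< (ℓ (starProduct P))
        (<ᶜ⇒ℓ-starProduct-< Q′ Q eQ′ eQ q′<q)))
      (ℓ-reduced-composition P Q R reduced)))

-- Tensoring bimodule maps with identities: sums, degrees and composition.

module Sandwich (a : Level) where
  open GradedAlgebra a hiding (⊗₁-deg)
  open BimoduleMap using (fun)
  open GradedBimodule using (bimodule)

  module _ {A B : Ring a a} {M N : Bimodule A B a a} where
    private
      module M = Bimodule M
      module N = Bimodule N
      module S = CommutativeSemigroupProperties (AbelianGroup.commutativeSemigroup N.+ᴹ-abelianGroup)

    total : List (BimoduleMap M N) → M.Carrierᴹ → N.Carrierᴹ
    total fs x = foldr (λ g y → fun g x N.+ᴹ y) N.0ᴹ fs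

    total-cong : ∀ fs {x y} → x M.≈ᴹ y → total fs x N.≈ᴹ total fs y
    total-cong []       x≈y = N.≈ᴹ-refl
    total-cong (f ∷ fs) x≈y = N.+ᴹ-cong (BimoduleMap.⟦⟧-cong f x≈y) (total-cong fs x≈y)

    total-+ : ∀ fs x y → total fs (x M.+ᴹ y) N.≈ᴹ total fs x N.+ᴹ total fs y
    total-+ []       x y = N.≈ᴹ-sym (N.+ᴹ-identityˡ N.0ᴹ)
    total-+ (f ∷ fs) x y = N.≈ᴹ-trans (N.+ᴹ-cong (BimoduleMap.+ᴹ-homo f x y) (total-+ fs x y))
      (S.interchange (fun f x) (fun f y) (total fs x) (total fs y))

    total-isGroupHomomorphism : ∀ fs → IsGroupHomomorphism M.+ᴹ-rawGroup N.+ᴹ-rawGroup (total fs)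
    total-isGroupHomomorphism fs = additive⇒isGroupHomomorphism M.+ᴹ-abelianGroup N.+ᴹ-abelianGroup
      (total fs) (total-cong fs) (total-+ fs)

    total-map-∘ : ∀ {ℓ ℓ′} {X : Set ℓ} {Y : Set ℓ′} {u : X → BimoduleMap M N} {w : Y → BimoduleMap M N} {h : X → Y} →
      (∀ i x → fun (u i) x N.≈ᴹ fun (w (h i)) x) →
      ∀ is x → total (map u is) x N.≈ᴹ total (map w (map h is)) x
    total-map-∘ u≈wh []       x = N.≈ᴹ-refl
    total-map-∘ u≈wh (i ∷ is) x = N.+ᴹ-cong (u≈wh i x) (total-map-∘ u≈wh is x)

  module _ {A B : Ring a a} {L M N P : Bimodule A B a a} where
    private
      module M = Bimodule M
      module N = Bimodule N
      module P = Bimodule P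

    IsSum-∘ : ∀ {ℓ} {X : Set ℓ} (h : BimoduleMap N P) (k : BimoduleMap L M) {f : BimoduleMap M N}
      {u : X → BimoduleMap M N} → ∀ is → IsSum f (map u is) →
      IsSum (h ∘ᴹ f ∘ᴹ k) (map (λ i → h ∘ᴹ u i ∘ᴹ k) is)
    IsSum-∘ h k {f} {u} is f≈ x = P.≈ᴹ-trans (h.⟦⟧-cong (f≈ (fun k x))) (go is)
      where
      module h = BimoduleMap h
      go : ∀ is → fun h (total (map u is) (fun k x)) P.≈ᴹ total (map (λ i → h ∘ᴹ u i ∘ᴹ k) is) x
      go []       = h.0ᴹ-homo
      go (i ∷ is) = P.≈ᴹ-trans (h.+ᴹ-homo _ _) (P.+ᴹ-congˡ (go is))

  module _ {A B C : GradedRing} where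

    -- The total degree is a separate `k` with an equation, so that tensoring with an identity of
    -- degree 0 leaves degree `i` and not `0ℤ +ℤ i`.
    ⊗₁-deg : ∀ i j {k} → k ≡ i +ℤ j → (M M′ : GradedBimodule A B) (N N′ : GradedBimodule B C)
      (f : BimoduleMap (bimodule M) (bimodule M′)) (g : BimoduleMap (bimodule N) (bimodule N′)) →
      IsDegreeZero M (M′ ⟨ i ⟩) f → IsDegreeZero N (N′ ⟨ j ⟩) g →
      IsDegreeZero (M ⊗ N) ((M′ ⊗ N′) ⟨ k ⟩) (_⊗₁_ {M = M} {M′} {N} {N′} f g)
    ⊗₁-deg i j {k} refl M M′ N N′ f g f-deg g-deg = go
      where
      open Tensor
      fg = _⊗₁_ {M = M} {M′} {N} {N′} f g
      regroup : ∀ d e → i +ℤ d +ℤ (j +ℤ e) ≡ i +ℤ j +ℤ (d +ℤ e)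
      regroup d e = Z.interchange i d j e
        where module Z = CommutativeSemigroupProperties ℤ.+-commutativeSemigroup
      go : IsDegreeZero (M ⊗ N) ((M′ ⊗ N′) ⟨ k ⟩) fg
      go (resp p h)                         = resp (BimoduleMap.⟦⟧-cong fg p) (go h)
      go zero                               = zero
      go (add h h′)                         = add (go h) (go h′)
      go (neg h)                            = neg (go h)
      go (pure {i = d} {j = e} refl m∈ n∈) = pure (regroup d e) (f-deg m∈) (g-deg n∈)

    module _ {ℓ} {X : Set ℓ} (M M′ : GradedBimodule A B) (N N′ : GradedBimodule B C) where
      private
        module T = Tensor M N
        module T′ = Tensor M′ N′
        _⊗ᵐ_ : BimoduleMap (bimodule M) (bimodule M′) → BimoduleMap (bimodule N) (bimodule N′) →
          BimoduleMap (bimodule (M ⊗ N)) (bimodule (M′ ⊗ N′))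
        _⊗ᵐ_ = _⊗₁_ {M = M} {M′} {N} {N′}

      IsSum-⊗ˡ : (g : BimoduleMap (bimodule N) (bimodule N′)) {f : BimoduleMap (bimodule M) (bimodule M′)}
        {u : X → BimoduleMap (bimodule M) (bimodule M′)} → ∀ is → IsSum f (map u is) →
        IsSum (f ⊗ᵐ g) (map (λ i → u i ⊗ᵐ g) is)
      IsSum-⊗ˡ g {f} {u} is f≈ = T.ext T′.+-abelianGroup
        (BimoduleMap.+ᴹ-isGroupHomomorphism (f ⊗ᵐ g))
        (total-isGroupHomomorphism (map (λ i → u i ⊗ᵐ g) is))
        (λ m n → T′.≈-trans (T′.⊗-cong (f≈ m) (GradedBimodule.≈ᴹ-refl N′)) (go m n is))
        where
        go : ∀ m n is → (total (map u is) m T′.⊗ₑ fun g n) T′.≈ₑ total (map (λ i → u i ⊗ᵐ g) is) (m T.⊗ₑ n)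
        go m n []       = T′.0⊗ (fun g n)
        go m n (i ∷ is) = T′.≈-trans (T′.⊗-distribʳ _ _ _) (T′.+-cong T′.≈-refl (go m n is))

      IsSum-⊗ʳ : (f : BimoduleMap (bimodule M) (bimodule M′)) {g : BimoduleMap (bimodule N) (bimodule N′)}
        {u : X → BimoduleMap (bimodule N) (bimodule N′)} → ∀ is → IsSum g (map u is) →
        IsSum (f ⊗ᵐ g) (map (λ i → f ⊗ᵐ u i) is)
      IsSum-⊗ʳ f {g} {u} is g≈ = T.ext T′.+-abelianGroup
        (BimoduleMap.+ᴹ-isGroupHomomorphism (f ⊗ᵐ g))
        (total-isGroupHomomorphism (map (λ i → f ⊗ᵐ u i) is))
        (λ m n → T′.≈-trans (T′.⊗-cong (GradedBimodule.≈ᴹ-refl M′) (g≈ n)) (go m n is))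
        where
        go : ∀ m n is → (fun f m T′.⊗ₑ total (map u is) n) T′.≈ₑ total (map (λ i → f ⊗ᵐ u i) is) (m T.⊗ₑ n)
        go m n []       = T′.⊗0 (fun f m)
        go m n (i ∷ is) = T′.≈-trans (T′.⊗-distribˡ _ _ _) (T′.+-cong T′.≈-refl (go m n is))

  module _ {A B C D : GradedRing} (M : GradedBimodule A B) (P : GradedBimodule C D) where

    infix 8 1⊗_⊗1
    1⊗_⊗1 : {N N′ : GradedBimodule B C} → BimoduleMap (bimodule N) (bimodule N′) →
      BimoduleMap (bimodule (M ⊗ (N ⊗ P))) (bimodule (M ⊗ (N′ ⊗ P)))
    1⊗_⊗1 {N} {N′} f = _⊗₁_ {M = M} {M} {N ⊗ P} {N′ ⊗ P} idMap (_⊗₁_ {M = N} {N′} {P} {P} f idMap)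

    1⊗⊗1-∘ : {N N′ N″ : GradedBimodule B C} (g : BimoduleMap (bimodule N′) (bimodule N″))
      (f : BimoduleMap (bimodule N) (bimodule N′)) → ∀ x →
      GradedBimodule._≈ᴹ_ (M ⊗ (N″ ⊗ P)) (fun (1⊗_⊗1 {N′} {N″} g) (fun (1⊗_⊗1 {N} {N′} f) x))
        (fun (1⊗_⊗1 {N} {N″} (g ∘ᴹ f)) x)
    1⊗⊗1-∘ {N} {N′} {N″} g f = outer
      where
      module I = Tensor N P
      module I″ = Tensor N″ P
      module O = Tensor M (N ⊗ P)
      module O″ = Tensor M (N″ ⊗ P)
      inner : ∀ x → fun (_⊗₁_ {M = N′} {N″} {P} {P} g idMap) (fun (_⊗₁_ {M = N} {N′} {P} {P} f idMap) x)
        I″.≈ₑ fun (_⊗₁_ {M = N} {N″} {P} {P} (g ∘ᴹ f) idMap) x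
      inner (n I.⊗ₑ p) = I″.≈-refl
      inner I.0ₑ       = I″.≈-refl
      inner (x I.+ₑ y) = I″.+-cong (inner x) (inner y)
      inner (I.-ₑ x)   = I″.neg-cong (inner x)
      outer : ∀ x → fun (1⊗_⊗1 {N′} {N″} g) (fun (1⊗_⊗1 {N} {N′} f) x)
        O″.≈ₑ fun (1⊗_⊗1 {N} {N″} (g ∘ᴹ f)) x
      outer (m O.⊗ₑ x) = O″.⊗-cong (GradedBimodule.≈ᴹ-refl M) (inner x)
      outer O.0ₑ       = O″.≈-refl
      outer (x O.+ₑ y) = O″.+-cong (outer x) (outer y)
      outer (O.-ₑ x)   = O″.neg-cong (outer x)

    module _ {N N′ : GradedBimodule B C} {E E′ : GradedBimodule A D}
      (φ : M ⊗ (N ⊗ P) ≅ E) (φ′ : M ⊗ (N′ ⊗ P) ≅ E′) where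
      private
        module φ = _≅_ φ
        module φ′ = _≅_ φ′

      -- Allows different middle bimodules, as the two halves of a factorization require, and
      -- unfolds to `sandwich` when both ends are `BS Q`.
      transport : BimoduleMap (bimodule N) (bimodule N′) → BimoduleMap (bimodule E) (bimodule E′)
      transport f =
        φ′.to ∘ᴹ (_⊗₁_ {M = M} {M} {N ⊗ P} {N′ ⊗ P} idMap
                   (_⊗₁_ {M = N} {N′} {P} {P} f idMap)) ∘ᴹ φ.from

      IsSum-transport : ∀ {ℓ} {X : Set ℓ} {f : BimoduleMap (bimodule N) (bimodule N′)}
        {u : X → BimoduleMap (bimodule N) (bimodule N′)} → ∀ is → IsSum f (map u is) →
        IsSum (transport f) (map (λ i → transport (u i)) is)
      IsSum-transport {f = f} {u} is f≈ = IsSum-∘ φ′.to φ.from {1⊗_⊗1 {N} {N′} f} {λ i → 1⊗_⊗1 {N} {N′} (u i)} is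
        (IsSum-⊗ʳ M M (N ⊗ P) (N′ ⊗ P) idMap
          {_⊗₁_ {M = N} {N′} {P} {P} f idMap} {λ i → _⊗₁_ {M = N} {N′} {P} {P} (u i) idMap} is
          (IsSum-⊗ˡ N N′ P P idMap {f} {u} is f≈))

      transport-total : ∀ {ℓ ℓ′} {X : Set ℓ} {Y : Set ℓ′} (u : X → BimoduleMap (bimodule N) (bimodule N′))
        (w : Y → BimoduleMap (bimodule E) (bimodule E′)) (h : X → Y) →
        (∀ i x → GradedBimodule._≈ᴹ_ E′ (fun (transport (u i)) x) (fun (w (h i)) x)) →
        ∀ {f : BimoduleMap (bimodule N) (bimodule N′)} is → IsSum f (map u is) → ∀ x →
        GradedBimodule._≈ᴹ_ E′ (fun (transport f) x)
          (foldr (λ g y → GradedBimodule._+ᴹ_ E′ (fun g x) y) (GradedBimodule.0ᴹ E′) (map w (map h is)))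
      transport-total u w h u≈wh {f} is f≈ x = GradedBimodule.≈ᴹ-trans E′
        (IsSum-transport {f = f} {u} is f≈ x)
        (total-map-∘ {u = λ i → transport (u i)} {w} {h} u≈wh is x)

      transportⁱ : ∃[ i ] Homⁱ i N N′ → ∃[ i ] Homⁱ i E E′
      transportⁱ (i , f , f-deg) = i , transport f , λ h → φ′.to-deg (deg (φ.from-deg h))
        where
        zeroShift : ∀ {B C} (L : GradedBimodule B C) → IsDegreeZero L (L ⟨ 0ℤ ⟩) idMap
        zeroShift L {d} {x} = subst (λ e → GradedBimodule.Homogeneous L e x) (sym (ℤ.+-identityˡ d))
        deg : IsDegreeZero (M ⊗ (N ⊗ P)) ((M ⊗ (N′ ⊗ P)) ⟨ i ⟩) (1⊗_⊗1 {N} {N′} f)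
        deg = ⊗₁-deg 0ℤ i (sym (ℤ.+-identityˡ i)) M M (N ⊗ P) (N′ ⊗ P) idMap (_⊗₁_ {M = N} {N′} {P} {P} f idMap) (zeroShift M)
          (⊗₁-deg i 0ℤ (sym (ℤ.+-identityʳ i)) N N′ P P f idMap f-deg (zeroShift P))

      transportHom : Hom N N′ → Hom E E′
      transportHom f = record
        { underlying = transport f.underlying
        ; components = map transportⁱ f.components
        ; isSum      = subst (IsSum (transport f.underlying)) (List.map-∘ f.components)
            (IsSum-transport {f = f.underlying} {λ g → proj₁ (proj₂ g)} f.components f.isSum)
        }
        where module f = Hom f

    -- Between the two transported maps, `from` after `to` of the middle isomorphism `φ′` cancels;
    -- what remains is functoriality of tensoring with identities.
    transport-∘ : {N N′ N″ : GradedBimodule B C} {E E′ E″ : GradedBimodule A D}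
      (φ : M ⊗ (N ⊗ P) ≅ E) (φ′ : M ⊗ (N′ ⊗ P) ≅ E′) (φ″ : M ⊗ (N″ ⊗ P) ≅ E″)
      (g : BimoduleMap (bimodule N′) (bimodule N″)) (f : BimoduleMap (bimodule N) (bimodule N′)) → ∀ x →
      GradedBimodule._≈ᴹ_ E″ (fun (transport φ φ″ (g ∘ᴹ f)) x)
        (fun (transport φ′ φ″ g ∘ᴹ transport φ φ′ f) x)
    transport-∘ {N} {N′} {N″} {E″ = E″} φ φ′ φ″ g f x = φ″.⟦⟧-cong
      (≈ᴹ-trans (≈ᴹ-sym (1⊗⊗1-∘ g f (fun (_≅_.from φ) x)))
        (BimoduleMap.⟦⟧-cong (1⊗_⊗1 {N′} {N″} g)
        (GradedBimodule.≈ᴹ-sym (M ⊗ (N′ ⊗ P)) (_≅_.from∘to φ′ _))))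
      where
      module φ″ = BimoduleMap (_≅_.to φ″)
      open GradedBimodule (M ⊗ (N″ ⊗ P)) using (≈ᴹ-sym; ≈ᴹ-trans)

-- Factorizations through lower cosets after composition.

module Compositions (em : ExcludedMiddle 0ℓ) (𝒞 : CoxeterMatrix)
  {c ℓ₁ ℓ₂ v ℓv : Level} (𝕜 : HeytingField c ℓ₁ ℓ₂)
  (𝒱 : Realizations.Realization em 𝒞 𝕜 v ℓv) where
  open Coxeter em 𝒞
  open BottSamelson em 𝒞 𝕜 𝒱
  open Sandwich (c ⊔ ℓ₁ ⊔ v ⊔ ℓv)
  open Expressions em 𝒞
  open BimoduleMap using (fun)
  open GradedBimodule using (bimodule)

  module _ {I J K L : FinitarySubset} (P : Expr I J) (R : Expr K L) where

    sandwiched : (Q Q′ : Expr J K) → Map (BS Q) (BS Q′) → Map (BS (P ∘ᴱ Q ∘ᴱ R)) (BS (P ∘ᴱ Q′ ∘ᴱ R))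
    sandwiched Q Q′ = transport (BS P) (BS R) {BS Q} {BS Q′} {BS (P ∘ᴱ Q ∘ᴱ R)} {BS (P ∘ᴱ Q′ ∘ᴱ R)}
      (join₃ P Q R) (join₃ P Q′ R)

    sandwichedHom : (Q Q′ : Expr J K) → Hom (BS Q) (BS Q′) → Hom (BS (P ∘ᴱ Q ∘ᴱ R)) (BS (P ∘ᴱ Q′ ∘ᴱ R))
    sandwichedHom Q Q′ = transportHom (BS P) (BS R) {BS Q} {BS Q′} {BS (P ∘ᴱ Q ∘ᴱ R)} {BS (P ∘ᴱ Q′ ∘ᴱ R)}
      (join₃ P Q R) (join₃ P Q′ R)

    module _ (Q : Expr J K) {q : DoubleCoset J K} {x : DoubleCoset I L} (eQ : Expresses Q q)
      (reduced : Reduced (P ∘ᴱ Q ∘ᴱ R)) (ePQR : Expresses (P ∘ᴱ Q ∘ᴱ R) x) where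
      private
        module E = GradedBimodule (BS (P ∘ᴱ Q ∘ᴱ R))

      lowerFactorization : Factorization (_<ᶜ q) (BS Q) (BS Q) →
        Factorization (_<ᶜ x) (BS (P ∘ᴱ Q ∘ᴱ R)) (BS (P ∘ᴱ Q ∘ᴱ R))
      lowerFactorization F = record
        { q          = coset (starProduct (P ∘ᴱ F.expression ∘ᴱ R))
        ; q∈C        = compose-<ᶜ P Q F.expression R eQ F.expresses F.q∈C reduced ePQR
        ; expression = P ∘ᴱ F.expression ∘ᴱ R
        ; expresses  = starProduct-expresses (P ∘ᴱ F.expression ∘ᴱ R)
        ; into       = sandwichedHom Q F.expression F.into
        ; outof      = sandwichedHom F.expression Q F.outof
        }
        where module F = Factorization F

      compositeQ : Factorization (_<ᶜ q) (BS Q) (BS Q) → Map (BS Q) (BS Q)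
      compositeQ = Factorization.composite {C = _<ᶜ q} {BS Q} {BS Q}

      compositePQR : Factorization (_<ᶜ x) (BS (P ∘ᴱ Q ∘ᴱ R)) (BS (P ∘ᴱ Q ∘ᴱ R)) →
        Map (BS (P ∘ᴱ Q ∘ᴱ R)) (BS (P ∘ᴱ Q ∘ᴱ R))
      compositePQR = Factorization.composite {C = _<ᶜ x} {BS (P ∘ᴱ Q ∘ᴱ R)} {BS (P ∘ᴱ Q ∘ᴱ R)}

      sandwiched-composite : ∀ F y → fun (sandwiched Q Q (compositeQ F)) y
        E.≈ᴹ fun (compositePQR (lowerFactorization F)) y
      sandwiched-composite F = transport-∘ (BS P) (BS R) {BS Q} {BS F.expression} {BS Q}
        {BS (P ∘ᴱ Q ∘ᴱ R)} {BS (P ∘ᴱ F.expression ∘ᴱ R)} {BS (P ∘ᴱ Q ∘ᴱ R)}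
        (join₃ P Q R) (join₃ P F.expression R) (join₃ P Q R)
        (Hom.underlying F.outof) (Hom.underlying F.into)
        where module F = Factorization F

      sandwiched-lower : ∀ f Fs → IsSum {M = bimodule (BS Q)} {bimodule (BS Q)} f (map compositeQ Fs) →
        IsSum {M = bimodule (BS (P ∘ᴱ Q ∘ᴱ R))} {bimodule (BS (P ∘ᴱ Q ∘ᴱ R))} (sandwich P Q R f)
          (map compositePQR (map lowerFactorization Fs))
      sandwiched-lower f Fs f≈ = transport-total (BS P) (BS R) {BS Q} {BS Q} {BS (P ∘ᴱ Q ∘ᴱ R)} {BS (P ∘ᴱ Q ∘ᴱ R)}
        (join₃ P Q R) (join₃ P Q R) compositeQ compositePQR lowerFactorization sandwiched-composite {f} Fs f≈

proposition3p7 : (em : ExcludedMiddle 0ℓ) (𝒞 : CoxeterMatrix)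
    {c ℓ₁ ℓ₂ v ℓv : Level} (𝕜 : HeytingField c ℓ₁ ℓ₂)
    (𝒱 : Realizations.Realization em 𝒞 𝕜 v ℓv) →
    let open Coxeter em 𝒞
        open Realizations em 𝒞 𝕜
        open BottSamelson em 𝒞 𝕜 𝒱
    in
    IsBalanced 𝒱 →
    IsReflectionFaithful 𝒱 →
    GeneralizedDemazureSurjectivity →
    ∀ {I J K L : FinitarySubset}
    (P : Expr I J) (Q : Expr J K) (R : Expr K L)
    (p : DoubleCoset I J) (q : DoubleCoset J K) (r : DoubleCoset K L)
    (p·q·r : DoubleCoset I L) →
    Reduced P → Expresses P p →
    Reduced Q → Expresses Q q →
    Reduced R → Expresses R r →
    Reduced (P ∘ᴱ Q ∘ᴱ R) → Expresses (P ∘ᴱ Q ∘ᴱ R) p·q·r →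
    ∀ f → f ∈ End[< q ] (BS Q) →
    sandwich P Q R f ∈ End[< p·q·r ] (BS (P ∘ᴱ Q ∘ᴱ R))
proposition3p7 em 𝒞 𝕜 𝒱 _ _ _ P Q R p q r p·q·r _ _ _ eQ _ _ reduced ePQR f (Fs , f≈) =
  map (lowerFactorization P R Q eQ reduced ePQR) Fs , sandwiched-lower P R Q eQ reduced ePQR f Fs f≈
  where open Compositions em 𝒞 𝕜 𝒱
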